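{- For every graph $H$ and every positive integer $\Delta$, there exists an integer $N$ such that if $G$ is a graph of maximum degree at most $\Delta$ and $H$ is not a minor of $G$, then $V(G)$ can be partitioned into three sets $X_1,X_2,X_3$ such that for each $1\le i\le 3$, every connected component of the induced subgraph $G[X_i]$ has at most $N$ vertices.
   Context: All graphs are finite and simple. A graph $H$ is a minor of $G$ if a graph isomorphic to $H$ can be obtained from a subgraph of $G$ by contracting edges. $G[X]$ denotes the subgraph of $G$ induced on $X$. -}

module Defs where

open import Data.Nat using (ℕ; suc; _≤_)
open import Data.Bool using (Bool; true; false)
open import Data.Fin using (Fin; punchIn)
open import Data.Fin.Subset using (Subset; ∣_∣; _∈_)
open import Data.Vec using (tabulate)
open import Data.Product using (Σ; _×_; ∃-syntax)
open import Data.Sum using (_⊎_)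
open import Relation.Binary.PropositionalEquality using (_≡_; _≢_)
open import Relation.Nullary using (¬_)
open import Function.Definitions using (Injective)
open import Function.Bundles using (_⇔_)

record Graph (n : ℕ) : Set where
  field
    adj    : Fin n → Fin n → Bool
    sym    : ∀ a b → adj a b ≡ adj b a
    irrefl : ∀ a → adj a a ≡ false
open Graph public

Edge : ∀ {n} → Graph n → Fin n → Fin n → Set
Edge G a b = adj G a b ≡ true

degree : ∀ {n} → Graph n → Fin n → ℕ
degree G v = ∣ tabulate (adj G v) ∣

MaxDegree≤ : ∀ {n} → Graph n → ℕ → Set
MaxDegree≤ {n} G Δ = ∀ (v : Fin n) → degree G v ≤ Δ

_⊆G_ : ∀ {m n} → Graph m → Graph n → Set
_⊆G_ {m} {n} S G =
  Σ (Fin m → Fin n) λ f → Injective _≡_ _≡_ f × (∀ a b → Edge S a b → Edge G (f a) (f b))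

-- G' is obtained from G by contracting the edge uv: vertex v is removed
-- (vertices of G' are identified with those of G other than v via punchIn v)
-- and u becomes adjacent to every former neighbour of v.
ContractEdge : ∀ {m} → Graph (suc m) → Graph m → Set
ContractEdge {m} G G' =
  Σ (Fin (suc m)) λ u → Σ (Fin (suc m)) λ v → Edge G u v ×
    (∀ (a b : Fin m) →
      Edge G' a b ⇔
        (a ≢ b × (Edge G (punchIn v a) (punchIn v b)
                  ⊎ (punchIn v a ≡ u × Edge G v (punchIn v b))
                  ⊎ (punchIn v b ≡ u × Edge G v (punchIn v a)))))

data Contracts : ∀ {m k} → Graph m → Graph k → Set where
  done : ∀ {m} (G : Graph m) → Contracts G G
  step : ∀ {m k} {G : Graph (suc m)} {G' : Graph m} {C : Graph k} →
         ContractEdge G G' → Contracts G' C → Contracts G C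

_≅_ : ∀ {h k} → Graph h → Graph k → Set
_≅_ {h} {k} H C =
  Σ (Fin h → Fin k) λ f → Σ (Fin k → Fin h) λ g →
    (∀ x → g (f x) ≡ x) × (∀ y → f (g y) ≡ y) ×
    (∀ a b → adj H a b ≡ adj C (f a) (f b))

_≼_ : ∀ {h n} → Graph h → Graph n → Set
_≼_ H G = ∃[ m ] Σ (Graph m) λ S → S ⊆G G × ∃[ k ] Σ (Graph k) λ C → Contracts S C × H ≅ C

data ConnIn {n} (G : Graph n) (X : Fin n → Set) : Fin n → Fin n → Set where
  here : ∀ {u} → X u → ConnIn G X u u
  step : ∀ {u w v} → X u → Edge G u w → ConnIn G X w v → ConnIn G X u v

ComponentsAtMost : ∀ {n} → Graph n → (Fin n → Set) → ℕ → Set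
ComponentsAtMost {n} G X N =
  ∀ (v : Fin n) (S : Subset n) → (∀ u → u ∈ S → ConnIn G X v u) → ∣ S ∣ ≤ N

{-# OPTIONS --safe #-}
-- Breadth-first layers reduce three colours to two: layer j uses the two colours other than j mod 3, so a
-- colour lives on two consecutive layers.  Even layers are coloured first; odd layers are then coloured in
-- the graph that also joins vertices through the small clusters already present on the even layers.
--
-- A bounded-degree graph in which every large vertex set S can be split by a separation shrinking S on both
-- sides has a two-colouring with bounded clusters (as for graphs of bounded tree-width).  That layers have
-- this property is where the excluded minor enters.  Let R be the (connected) union of the layers below the
-- window W.  Contracting W onto its lowest layer, every vertex of W has a neighbour in R.  If a large X ⊆ W
-- cannot be split, cut R into connected pieces, each adjacent to many vertices of X, and link all pairs of
-- pieces through W by Menger's theorem.  Either one path per pair can be chosen disjointly, which gives a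
-- K_t model, or two linkages contain k paths P_i and k paths Q_j such that every P_i meets every Q_j.  In the
-- latter case cut R again, now with respect to the k² points of P_i ∩ Q_j: a piece owning many of these points
-- touches many of the P_i or many of the Q_j, so some t pieces and t disjoint paths form a K_{t,t} model.

module Submission where

open import Defs hiding (sym; step)
open import Data.Bool using (Bool; true; false; not)
import Data.Bool.Properties as Bool
open import Data.Empty using (⊥; ⊥-elim)
import Data.Fin as Fin
open import Data.Fin using (Fin; zero; suc; combine; remQuot; funToFin; finToFun; punchIn; punchOut)
open import Data.Fin.Properties using (any?; all?; suc-injective; 0≢1+n; combine-remQuot; remQuot-combine;
  finToFun-funToFin; punchIn-punchOut; punchIn-injective; punchInᵢ≢i)
open import Data.Fin.Subset using (∣_∣)
open import Data.List using (List; []; _∷_; filter; cartesianProduct; allFin)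
open import Data.List.Membership.Propositional using () renaming (_∈_ to _∈ˡ_)
open import Data.List.Membership.Propositional.Properties using (∈-filter⁺; ∈-filter⁻; ∈-cartesianProduct⁺; ∈-allFin)
open import Data.List.Relation.Unary.Any using (here; there)
open import Data.Maybe as Maybe using (Maybe; just; nothing)
import Data.Nat as ℕ
open import Data.Nat using (ℕ; zero; suc; _+_; _*_; _^_; _≤_; _<_; z≤n; s≤s; _≤?_; _<?_; s≤s⁻¹)
open import Data.Nat.Properties hiding (0≢1+n; _≟_) renaming (suc-injective to ℕ-suc-injective)
open import Data.Nat.Tactic.RingSolver using (solve-∀)
open import Data.Product using (Σ; _×_; _,_; proj₁; proj₂; ∃)
open import Data.Sum as Sum using (_⊎_; inj₁; inj₂)
open import Data.Vec using (lookup; tabulate)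
open import Data.Vec.Properties using (lookup⇒[]=; tabulate∘lookup)
open import Algebra.Properties.CommutativeSemigroup +-commutativeSemigroup using (interchange)
open import Function using (_∘_)
open import Function.Bundles using (mk⇔)
open import Relation.Binary.PropositionalEquality using (_≡_; _≢_; refl; sym; trans; cong; cong₂; subst; subst₂)
open import Relation.Nullary using (¬_; Dec; yes; no; does)
open import Relation.Nullary.Decidable using (_×-dec_; _⊎-dec_; _→-dec_; ¬?; map′; dec-true; dec-false; does-⇔; decidable-stable)

-- A colour occupies an even layer and a neighbouring odd one, and a monochromatic component may
-- zigzag between the two; bounding clusters layer by layer is not enough. Since even clusters are
-- bounded beforehand, the graph with jumps through them still has bounded degree, but its minors
-- are out of control. Its separations are therefore derived from separations of `G` in three
-- consecutive layers: a jump from the middle layer runs through a cluster of that window, and a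
-- separator that absorbs all vertices able to jump through it blocks every jump.
--
-- Bounded degree is also what allows `R` to be cut into many heavy connected pieces: each vertex
-- has few branches, so a minimal heavy branch is not much heavier than required.
--
-- The two-colouring recursion carries a boundary set `S`. While `S` has more than `θ` vertices, a
-- separation replaces it by a smaller boundary on either side; once it is small, it becomes a
-- monochromatic bag, and its at most `θ * Δ` neighbours are the next boundary, with the colours
-- exchanged. At most `θ * Δ` splits lie between two such exchanges, which bounds the bags.

private variable n m : ℕ

-- Finite vertex sets as Boolean predicates

VSet : ℕ → Set
VSet n = Fin n → Bool

infix 4 _∈_ _∉_ _⊑_
-- A record rather than the bare equation `p x ≡ true`, so that `x` and `p` can be inferred from the
-- type even when `p x` computes.
record _∈_ (x : Fin n) (p : VSet n) : Set where
  constructor holds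
  field eq : p x ≡ true
open _∈_ public

_∉_ : Fin n → VSet n → Set
x ∉ p = ¬ (x ∈ p)

_⊑_ : VSet n → VSet n → Set
p ⊑ q = ∀ {x} → x ∈ p → x ∈ q

module Comprehension where
  abstract
    infix 4 _∈?_
    _∈?_ : (x : Fin n) (p : VSet n) → Dec (x ∈ p)
    x ∈? p = map′ holds eq (p x Bool.≟ true)

    -- Abstract, so that a membership statement does not unfold to a decision procedure and `out`
    -- and `into` can read `P?` off the type.
    ⟦_⟧ : {P : Fin n → Set} → (∀ x → Dec (P x)) → VSet n
    ⟦ P? ⟧ x = does (P? x)

    out : {P : Fin n → Set} {P? : ∀ x → Dec (P x)} {x : Fin n} → x ∈ ⟦ P? ⟧ → P x
    out {P? = P?} {x} (holds e) with P? x
    ... | yes h = h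
    out (holds ()) | no _

    into : {P : Fin n → Set} {P? : ∀ x → Dec (P x)} {x : Fin n} → P x → x ∈ ⟦ P? ⟧
    into {P? = P?} {x} h = holds (dec-true (P? x) h)
open Comprehension public

infixr 6 _∪_
infixr 7 _∩_ _∖_
_∪_ _∩_ _∖_ : VSet n → VSet n → VSet n
p ∪ q = ⟦ (λ x → (x ∈? p) ⊎-dec (x ∈? q)) ⟧
p ∩ q = ⟦ (λ x → (x ∈? p) ×-dec (x ∈? q)) ⟧
p ∖ q = ⟦ (λ x → (x ∈? p) ×-dec ¬? (x ∈? q)) ⟧

⁅_⁆ : Fin n → VSet n
⁅ v ⁆ = ⟦ (λ x → x Fin.≟ v) ⟧

full ∅ : VSet n
full _ = true
∅ _ = false

ind : Bool → ℕ
ind true = 1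
ind false = 0

-- Finite sums and cardinalities

module Summation where
  abstract
    ∑ : (Fin n → ℕ) → ℕ
    ∑ {zero} f = 0
    ∑ {suc n} f = f zero + ∑ (f ∘ suc)

    ∑-mono : {f g : Fin n → ℕ} → (∀ i → f i ≤ g i) → ∑ f ≤ ∑ g
    ∑-mono {zero} h = z≤n
    ∑-mono {suc n} h = +-mono-≤ (h zero) (∑-mono (h ∘ suc))

    ∑-cong : {f g : Fin n → ℕ} → (∀ i → f i ≡ g i) → ∑ f ≡ ∑ g
    ∑-cong {zero} h = refl
    ∑-cong {suc n} h = cong₂ _+_ (h zero) (∑-cong (h ∘ suc))

    ∑-+ : (f g : Fin n → ℕ) → ∑ (λ i → f i + g i) ≡ ∑ f + ∑ g
    ∑-+ {zero} f g = refl
    ∑-+ {suc n} f g = trans (cong (f zero + g zero +_) (∑-+ (f ∘ suc) (g ∘ suc)))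
      (interchange (f zero) (g zero) _ _)

    ∑-0 : ∀ n → ∑ {n} (λ _ → 0) ≡ 0
    ∑-0 zero = refl
    ∑-0 (suc n) = ∑-0 n

    ∑-swap : (f : Fin m → Fin n → ℕ) → ∑ (λ i → ∑ (f i)) ≡ ∑ (λ j → ∑ (λ i → f i j))
    ∑-swap {zero} {n} f = sym (∑-0 n)
    ∑-swap {suc m} f = trans (cong (∑ (f zero) +_) (∑-swap (f ∘ suc))) (sym (∑-+ (f zero) _))

    ∑-*ʳ : (f : Fin n → ℕ) (c : ℕ) → ∑ (λ i → f i * c) ≡ ∑ f * c
    ∑-*ʳ {zero} f c = refl
    ∑-*ʳ {suc n} f c = trans (cong (f zero * c +_) (∑-*ʳ (f ∘ suc) c)) (sym (*-distribʳ-+ c (f zero) _))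

    ∑-*ˡ : (c : ℕ) (f : Fin n → ℕ) → ∑ (λ i → c * f i) ≡ c * ∑ f
    ∑-*ˡ c f = trans (∑-cong (λ i → *-comm c (f i))) (trans (∑-*ʳ f c) (*-comm (∑ f) c))

    ∑-const : ∀ n c → ∑ {n} (λ _ → c) ≡ n * c
    ∑-const zero c = refl
    ∑-const (suc n) c = cong (c +_) (∑-const n c)

    ∑-term : (f : Fin n → ℕ) (i : Fin n) → f i ≤ ∑ f
    ∑-term f zero = m≤m+n _ _
    ∑-term f (suc i) = ≤-trans (∑-term (f ∘ suc) i) (m≤n+m _ _)

    ∑-suc : (f : Fin (suc n) → ℕ) → ∑ f ≡ f zero + ∑ (f ∘ suc)
    ∑-suc f = refl
open Summation public

module Cardinality where
  abstract
    card : VSet n → ℕ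
    card p = ∑ (λ i → ind (p i))

    card-∑ : (p : VSet n) → card p ≡ ∑ (λ i → ind (p i))
    card-∑ p = refl

    card-suc : (p : VSet (suc n)) → card p ≡ ind (p zero) + card (p ∘ suc)
    card-suc p = ∑-suc (λ i → ind (p i))

    ind-∈ : ∀ {b} → b ≡ true → ind b ≡ 1
    ind-∈ refl = refl

    card-mono : {p q : VSet n} → p ⊑ q → card p ≤ card q
    card-mono {p = p} {q} h = ∑-mono f
      where
      f : ∀ i → ind (p i) ≤ ind (q i)
      f i with p i in e
      ... | false = z≤n
      ... | true = ≤-reflexive (sym (ind-∈ (eq (h (holds e)))))

    card-full : ∀ n → card {n} full ≡ n
    card-full n = trans (∑-const n 1) (*-identityʳ n)

    card≤n : (p : VSet n) → card p ≤ n
    card≤n {n} p = subst (card p ≤_) (card-full n) (card-mono {q = full} (λ _ → holds refl))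

    -- Double counting of the pairs `(u , v)` with `u ∈ p` and `v ∈ r u`. Most counts below are
    -- instances: degrees with `r` the neighbourhoods, images and injections with `r` singletons or
    -- fibres.
    card-⋃ : (p : VSet m) {q : VSet n} (r : Fin m → VSet n) (k : ℕ) →
      (∀ {v} → v ∈ q → ∃ λ u → u ∈ p × v ∈ r u) → (∀ {u} → u ∈ p → card (r u) ≤ k) →
      card q ≤ card p * k
    card-⋃ p {q} r k cover bound = begin
      card q                                      ≤⟨ ∑-mono f ⟩
      ∑ (λ v → ∑ (λ u → ind (p u) * ind (r u v))) ≡⟨ ∑-swap _ ⟩
      ∑ (λ u → ∑ (λ v → ind (p u) * ind (r u v))) ≡⟨ ∑-cong (λ u → ∑-*ˡ (ind (p u)) _) ⟩
      ∑ (λ u → ind (p u) * card (r u))            ≤⟨ ∑-mono g ⟩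
      ∑ (λ u → ind (p u) * k)                     ≡⟨ ∑-*ʳ _ k ⟩
      card p * k                                  ∎
      where
      open ≤-Reasoning
      f : ∀ v → ind (q v) ≤ ∑ (λ u → ind (p u) * ind (r u v))
      f v with q v in e
      ... | false = z≤n
      ... | true with u , holds a , holds b ← cover (holds e) = ≤-trans (≤-reflexive (sym (cong₂ _*_ (ind-∈ a) (ind-∈ b))))
              (∑-term (λ u → ind (p u) * ind (r u v)) u)
      g : ∀ u → ind (p u) * card (r u) ≤ ind (p u) * k
      g u with p u in e
      ... | false = z≤n
      ... | true = *-monoʳ-≤ 1 (bound (holds e))

    card-∅ : {p : VSet n} → (∀ x → x ∉ p) → card p ≡ 0
    card-∅ {n} {p} h = n≤0⇒n≡0 (subst (card p ≤_) (∑-0 n) (card-mono {q = ∅} (λ {x} e → ⊥-elim (h x e))))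

    card≤1 : {p : VSet n} → (∀ {x y} → x ∈ p → y ∈ p → x ≡ y) → card p ≤ 1
    card≤1 {zero} {p} h = ≤-trans (card≤n p) z≤n
    card≤1 {suc n} {p} h rewrite ∑-suc (λ i → ind (p i)) with p zero in e
    ... | false = card≤1 {p = p ∘ suc} (λ { (holds a) (holds b) → suc-injective (h (holds a) (holds b)) })
    ... | true = s≤s (≤-reflexive (card-∅ {p = p ∘ suc} (λ { x (holds a) → 0≢1+n (h (holds e) (holds a)) })))

    card-⁅⁆ : (v : Fin n) → card ⁅ v ⁆ ≤ 1
    card-⁅⁆ v = card≤1 (λ a b → trans (out a) (sym (out b)))

    card-pos : {p : VSet n} {x : Fin n} → x ∈ p → 1 ≤ card p
    card-pos {p = p} {x} (holds h) = ≤-trans (≤-reflexive (sym (ind-∈ h))) (∑-term (λ i → ind (p i)) x)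

    card-inj : (p : VSet m) (q : VSet n) (f : Fin m → Fin n) → (∀ {x} → x ∈ p → f x ∈ q) →
      (∀ {x y} → x ∈ p → y ∈ p → f x ≡ f y → x ≡ y) → card p ≤ card q
    card-inj p q f f∈ inj = subst (card p ≤_) (*-identityʳ _)
      (card-⋃ q (λ v → ⟦ (λ x → (x ∈? p) ×-dec (f x Fin.≟ v)) ⟧) 1
        (λ {x} h → f x , f∈ h , into (h , refl))
        (λ _ → card≤1 (λ a b → inj (proj₁ (out a)) (proj₁ (out b)) (trans (proj₂ (out a)) (sym (proj₂ (out b)))))))

    inj≤card : (q : VSet n) (f : Fin m → Fin n) → (∀ x → f x ∈ q) →
      (∀ {x y} → f x ≡ f y → x ≡ y) → m ≤ card q
    inj≤card {m = m} q f f∈ inj = subst (_≤ card q) (card-full m)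
      (card-inj full q f (λ {x} _ → f∈ x) (λ _ _ → inj))

    card-split : (p q : VSet n) → card p ≡ card (p ∩ q) + card (p ∖ q)
    card-split p q = trans (∑-cong f) (∑-+ _ _)
      where
      f : ∀ i → ind (p i) ≡ ind ((p ∩ q) i) + ind ((p ∖ q) i)
      f i with (p ∩ q) i in e₁ | (p ∖ q) i in e₂
      ... | true | true = ⊥-elim (proj₂ (out {x = i} (holds e₂)) (proj₂ (out {x = i} (holds e₁))))
      ... | true | false = ind-∈ (eq (proj₁ (out {x = i} (holds e₁))))
      ... | false | true = ind-∈ (eq (proj₁ (out {x = i} (holds e₂))))
      ... | false | false with p i in e₃
      ...   | false = refl
      ...   | true with i ∈? q
      ...     | yes h with () ← trans (sym e₁) (eq {p = p ∩ q} (into (holds e₃ , h)))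
      ...     | no h with () ← trans (sym e₂) (eq {p = p ∖ q} (into (holds e₃ , h)))

    card-∪ : (p q : VSet n) → card (p ∪ q) ≤ card p + card q
    card-∪ p q = subst (_≤ card p + card q) (sym (card-split (p ∪ q) p))
      (+-mono-≤ (card-mono (λ h → proj₂ (out h))) (card-mono f))
      where
      f : (p ∪ q) ∖ p ⊑ q
      f h with out (proj₁ (out h))
      ... | inj₁ a = ⊥-elim (proj₂ (out h) a)
      ... | inj₂ b = b

    card-< : {p q : VSet n} → p ⊑ q → {x : Fin n} → x ∈ q → x ∉ p → card p < card q
    card-< {p = p} {q} h x∈q x∉p = subst (card p <_) (sym (card-split q p))
      (≤-trans (≤-reflexive (+-comm 1 (card p))) (+-mono-≤ (card-mono (λ a → into (h a , a))) (card-pos (into (x∈q , x∉p)))))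

    choose : (p : VSet n) (k : ℕ) → k ≤ card p →
      Σ (Fin k → Fin n) λ f → (∀ i → f i ∈ p) × (∀ {i j} → f i ≡ f j → i ≡ j)
    choose {n} p zero h = (λ ()) , (λ ()) , (λ { {()} })
    choose {zero} p (suc k) h with () ← ≤-trans h (card≤n p)
    choose {suc n} p (suc k) h rewrite ∑-suc (λ i → ind (p i)) with p zero in e
    ... | false with f , f∈ , inj ← choose (p ∘ suc) (suc k) h = suc ∘ f , (λ i → holds (eq (f∈ i))) , (λ a → inj (suc-injective a))
    ... | true with choose (p ∘ suc) k (s≤s⁻¹ h)
    ...   | f , f∈ , inj = g , g∈ , g-inj
      where
      g : Fin (suc k) → Fin (suc n)
      g zero = zero
      g (suc i) = suc (f i)
      g∈ : ∀ i → g i ∈ p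
      g∈ zero = holds e
      g∈ (suc i) = holds (eq (f∈ i))
      g-inj : ∀ {i j} → g i ≡ g j → i ≡ j
      g-inj {zero} {zero} _ = refl
      g-inj {suc i} {suc j} a = cong suc (inj (suc-injective a))
open Cardinality public

module Pigeonhole where
  abstract
    pigeonhole : (p : VSet m) (r : Fin n → VSet m) (d : ℕ) → (∀ {x} → x ∈ p → ∃ λ e → x ∈ r e) →
      n * d < card p → ∃ λ e → d < card (r e)
    pigeonhole {n = n} p r d cover h with any? (λ e → d <? card (r e))
    ... | yes found = found
    ... | no none = ⊥-elim (<⇒≱ h (≤-trans (card-⋃ full r d
            (λ {v} v∈ → proj₁ (cover v∈) , holds refl , proj₂ (cover v∈)) (λ {e} _ → ≮⇒≥ (λ l → none (e , l))))
            (≤-reflexive (cong (_* d) (card-full n)))))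
open Pigeonhole public

collect : ∀ {ℓ} {A : Set ℓ} {B : Fin n → Set ℓ} → (∀ i → A ⊎ B i) → A ⊎ (∀ i → B i)
collect {zero} h = inj₂ (λ ())
collect {suc n} {B = B} h with h zero | collect (h ∘ suc)
... | inj₁ a | _ = inj₁ a
... | inj₂ _ | inj₁ a = inj₁ a
... | inj₂ b | inj₂ c = inj₂ g
  where
  g : ∀ i → B i
  g zero = b
  g (suc i) = c i

-- Connectivity and Menger's theorem

Rel : ℕ → Set₁
Rel n = Fin n → Fin n → Set

data Conn (E : Rel n) (p : VSet n) : Fin n → Fin n → Set where
  stop : ∀ {u} → u ∈ p → Conn E p u u
  step : ∀ {u w v} → u ∈ p → E u w → Conn E p w v → Conn E p u v

module _ {E : Rel n} {p : VSet n} where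
  conn-start : ∀ {u v} → Conn E p u v → u ∈ p
  conn-start (stop h) = h
  conn-start (step h _ _) = h

  conn-end : ∀ {u v} → Conn E p u v → v ∈ p
  conn-end (stop h) = h
  conn-end (step _ _ c) = conn-end c

  conn-trans : ∀ {u v w} → Conn E p u v → Conn E p v w → Conn E p u w
  conn-trans (stop _) d = d
  conn-trans (step h e c) d = step h e (conn-trans c d)

  conn-edge : ∀ {u v} → u ∈ p → E u v → v ∈ p → Conn E p u v
  conn-edge h e h′ = step h e (stop h′)

  conn-sym : (∀ {u v} → E u v → E v u) → ∀ {u v} → Conn E p u v → Conn E p v u
  conn-sym s (stop h) = stop h
  conn-sym s (step h e c) = conn-trans (conn-sym s c) (conn-edge (conn-start c) (s e) h)

  conn-invariant : (P : Fin n → Set) → (∀ {u w} → P u → u ∈ p → w ∈ p → E u w → P w) →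
    ∀ {u v} → Conn E p u v → P u → P v
  conn-invariant P f (stop _) a = a
  conn-invariant P f (step h e c) a = conn-invariant P f c (f a h (conn-start c) e)

conn-mono : {E E′ : Rel n} {p q : VSet n} → (∀ {u v} → E u v → E′ u v) → p ⊑ q →
  ∀ {u v} → Conn E p u v → Conn E′ q u v
conn-mono f g (stop h) = stop (g h)
conn-mono f g (step h e c) = step (g h) (f e) (conn-mono f g c)

conn-within : {E : Rel n} {p q : VSet n} → (∀ {u w} → u ∈ q → u ∈ p → w ∈ p → E u w → w ∈ q) →
  ∀ {u v} → u ∈ q → Conn E p u v → Conn E (p ∩ q) u v
conn-within f a (stop h) = stop (into (h , a))
conn-within f a (step h e c) = step (into (h , a)) e (conn-within f (f a h (conn-start c) e) c)

Connected : Rel n → VSet n → Set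
Connected E p = ∀ {u v} → u ∈ p → v ∈ p → Conn E p u v

hub-connected : {E : Rel n} {p : VSet n} → (∀ {u v} → E u v → E v u) → (r : Fin n) →
  (∀ {v} → v ∈ p → Conn E p v r) → Connected E p
hub-connected s r h a b = conn-trans (h a) (conn-sym s (h b))

∪-connected : {E : Rel n} {p q : VSet n} → (∀ {u v} → E u v → E v u) → Connected E p → Connected E q →
  ∀ {a b} → a ∈ p → b ∈ q → a ≡ b ⊎ E a b → Connected E (p ∪ q)
∪-connected {E = E} {p} {q} s cp cq {a} {b} a∈ b∈ j = hub-connected s a h
  where
  inp : p ⊑ p ∪ q
  inp h = into (inj₁ h)
  inq : q ⊑ p ∪ q
  inq h = into (inj₂ h)
  ba : a ≡ b ⊎ E a b → Conn E (p ∪ q) b a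
  ba (inj₁ refl) = stop (inp a∈)
  ba (inj₂ e) = conn-edge (inq b∈) (s e) (inp a∈)
  h : ∀ {v} → v ∈ p ∪ q → Conn E (p ∪ q) v a
  h v∈ with out v∈
  ... | inj₁ v∈p = conn-mono (λ e → e) inp (cp v∈p a∈)
  ... | inj₂ v∈q = conn-trans (conn-mono (λ e → e) inq (cq v∈q b∈)) (ba j)

-- A path is just a connected vertex set with a vertex in `A` and one in `B`. The models built from
-- linkages use nothing more, and gluing paths becomes taking unions.
record Linkage (E : Rel n) (W A B : VSet n) (k : ℕ) : Set where
  field
    path     : Fin k → VSet n
    inside   : ∀ i → path i ⊑ W
    disjoint : ∀ {i j x} → x ∈ path i → x ∈ path j → i ≡ j
    conn     : ∀ i → Connected E (path i)
    source   : Fin k → Fin n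
    source∈  : ∀ i → source i ∈ path i
    source∈A : ∀ i → source i ∈ A
    target   : Fin k → Fin n
    target∈  : ∀ i → target i ∈ path i
    target∈B : ∀ i → target i ∈ B

record Separation (E : Rel n) (W A B : VSet n) (k : ℕ) : Set where
  field
    L R     : VSet n
    L⊑      : L ⊑ W
    R⊑      : R ⊑ W
    cover   : ∀ {x} → x ∈ W → x ∈ L ⊎ x ∈ R
    A⊑      : A ⊑ L
    B⊑      : B ⊑ R
    crossing : ∀ {u v} → u ∈ L → u ∉ R → v ∈ R → v ∉ L → ¬ E u v
    order   : card (L ∩ R) < k

-- Graphs given by edge lists, so that Menger's theorem can be proved by induction on the edges.
Among : List (Fin n × Fin n) → Rel n
Among es u v = (u , v) ∈ˡ es ⊎ (v , u) ∈ˡ es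

among-sym : {es : List (Fin n × Fin n)} → ∀ {u v} → Among es u v → Among es v u
among-sym (inj₁ h) = inj₂ h
among-sym (inj₂ h) = inj₁ h

injective-onto : {k : ℕ} {p : VSet n} (f : Fin k → Fin n) → (∀ i → f i ∈ p) → (∀ {i j} → f i ≡ f j → i ≡ j) →
  card p ≤ k → ∀ {x} → x ∈ p → ∃ λ i → f i ≡ x
injective-onto {k = k} {p} f f∈ inj le {x} x∈ with any? (λ i → f i Fin.≟ x)
... | yes h = h
... | no h = ⊥-elim (<⇒≱ (s≤s le) (inj≤card p g g∈ g-inj))
  where
  g : Fin (suc k) → Fin _
  g zero = x
  g (suc i) = f i
  g∈ : ∀ i → g i ∈ p
  g∈ zero = x∈
  g∈ (suc i) = f∈ i
  g-inj : ∀ {i j} → g i ≡ g j → i ≡ j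
  g-inj {zero} {zero} _ = refl
  g-inj {zero} {suc j} e = ⊥-elim (h (j , sym e))
  g-inj {suc i} {zero} e = ⊥-elim (h (i , e))
  g-inj {suc i} {suc j} e = cong suc (inj e)

linkage-mono : {k : ℕ} {E E′ : Rel n} {W A B : VSet n} → (∀ {u v} → E u v → E′ u v) → Linkage E W A B k → Linkage E′ W A B k
linkage-mono f Λ = record
  { path = path; inside = inside; disjoint = disjoint
  ; conn = λ i a b → conn-mono f (λ h → h) (conn i a b)
  ; source = source; source∈ = source∈; source∈A = source∈A
  ; target = target; target∈ = target∈; target∈B = target∈B }
  where open Linkage Λ

-- The inductive step of Göring's proof: S is a separation of order less than k once the edge xy is removed,
-- and xy crosses it.  Linkages A–(C ∪ x) on one side and (C ∪ y)–B on the other are glued along C and xy.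
module Glue {E E′ : Rel n} {W A B : VSet n} {k : ℕ} (E⊑ : ∀ {u v} → E u v → E′ u v)
  (E′sym : ∀ {u v} → E′ u v → E′ v u) (S : Separation E W A B k) {x y : Fin n}
  (xy : E′ x y) (x∈L : x ∈ Separation.L S) (x∉R : x ∉ Separation.R S)
  (y∈R : y ∈ Separation.R S) (y∉L : y ∉ Separation.L S)
  (new : ∀ {u v} → E′ u v → E u v ⊎ (u ≡ x × v ≡ y ⊎ u ≡ y × v ≡ x)) where
  open Separation S
  C P Q : VSet n
  C = L ∩ R
  P = C ∪ ⁅ x ⁆
  Q = C ∪ ⁅ y ⁆

  C⊑P : C ⊑ P
  C⊑P h = into (inj₁ h)
  C⊑Q : C ⊑ Q
  C⊑Q h = into (inj₁ h)
  x∈P : x ∈ P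
  x∈P = into (inj₂ (into refl))
  y∈Q : y ∈ Q
  y∈Q = into (inj₂ (into refl))

  P⊑L : P ⊑ L
  P⊑L h with out h
  ... | inj₁ c = proj₁ (out c)
  ... | inj₂ e with refl ← out e = x∈L
  Q⊑R : Q ⊑ R
  Q⊑R h with out h
  ... | inj₁ c = proj₂ (out c)
  ... | inj₂ e with refl ← out e = y∈R

  -- Adding all of `R` to the right side does not enlarge the separator, since `D.L` meets `R`
  -- inside `C`, and `C ⊑ P ⊑ D.R`. The edge `xy` does not cross because `x ∈ P` lies in `D.R`. The
  -- lemma `sepʳ` is its mirror image.
  sepˡ : Separation E L A P k → Separation E′ W A B k
  sepˡ D = record
    { L = D.L; R = D.R ∪ R
    ; L⊑ = λ h → L⊑ (D.L⊑ h)
    ; R⊑ = R⊑′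
    ; cover = cover′
    ; A⊑ = D.A⊑
    ; B⊑ = λ h → into (inj₂ (B⊑ h))
    ; crossing = crossing′
    ; order = ≤-<-trans (card-mono meet) D.order }
    where
    module D = Separation D
    R⊑′ : D.R ∪ R ⊑ W
    R⊑′ h with out h
    ... | inj₁ a = L⊑ (D.R⊑ a)
    ... | inj₂ a = R⊑ a
    cover′ : ∀ {z} → z ∈ W → z ∈ D.L ⊎ z ∈ D.R ∪ R
    cover′ h with cover h
    ... | inj₂ a = inj₂ (into (inj₂ a))
    ... | inj₁ a with D.cover a
    ...   | inj₁ b = inj₁ b
    ...   | inj₂ b = inj₂ (into (inj₁ b))
    meet : D.L ∩ (D.R ∪ R) ⊑ D.L ∩ D.R
    meet h with out h
    ... | a , b with out b
    ...   | inj₁ c = into (a , c)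
    ...   | inj₂ c = into (a , D.B⊑ (C⊑P (into (D.L⊑ a , c))))
    crossing′ : ∀ {u v} → u ∈ D.L → u ∉ D.R ∪ R → v ∈ D.R ∪ R → v ∉ D.L → ¬ E′ u v
    crossing′ {u} {v} uL u∉ vR v∉ e with new e
    ... | inj₂ (inj₁ (refl , _)) = u∉ (into (inj₁ (D.B⊑ x∈P)))
    ... | inj₂ (inj₂ (refl , _)) = y∉L (D.L⊑ uL)
    ... | inj₁ e₁ with v ∈? L
    ...   | no v∉L with out vR
    ...     | inj₁ a = v∉L (D.R⊑ a)
    ...     | inj₂ a = crossing (D.L⊑ uL) (λ h → u∉ (into (inj₂ h))) a v∉L e₁
    crossing′ {u} {v} uL u∉ vR v∉ e | inj₁ e₁ | yes v∈L with D.cover v∈L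
    ... | inj₁ a = v∉ a
    ... | inj₂ a = D.crossing uL (λ h → u∉ (into (inj₁ h))) a v∉ e₁

  sepʳ : Separation E R Q B k → Separation E′ W A B k
  sepʳ D = record
    { L = L ∪ D.L; R = D.R
    ; L⊑ = L⊑′
    ; R⊑ = λ h → R⊑ (D.R⊑ h)
    ; cover = cover′
    ; A⊑ = λ h → into (inj₁ (A⊑ h))
    ; B⊑ = D.B⊑
    ; crossing = crossing′
    ; order = ≤-<-trans (card-mono meet) D.order }
    where
    module D = Separation D
    L⊑′ : L ∪ D.L ⊑ W
    L⊑′ h with out h
    ... | inj₁ a = L⊑ a
    ... | inj₂ a = R⊑ (D.L⊑ a)
    cover′ : ∀ {z} → z ∈ W → z ∈ L ∪ D.L ⊎ z ∈ D.R
    cover′ h with cover h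
    ... | inj₁ a = inj₁ (into (inj₁ a))
    ... | inj₂ a with D.cover a
    ...   | inj₁ b = inj₁ (into (inj₂ b))
    ...   | inj₂ b = inj₂ b
    meet : (L ∪ D.L) ∩ D.R ⊑ D.L ∩ D.R
    meet h with out h
    ... | b , a with out b
    ...   | inj₂ c = into (c , a)
    ...   | inj₁ c = into (D.A⊑ (C⊑Q (into (c , D.R⊑ a))) , a)
    crossing′ : ∀ {u v} → u ∈ L ∪ D.L → u ∉ D.R → v ∈ D.R → v ∉ L ∪ D.L → ¬ E′ u v
    crossing′ {u} {v} uL u∉ vR v∉ e with new e
    ... | inj₂ (inj₁ (_ , refl)) = v∉ (into (inj₂ (D.A⊑ y∈Q)))
    ... | inj₂ (inj₂ (_ , refl)) = x∉R (D.R⊑ vR)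
    ... | inj₁ e₁ with u ∈? R
    ...   | no u∉R with out uL
    ...     | inj₁ a = crossing a u∉R (D.R⊑ vR) (λ h → v∉ (into (inj₁ h))) e₁
    ...     | inj₂ a = u∉R (D.L⊑ a)
    crossing′ {u} {v} uL u∉ vR v∉ e | inj₁ e₁ | yes u∈R with D.cover u∈R
    ... | inj₁ a = D.crossing a u∉ vR (λ h → v∉ (into (inj₂ h))) e₁
    ... | inj₂ a = u∉ a

  card-P : card P ≤ k
  card-P = ≤-trans (card-∪ C ⁅ x ⁆) (≤-trans (+-monoʳ-≤ (card C) (card-⁅⁆ x)) (subst (_≤ k) (+-comm 1 (card C)) order))
  card-Q : card Q ≤ k
  card-Q = ≤-trans (card-∪ C ⁅ y ⁆) (≤-trans (+-monoʳ-≤ (card C) (card-⁅⁆ y)) (subst (_≤ k) (+-comm 1 (card C)) order))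

  module _ (Λ : Linkage E L A P k) (Μ : Linkage E R Q B k) where
    module Λ = Linkage Λ
    module Μ = Linkage Μ

    -- The order of `S` is below `k`, so `P` has at most `k` vertices and the ends of `k` disjoint
    -- paths exhaust it. This is why paths on the two sides can be matched along `C` and the edge
    -- `xy`.
    onto-P : ∀ {z} → z ∈ P → ∃ λ i → Λ.target i ≡ z
    onto-P = injective-onto Λ.target Λ.target∈B
      (λ {i} {j} e → Λ.disjoint (Λ.target∈ i) (subst (_∈ Λ.path j) (sym e) (Λ.target∈ j))) card-P

    onto-Q : ∀ {z} → z ∈ Q → ∃ λ i → Μ.source i ≡ z
    onto-Q = injective-onto Μ.source Μ.source∈A
      (λ {i} {j} e → Μ.disjoint (Μ.source∈ i) (subst (_∈ Μ.path j) (sym e) (Μ.source∈ j))) card-Q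

    -- The vertex `z` is the end of some path, and disjointness makes that path the `i`-th one.
    -- Hence paths never have to be trimmed before gluing.
    only-P : ∀ {i z} → z ∈ Λ.path i → z ∈ P → Λ.target i ≡ z
    only-P {i} {z} a b with j , refl ← onto-P b = cong Λ.target (Λ.disjoint a (Λ.target∈ j)) 
    partner : ∀ {z} → z ∈ P → Σ (Fin k) λ j → Μ.source j ≡ z × z ∈ C ⊎ Μ.source j ≡ y × z ≡ x
    partner h with out h
    ... | inj₁ c with j , e ← onto-Q (C⊑Q c) = j , inj₁ (e , c)
    ... | inj₂ s with refl ← out s | j , e ← onto-Q y∈Q = j , inj₂ (e , refl)

    next : Fin k → Fin k
    next i = proj₁ (partner (Λ.target∈B i))

    next-spec : ∀ i → Μ.source (next i) ≡ Λ.target i × Λ.target i ∈ C ⊎ Μ.source (next i) ≡ y × Λ.target i ≡ x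
    next-spec i = proj₂ (partner (Λ.target∈B i))

    target-inj : ∀ {i j} → Λ.target i ≡ Λ.target j → i ≡ j
    target-inj {i} {j} e = Λ.disjoint (Λ.target∈ i) (subst (_∈ Λ.path j) (sym e) (Λ.target∈ j))

    y∉C : y ∉ C
    y∉C h = y∉L (proj₁ (out h))

    next-inj : ∀ {i j} → next i ≡ next j → i ≡ j
    next-inj {i} {j} e with next-spec i | next-spec j
    ... | inj₁ (a , _) | inj₁ (b , _) = target-inj (trans (sym a) (trans (cong Μ.source e) b))
    ... | inj₂ (_ , a) | inj₂ (_ , b) = target-inj (trans a (sym b))
    ... | inj₁ (a , c) | inj₂ (b , _) = ⊥-elim (y∉C (subst (_∈ C) (trans (sym a) (trans (cong Μ.source e) b)) c))
    ... | inj₂ (b , _) | inj₁ (a , c) = ⊥-elim (y∉C (subst (_∈ C) (trans (sym a) (trans (cong Μ.source (sym e)) b)) c))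

    -- A vertex on both sides lies in C, hence is the end of both its paths.
    meet : ∀ {i j z} → z ∈ Λ.path i → z ∈ Μ.path j → j ≡ next i
    meet {i} {j} {z} a b with z∈C ← into {P? = λ v → (v ∈? L) ×-dec (v ∈? R)} (Λ.inside i a , Μ.inside j b) with next-spec i
    ... | inj₁ (e , _) = Μ.disjoint b (subst (_∈ Μ.path (next i)) (trans e (only-P a (C⊑P z∈C))) (Μ.source∈ (next i)))
    ... | inj₂ (_ , e) = ⊥-elim (x∉R (subst (_∈ R) (trans (sym (only-P a (C⊑P z∈C))) e) (proj₂ (out z∈C))))

    glue : Linkage E′ W A B k
    glue = record
      { path = λ i → Λ.path i ∪ Μ.path (next i)
      ; inside = inside
      ; disjoint = disjoint
      ; conn = λ i → ∪-connected E′sym (λ a b → conn-mono E⊑ (λ h → h) (Λ.conn i a b))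
                 (λ a b → conn-mono E⊑ (λ h → h) (Μ.conn (next i) a b)) (Λ.target∈ i) (Μ.source∈ (next i)) (joint i)
      ; source = Λ.source
      ; source∈ = λ i → into (inj₁ (Λ.source∈ i))
      ; source∈A = Λ.source∈A
      ; target = Μ.target ∘ next
      ; target∈ = λ i → into (inj₂ (Μ.target∈ (next i)))
      ; target∈B = λ i → Μ.target∈B (next i) }
      where
      joint : ∀ i → Λ.target i ≡ Μ.source (next i) ⊎ E′ (Λ.target i) (Μ.source (next i))
      joint i with next-spec i
      ... | inj₁ (e , _) = inj₁ (sym e)
      ... | inj₂ (e , f) = inj₂ (subst₂ E′ (sym f) (sym e) xy)
      inside : ∀ i → Λ.path i ∪ Μ.path (next i) ⊑ W
      inside i h with out h
      ... | inj₁ a = L⊑ (Λ.inside i a)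
      ... | inj₂ a = R⊑ (Μ.inside _ a)
      disjoint : ∀ {i j z} → z ∈ Λ.path i ∪ Μ.path (next i) → z ∈ Λ.path j ∪ Μ.path (next j) → i ≡ j
      disjoint a b with out a | out b
      ... | inj₁ c | inj₁ d = Λ.disjoint c d
      ... | inj₂ c | inj₂ d = next-inj (Μ.disjoint c d)
      ... | inj₁ c | inj₂ d = next-inj (sym (meet c d))
      ... | inj₂ c | inj₁ d = next-inj (meet d c)

separation-mono : {k : ℕ} {E E′ : Rel n} {W A B : VSet n} → (S : Separation E W A B k) → 
  (∀ {u v} → u ∈ Separation.L S → u ∉ Separation.R S → v ∈ Separation.R S → v ∉ Separation.L S → ¬ E′ u v) →
  Separation E′ W A B k
separation-mono S c = record { L = L; R = R; L⊑ = L⊑; R⊑ = R⊑; cover = cover; A⊑ = A⊑; B⊑ = B⊑; crossing = c; order = order }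
  where open Separation S

-- Without edges, single vertices of `A ∩ B` are the only paths. With a new edge the only trouble is
-- that it crosses the separation found without it; the induction hypothesis is then applied twice
-- more, to the two sides of that separation.
menger-list : (es : List (Fin n × Fin n)) (W A B : VSet n) (k : ℕ) → A ⊑ W → B ⊑ W →
  Separation (Among es) W A B k ⊎ Linkage (Among es) W A B k
menger-list [] W A B k A⊑W B⊑W with k ≤? card (A ∩ B)
... | yes le with f , f∈ , inj ← choose (A ∩ B) k le = inj₂ record
  { path = λ i → ⁅ f i ⁆
  ; inside = λ i h → subst (_∈ W) (sym (out h)) (A⊑W (proj₁ (out (f∈ i))))
  ; disjoint = λ a b → inj (trans (sym (out a)) (out b))
  ; conn = λ i a b → subst (Conn _ _ _) (trans (out a) (sym (out b))) (stop a)
  ; source = f; source∈ = λ i → into refl; source∈A = λ i → proj₁ (out (f∈ i))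
  ; target = f; target∈ = λ i → into refl; target∈B = λ i → proj₂ (out (f∈ i)) }
... | no gt = inj₁ record
  { L = A; R = (W ∖ A) ∪ B
  ; L⊑ = A⊑W; R⊑ = R⊑W
  ; cover = cover
  ; A⊑ = λ h → h; B⊑ = λ h → into (inj₂ h)
  ; crossing = λ { _ _ _ _ (inj₁ ()) ; _ _ _ _ (inj₂ ()) }
  ; order = ≤-<-trans (card-mono meet) (≰⇒> gt) }
  where
  R⊑W : (W ∖ A) ∪ B ⊑ W
  R⊑W h with out h
  ... | inj₁ a = proj₁ (out a)
  ... | inj₂ a = B⊑W a
  cover : ∀ {x} → x ∈ W → x ∈ A ⊎ x ∈ (W ∖ A) ∪ B
  cover {x} h with x ∈? A
  ... | yes a = inj₁ a
  ... | no a = inj₂ (into (inj₁ (into (h , a))))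
  meet : A ∩ ((W ∖ A) ∪ B) ⊑ A ∩ B
  meet h with out h
  ... | a , b with out b
  ...   | inj₁ c = ⊥-elim (proj₂ (out c) a)
  ...   | inj₂ c = into (a , c)
menger-list {n} ((x , y) ∷ es) W A B k A⊑W B⊑W with menger-list es W A B k A⊑W B⊑W
... | inj₂ Λ = inj₂ (linkage-mono (λ { (inj₁ h) → inj₁ (there h) ; (inj₂ h) → inj₂ (there h) }) Λ)
... | inj₁ S = decide
  where
  open Separation S
  more : ∀ {u v} → Among es u v → Among ((x , y) ∷ es) u v
  more (inj₁ h) = inj₁ (there h)
  more (inj₂ h) = inj₂ (there h)
  new : ∀ {u v} → Among ((x , y) ∷ es) u v → Among es u v ⊎ (u ≡ x × v ≡ y ⊎ u ≡ y × v ≡ x)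
  new (inj₁ (here refl)) = inj₂ (inj₁ (refl , refl))
  new (inj₁ (there h)) = inj₁ (inj₁ h)
  new (inj₂ (here refl)) = inj₂ (inj₂ (refl , refl))
  new (inj₂ (there h)) = inj₁ (inj₂ h)
  new′ : ∀ {u v} → Among ((x , y) ∷ es) u v → Among es u v ⊎ (u ≡ y × v ≡ x ⊎ u ≡ x × v ≡ y)
  new′ e with new e
  ... | inj₁ h = inj₁ h
  ... | inj₂ (inj₁ h) = inj₂ (inj₂ h)
  ... | inj₂ (inj₂ h) = inj₂ (inj₁ h)
  across? : ∀ a b → Dec ((a ∈ L × a ∉ R) × (b ∈ R × b ∉ L))
  across? a b = ((a ∈? L) ×-dec ¬? (a ∈? R)) ×-dec ((b ∈? R) ×-dec ¬? (b ∈? L))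
  Result : Set
  Result = Separation (Among ((x , y) ∷ es)) W A B k ⊎ Linkage (Among ((x , y) ∷ es)) W A B k
  module Cross {a b : Fin n} (ab : Among ((x , y) ∷ es) a b) (a∈L : a ∈ L) (a∉R : a ∉ R) (b∈R : b ∈ R) (b∉L : b ∉ L)
    (new : ∀ {u v} → Among ((x , y) ∷ es) u v → Among es u v ⊎ (u ≡ a × v ≡ b ⊎ u ≡ b × v ≡ a)) where
    open Glue {E = Among es} {E′ = Among ((x , y) ∷ es)} more among-sym S ab a∈L a∉R b∈R b∉L new
    result : Separation (Among es) L A P k ⊎ Linkage (Among es) L A P k →
             Separation (Among es) R Q B k ⊎ Linkage (Among es) R Q B k → Result
    result (inj₁ D) _ = inj₁ (sepˡ D)
    result (inj₂ _) (inj₁ D) = inj₁ (sepʳ D)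
    result (inj₂ Λ) (inj₂ Μ) = inj₂ (glue Λ Μ)
  decide : Result
  decide with across? x y | across? y x
  ... | yes ((a , b) , (c , d)) | _ =
    let open Cross (inj₁ (here refl)) a b c d new
        open Glue {E = Among es} {E′ = Among ((x , y) ∷ es)} more among-sym S (inj₁ (here refl)) a b c d new
    in result (menger-list es L A P k A⊑ P⊑L) (menger-list es R Q B k Q⊑R B⊑)
  ... | no _ | yes ((a , b) , (c , d)) =
    let open Cross (inj₂ (here refl)) a b c d new′
        open Glue {E = Among es} {E′ = Among ((x , y) ∷ es)} more among-sym S (inj₂ (here refl)) a b c d new′
    in result (menger-list es L A P k A⊑ P⊑L) (menger-list es R Q B k Q⊑R B⊑)
  ... | no h | no h′ = inj₁ (separation-mono S crossing′)
    where
    crossing′ : ∀ {u v} → u ∈ L → u ∉ R → v ∈ R → v ∉ L → ¬ Among ((x , y) ∷ es) u v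
    crossing′ a b c d e with new e
    ... | inj₁ e₁ = crossing a b c d e₁
    ... | inj₂ (inj₁ (refl , refl)) = h ((a , b) , (c , d))
    ... | inj₂ (inj₂ (refl , refl)) = h′ ((a , b) , (c , d))

-- Menger's theorem for graphs, bounded degree and reachability

edge-sym : (G : Graph n) → ∀ {u v} → Edge G u v → Edge G v u
edge-sym G {u} {v} e = trans (Graph.sym G v u) e

edge? : (G : Graph n) → ∀ u v → Dec (Edge G u v)
edge? G u v = adj G u v Bool.≟ true

edges : Graph n → List (Fin n × Fin n)
edges {n} G = filter (λ (u , v) → edge? G u v) (cartesianProduct (allFin n) (allFin n))

menger : (G : Graph n) (W A B : VSet n) (k : ℕ) → A ⊑ W → B ⊑ W →
  Separation (Edge G) W A B k ⊎ Linkage (Edge G) W A B k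
menger {n} G W A B k A⊑ B⊑ with menger-list (edges G) W A B k A⊑ B⊑
... | inj₁ S = inj₁ (separation-mono S (λ a b c d e → Separation.crossing S a b c d
        (inj₁ (∈-filter⁺ _ (∈-cartesianProduct⁺ (∈-allFin _) (∈-allFin _)) e))))
... | inj₂ Λ = inj₂ (linkage-mono from Λ)
  where
  from : ∀ {u v} → Among (edges G) u v → Edge G u v
  from (inj₁ h) = proj₂ (∈-filter⁻ _ {xs = cartesianProduct (allFin n) (allFin n)} h)
  from (inj₂ h) = edge-sym G (proj₂ (∈-filter⁻ _ {xs = cartesianProduct (allFin n) (allFin n)} h))

size-tabulate : (p : VSet n) → ∣ tabulate p ∣ ≡ card p
size-tabulate {zero} p = sym (n≤0⇒n≡0 (card≤n p))
size-tabulate {suc n} p rewrite card-suc p with p zero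
... | true = cong suc (size-tabulate (p ∘ suc))
... | false = size-tabulate (p ∘ suc)

Degree≤ : Graph n → ℕ → Set
Degree≤ G Δ = ∀ v → card (adj G v) ≤ Δ

module Reach (G : Graph n) (p : VSet n) (r : Fin n) (r∈p : r ∈ p) where
  reach : ℕ → VSet n
  reach zero = ⁅ r ⁆
  reach (suc k) = ⟦ (λ v → (v ∈? reach k) ⊎-dec ((v ∈? p) ×-dec any? (λ u → (u ∈? reach k) ×-dec edge? G u v))) ⟧

  reach-suc : ∀ k → reach k ⊑ reach (suc k)
  reach-suc k h = into (inj₁ h)

  reach-edge : ∀ k {u v} → u ∈ reach k → Edge G u v → v ∈ p → v ∈ reach (suc k)
  reach-edge k a e b = into (inj₂ (b , _ , a , e))

  reach-mono : ∀ {j k} → j ≤ k → reach j ⊑ reach k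
  reach-mono {j} {k} le {x} h with m≤n⇒∃[o]m+o≡n le
  ... | o , refl = go o
    where
    go : ∀ o → x ∈ reach (j + o)
    go zero = subst (λ i → x ∈ reach i) (sym (+-identityʳ j)) h
    go (suc o) = subst (λ i → x ∈ reach i) (sym (+-suc j o)) (reach-suc (j + o) (go o))

  reach-sound : ∀ k {v} → v ∈ reach k → Conn (Edge G) p r v
  reach-sound zero h with refl ← out h = stop r∈p
  reach-sound (suc k) h with out h
  ... | inj₁ a = reach-sound k a
  ... | inj₂ (b , u , a , e) = conn-trans (reach-sound k a) (conn-edge (conn-end (reach-sound k a)) e b)

  Stable : ℕ → Set
  Stable k = reach (suc k) ⊑ reach k

  stable-suc : ∀ k → Stable k → Stable (suc k)
  stable-suc k st h with out h
  ... | inj₁ a = a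
  ... | inj₂ (b , u , a , e) = reach-edge k (st a) e b

  -- Each unstable round adds a vertex, so `n` rounds exhaust the component. This makes connectivity
  -- decidable.
  grows : ∀ k → Stable k ⊎ k < card (reach k)
  grows zero = inj₂ (card-pos (into refl))
  grows (suc k) with grows k
  ... | inj₁ st = inj₁ (stable-suc k st)
  ... | inj₂ lt with any? (λ v → (v ∈? reach (suc k)) ×-dec ¬? (v ∈? reach k))
  ...   | yes (v , a , b) = inj₂ (≤-<-trans lt (card-< (reach-suc k) a b))
  ...   | no h = inj₁ (stable-suc k st)
    where
    st : Stable k
    st {v} a with v ∈? reach k
    ... | yes b = b
    ... | no b = ⊥-elim (h (v , a , b))

  stable-n : Stable n
  stable-n {x} with grows n
  ... | inj₁ st = st {x}
  ... | inj₂ lt = ⊥-elim (<⇒≱ lt (card≤n (reach n)))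

  reach-complete : ∀ {v} → Conn (Edge G) p r v → v ∈ reach n
  reach-complete c = conn-invariant (λ v → v ∈ reach n) (λ a _ b e → stable-n (reach-edge n a e b)) c
    (reach-mono {0} {n} z≤n (into refl))

conn? : (G : Graph n) (p : VSet n) → ∀ u v → Dec (Conn (Edge G) p u v)
conn? {n} G p u v with u ∈? p
... | no h = no (λ c → h (conn-start c))
... | yes h = map′ (reach-sound n) reach-complete (v ∈? reach n)
  where open Reach G p u h

comp : Graph n → VSet n → Fin n → VSet n
comp G p u = ⟦ (λ v → conn? G p u v) ⟧

conn-comp : (G : Graph n) {p : VSet n} → ∀ {u v w} → Conn (Edge G) p u v → Conn (Edge G) p v w →
  Conn (Edge G) (comp G p u) v w
conn-comp G c (stop _) = stop (into c)
conn-comp G c (step h e d) = step (into c) e (conn-comp G (conn-trans c (conn-edge h e (conn-start d))) d)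

comp-connected : (G : Graph n) (p : VSet n) (u : Fin n) → Connected (Edge G) (comp G p u)
comp-connected G p u a b = conn-comp G (out a) (conn-trans (conn-sym (edge-sym G) (out a)) (out b))

-- Cutting a connected set into heavy connected pieces

nonempty : {p : VSet n} → 1 ≤ card p → ∃ λ x → x ∈ p
nonempty {p = p} h with f , f∈ , _ ← choose p 1 h = f zero , f∈ zero

first-hit : {E : Rel n} {T : VSet n} → ∀ {z v} → Conn E T z v → z ≢ v →
  ∃ λ u → E u v × Conn E (T ∖ ⁅ v ⁆) z u
first-hit (stop _) ne = ⊥-elim (ne refl)
first-hit {v = v} (step {w = w} h e c) ne with w Fin.≟ v
... | yes refl = _ , e , stop (into (h , λ s → ne (out s)))
... | no ne′ with u , e′ , c′ ← first-hit c ne′ = u , e′ , step (into (h , λ s → ne (out s))) e c′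

module Split (G : Graph n) (Δ : ℕ) (deg : Degree≤ G Δ) (X : VSet n) (foot : Fin n → Fin n)
  (attached : ∀ {x} → x ∈ X → Edge G x (foot x)) where

  -- A vertex of `X` is counted only where its `foot` lies, so disjoint pieces own disjoint token
  -- sets even if it has several neighbours in `R`.
  tokens : VSet n → VSet n
  tokens T = ⟦ (λ x → (x ∈? X) ×-dec (foot x ∈? T)) ⟧

  weight : VSet n → ℕ
  weight T = card (tokens T)

  record Piece (M : ℕ) (R : VSet n) : Set where
    field
      T : VSet n
      T⊑ : T ⊑ R
      T-connected : Connected (Edge G) T
      rest-connected : Connected (Edge G) (R ∖ T)
      heavy : M ≤ weight T
      light : weight T ≤ Δ + Δ * M

  -- The branch at v of a minimal heavy branch T splits into at most Δ branches of weight below M.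
  cut : ∀ s (M : ℕ) (R T : VSet n) (v : Fin n) → card T ≤ s → v ∈ T → T ⊑ R →
    Connected (Edge G) T → Connected (Edge G) (R ∖ T) →
    (∀ {z} → z ∈ R ∖ T → Conn (Edge G) ((R ∖ T) ∪ ⁅ v ⁆) z v) →
    M ≤ weight T → Piece M R
  cut zero M R T v le v∈ _ _ _ _ _ = ⊥-elim (<⇒≱ (card-pos v∈) le)
  cut (suc s) M R T v le v∈ T⊑ T-conn rest-conn rest-v heavy
    with any? (λ u → (edge? G v u ×-dec (u ∈? T ∖ ⁅ v ⁆)) ×-dec (M ≤? weight (comp G (T ∖ ⁅ v ⁆) u)))
  -- `K` is a component of `T` without `v`, so everything outside `K` stays connected through `v`,
  -- which is adjacent to the new root `u`. The recursion ends because `v` is dropped.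
  ... | yes (u , (e , u∈) , heavy′) = cut s M R K u
          (s≤s⁻¹ (≤-trans (card-< (λ h → proj₁ (out (conn-end (out h)))) v∈ v∉K) le))
          u∈K (λ h → T⊑ (K⊑T h)) (comp-connected G _ u) (hub-connected (edge-sym G) v to-v)
          (λ z∈ → conn-trans (conn-mono (λ e → e) (λ h → into (inj₁ h)) (to-v z∈))
                    (conn-edge (into (inj₁ v∈R∖K)) e (into (inj₂ (into refl))))) heavy′
    where
    K : VSet n
    K = comp G (T ∖ ⁅ v ⁆) u
    u∈K : u ∈ K
    u∈K = into (stop u∈)
    K⊑T : K ⊑ T
    K⊑T h = proj₁ (out (conn-end (out h)))
    v∉K : v ∉ K
    v∉K h = proj₂ (out (conn-end (out h))) (into refl)
    v∈R∖K : v ∈ R ∖ K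
    v∈R∖K = into (T⊑ v∈ , v∉K)
    within-T : ∀ {z} → z ∈ T → z ∉ K → Conn (Edge G) (R ∖ K) z v
    within-T {z} z∈ z∉ with z Fin.≟ v
    ... | yes refl = stop v∈R∖K
    ... | no ne with w , e′ , c ← first-hit (T-conn z∈ v∈) ne =
      conn-trans (avoid c z∉) (conn-edge (conn-end (avoid c z∉)) e′ v∈R∖K)
      where
      avoid : ∀ {a b} → Conn (Edge G) (T ∖ ⁅ v ⁆) a b → a ∉ K → Conn (Edge G) (R ∖ K) a b
      avoid (stop h) a∉ = stop (into (T⊑ (proj₁ (out h)) , a∉))
      avoid (step h e c) a∉ = step (into (T⊑ (proj₁ (out h)) , a∉)) e
        (avoid c (λ w∈ → a∉ (into (conn-trans (out w∈) (conn-edge (conn-start c) (edge-sym G e) h)))))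
    to-v : ∀ {z} → z ∈ R ∖ K → Conn (Edge G) (R ∖ K) z v
    to-v {z} z∈ with z ∈? T
    ... | yes z∈T = within-T z∈T (proj₂ (out z∈))
    ... | no z∉T = conn-mono (λ e → e) sub (rest-v (into (proj₁ (out z∈) , z∉T)))
      where
      sub : (R ∖ T) ∪ ⁅ v ⁆ ⊑ R ∖ K
      sub h with out h
      ... | inj₁ a = into (proj₁ (out a) , λ b → proj₂ (out a) (K⊑T b))
      ... | inj₂ a with refl ← out a = v∈R∖K
  ... | no none = record
    { T = T; T⊑ = T⊑; T-connected = T-conn; rest-connected = rest-conn; heavy = heavy
    ; light = ≤-trans (card-mono cover) (≤-trans (card-∪ _ _) (+-mono-≤ at-v branches)) }
    where
    P : VSet n
    P = adj G v ∩ (T ∖ ⁅ v ⁆)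
    B : VSet n
    B = ⟦ (λ x → (x ∈? X) ×-dec (foot x ∈? T ∖ ⁅ v ⁆)) ⟧
    cover : tokens T ⊑ tokens ⁅ v ⁆ ∪ B
    cover {x} h with foot x Fin.≟ v
    ... | yes e = into (inj₁ (into (proj₁ (out h) , into e)))
    ... | no ne = into (inj₂ (into (proj₁ (out h) , into (proj₂ (out h) , λ s → ne (out s)))))
    -- Tokens with foot `v` belong to no branch; they are neighbours of `v`, whence the summand `Δ`
    -- in `light`.
    at-v : weight ⁅ v ⁆ ≤ Δ
    at-v = ≤-trans (card-mono (λ {x} h → holds (subst (λ y → Edge G y x) (out (proj₂ (out h)))
             (edge-sym G (attached (proj₁ (out h))))))) (deg v)
    branches : card B ≤ Δ * M
    branches = ≤-trans (card-⋃ P (λ u → tokens (comp G (T ∖ ⁅ v ⁆) u)) M inside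
                 (λ {u} h → <⇒≤ (≰⇒> (λ le → none (u , (eq (proj₁ (out h)) , proj₂ (out h)) , le)))))
               (*-monoˡ-≤ M (≤-trans (card-mono (λ h → proj₁ (out h))) (deg v)))
      where
      inside : ∀ {x} → x ∈ B → ∃ λ u → u ∈ P × x ∈ tokens (comp G (T ∖ ⁅ v ⁆) u)
      inside {x} h with x∈ , f∈ ← out h with f∈T , f≠ ← out f∈
        with u , e , c ← first-hit (T-conn f∈T v∈) (λ e → f≠ (into e)) =
        u , into (holds (edge-sym G e) , conn-end c) , into (x∈ , into (conn-sym (edge-sym G) c))

  piece : ∀ M R r → r ∈ R → Connected (Edge G) R → M ≤ weight R → Piece M R
  piece M R r r∈ conn heavy = cut (card R) M R R r ≤-refl r∈ (λ h → h) conn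
    (λ h → ⊥-elim (proj₂ (out h) (proj₁ (out h)))) (λ h → ⊥-elim (proj₂ (out h) (proj₁ (out h)))) heavy

  record Pieces (S M : ℕ) (R : VSet n) : Set where
    field
      T : Fin S → VSet n
      T⊑ : ∀ a → T a ⊑ R
      T-disjoint : ∀ {a b x} → x ∈ T a → x ∈ T b → a ≡ b
      T-connected : ∀ a → Connected (Edge G) (T a)
      heavy : ∀ a → M ≤ weight (T a)

  abstract
    -- Each piece takes at most `Δ + Δ * M` tokens out of its share of the budget. The extra `M` in
    -- each share guarantees that what remains can be cut again, even for `Δ = 0`.
    pieces : ∀ S M R → 1 ≤ M → Connected (Edge G) R → S * (M + (Δ + Δ * M)) ≤ weight R → Pieces S M R
    pieces zero M R _ _ _ = record { T = λ (); T⊑ = λ (); T-disjoint = λ { {()} } ; T-connected = λ (); heavy = λ () }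
    pieces (suc S) M R M≥1 conn h = record
      { T = T; T⊑ = T⊑; T-disjoint = T-disjoint; T-connected = T-connected; heavy = heavy }
      where
      M≤ : M ≤ weight R
      M≤ = ≤-trans (≤-trans (m≤m+n M _) (m≤m+n _ (S * (M + (Δ + Δ * M))))) h
      first : Piece M R
      first with x , x∈ ← nonempty (≤-trans M≥1 M≤) = piece M R (foot x) (proj₂ (out x∈)) conn M≤
      module F = Piece first
      covered : tokens R ⊑ tokens F.T ∪ tokens (R ∖ F.T)
      covered {x} h with foot x ∈? F.T
      ... | yes a = into (inj₁ (into (proj₁ (out h) , a)))
      ... | no a = into (inj₂ (into (proj₁ (out h) , into (proj₂ (out h) , a))))
      rest : Pieces S M (R ∖ F.T)
      rest = pieces S M (R ∖ F.T) M≥1 F.rest-connected (+-cancelˡ-≤ (M + (Δ + Δ * M)) _ _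
        (≤-trans h (≤-trans (card-mono covered) (≤-trans (card-∪ _ _) (+-monoˡ-≤ _ (≤-trans F.light (m≤n+m _ M)))))))
      module P = Pieces rest
      T : Fin (suc S) → VSet n
      T zero = F.T
      T (suc a) = P.T a
      T⊑ : ∀ a → T a ⊑ R
      T⊑ zero = F.T⊑
      T⊑ (suc a) h = proj₁ (out (P.T⊑ a h))
      T-disjoint : ∀ {a b x} → x ∈ T a → x ∈ T b → a ≡ b
      T-disjoint {zero} {zero} _ _ = refl
      T-disjoint {zero} {suc b} h h′ = ⊥-elim (proj₂ (out (P.T⊑ b h′)) h)
      T-disjoint {suc a} {zero} h h′ = ⊥-elim (proj₂ (out (P.T⊑ a h)) h′)
      T-disjoint {suc a} {suc b} h h′ = cong suc (P.T-disjoint h h′)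
      T-connected : ∀ a → Connected (Edge G) (T a)
      T-connected zero = F.T-connected
      T-connected (suc a) = P.T-connected a
      heavy : ∀ a → M ≤ weight (T a)
      heavy zero = F.heavy
      heavy (suc a) = P.heavy a

-- Disjoint or crossing linkages

-- The first summand lets the pigeonhole principle find `d` members of the first family blocked by
-- one and the same other family. The second leaves `d` members of that family after the removal,
-- for each of these, of fewer than `supply d N` members that avoid it.
supply : ℕ → ℕ → ℕ
supply d zero = 0
supply d (suc N) = suc (N * d) + (d * supply d N + d)

module Refine {K : ℕ} (d : ℕ) where

  record Crossing {N : ℕ} (Meets : Fin N → Fin N → Fin K → Fin K → Set) : Set where
    field
      e e′ : Fin N
      P Q : Fin d → Fin K
      P-injective : ∀ {i j} → P i ≡ P j → i ≡ j
      Q-injective : ∀ {i j} → Q i ≡ Q j → i ≡ j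
      crosses : ∀ i j → Meets e e′ (P i) (Q j)

  Avoiding : {N : ℕ} → (Fin N → Fin N → Fin K → Fin K → Set) → (Fin N → VSet K) → Set
  Avoiding {N} Meets p = Σ (Fin N → Fin K) λ c → (∀ e → c e ∈ p e) ×
    (∀ e e′ → e ≢ e′ → ¬ Meets e e′ (c e) (c e′))

  -- Greedy choice: a member of the first family is fixed if every other family keeps `supply d N`
  -- members that avoid it. If no member is suitable, each is blocked by some family, and `d`
  -- members blocked by the same family meet `d` common members of it.
  refine : (N : ℕ) (Meets : Fin N → Fin N → Fin K → Fin K → Set) →
    (∀ e e′ i j → Dec (Meets e e′ i j)) → (∀ {e e′ i j} → Meets e e′ i j → Meets e′ e j i) →
    (p : Fin N → VSet K) → (∀ e → supply d N ≤ card (p e)) →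
    Avoiding Meets p ⊎ Crossing Meets
  refine zero Meets meets? meets-sym p h = inj₁ ((λ ()) , (λ ()) , λ ())
  refine (suc N) Meets meets? meets-sym p h
    with any? (λ i → (i ∈? p zero) ×-dec all? (λ e → supply d N ≤? card (avoid e i)))
    where
    avoid : Fin N → Fin K → VSet K
    avoid e i = ⟦ (λ j → (j ∈? p (suc e)) ×-dec ¬? (meets? zero (suc e) i j)) ⟧
  ... | yes (i , i∈ , many)
      with refine N (λ e e′ → Meets (suc e) (suc e′)) (λ e e′ → meets? (suc e) (suc e′)) meets-sym _ many
  ...   | inj₂ C = inj₂ record { e = suc e; e′ = suc e′; P = P; Q = Q; P-injective = P-injective; Q-injective = Q-injective; crosses = crosses }
    where open Crossing C
  ...   | inj₁ (c , c∈ , c-avoids) = inj₁ (c′ , c′∈ , avoids)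
    where
    c′ : Fin (suc N) → Fin K
    c′ zero = i
    c′ (suc e) = c e
    c′∈ : ∀ e → c′ e ∈ p e
    c′∈ zero = i∈
    c′∈ (suc e) = proj₁ (out (c∈ e))
    avoids : ∀ e e′ → e ≢ e′ → ¬ Meets e e′ (c′ e) (c′ e′)
    avoids zero zero ne _ = ne refl
    avoids zero (suc e′) _ = proj₂ (out (c∈ e′))
    avoids (suc e) zero _ m = proj₂ (out (c∈ e)) (meets-sym m)
    avoids (suc e) (suc e′) ne = c-avoids e e′ (λ eq → ne (cong suc eq))
  refine (suc N) Meets meets? meets-sym p h | no none = inj₂ crossing
    where
    avoid : Fin N → Fin K → VSet K
    avoid e i = ⟦ (λ j → (j ∈? p (suc e)) ×-dec ¬? (meets? zero (suc e) i j)) ⟧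
    blocked : Fin N → VSet K
    blocked e = ⟦ (λ i → ¬? (supply d N ≤? card (avoid e i))) ⟧
    some-blocked : ∀ {i} → i ∈ p zero → ∃ λ e → i ∈ blocked e
    some-blocked {i} i∈ with any? (λ e → ¬? (supply d N ≤? card (avoid e i)))
    ... | yes (e , b) = e , into b
    ... | no h = ⊥-elim (none (i , i∈ , λ e → decidable-stable (supply d N ≤? _) (λ b → h (e , b))))
    crossing : Crossing Meets
    crossing with pigeonhole (p zero) blocked d some-blocked (≤-trans (m≤m+n (suc (N * d)) _) (h zero))
    ... | e , many with choose (blocked e) d (<⇒≤ many)
    ...   | P , P∈ , P-inj with choose Q-set d enough
      where
      Q-set : VSet K
      Q-set = ⟦ (λ j → (j ∈? p (suc e)) ×-dec all? (λ i → meets? zero (suc e) (P i) j)) ⟧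
      U : VSet K
      U = ⟦ (λ j → any? (λ i → j ∈? avoid e (P i))) ⟧
      covered : p (suc e) ⊑ U ∪ Q-set
      covered {j} j∈ with any? (λ i → j ∈? avoid e (P i))
      ... | yes h = into (inj₁ (into h))
      ... | no h = into (inj₂ (into (j∈ , λ i → decidable-stable (meets? zero (suc e) (P i) j)
                     (λ ¬m → h (i , into (j∈ , ¬m))))))
      U-small : card U ≤ d * supply d N
      U-small = subst (λ x → card U ≤ x * supply d N) (card-full d)
        (card-⋃ full (λ i → avoid e (P i)) (supply d N) (λ u → proj₁ (out u) , holds refl , proj₂ (out u))
          (λ {i} _ → <⇒≤ (≰⇒> (out (P∈ i)))))
      enough : d ≤ card Q-set
      enough = +-cancelˡ-≤ (d * supply d N) _ _ (≤-trans (≤-trans (m≤n+m _ (suc (N * d))) (h (suc e)))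
        (≤-trans (card-mono covered) (≤-trans (card-∪ U Q-set) (+-monoˡ-≤ _ U-small))))
    ...     | Q , Q∈ , Q-inj = record
      { e = zero; e′ = suc e; P = P; Q = Q; P-injective = P-inj; Q-injective = Q-inj
      ; crosses = λ i j → proj₂ (out (Q∈ j)) i }

-- Crossing families give a biclique model

-- A model of `K_t` inside `D`. The field `point` keeps bags nonempty, since `Connected` holds
-- vacuously for the empty set.
record Model (E : Rel n) (D : VSet n) (t : ℕ) : Set where
  field
    bag       : Fin t → VSet n
    bag⊑      : ∀ i → bag i ⊑ D
    point     : Fin t → Fin n
    point∈    : ∀ i → point i ∈ bag i
    connected : ∀ i → Connected E (bag i)
    disjoint  : ∀ {i j x} → x ∈ bag i → x ∈ bag j → i ≡ j
    adjacent  : ∀ i j → i ≢ j → ∃ λ u → ∃ λ v → u ∈ bag i × v ∈ bag j × E u v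

record Biclique {S k : ℕ} (I : Fin S → VSet k) (s : ℕ) : Set where
  field
    row : Fin s → Fin k
    row-injective : ∀ {i j} → row i ≡ row j → i ≡ j
    col : Fin s → Fin S
    col-injective : ∀ {i j} → col i ≡ col j → i ≡ j
    incident : ∀ i j → row i ∈ I (col j)

-- Kővári–Sós–Turán for very unbalanced bipartite graphs: rows of degree at least s are sorted by an s-subset
-- of their neighbourhood.
abstract
  biclique : {S k : ℕ} (s q : ℕ) (I : Fin S → VSet k) → (∀ a → q ≤ card (I a)) →
    k * s + S * (S ^ s * s) < S * q → Biclique I s
  biclique {S} {k} s q I dense room = result
    where
    col-set : Fin k → VSet S
    col-set i a = I a i
    H : VSet k
    H = ⟦ (λ i → s ≤? card (col-set i)) ⟧
    -- A row outside `H` accounts for at most `s` incidences and a row in `H` for at most `S`, so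
    -- the surplus in `room` forces many rows into `H`.
    sum-bound : S * q ≤ k * s + card H * S
    sum-bound = begin
      S * q                               ≡⟨ ∑-const S q ⟨
      ∑ {S} (λ _ → q)                     ≤⟨ ∑-mono dense ⟩
      ∑ (λ a → card (I a))                ≡⟨ ∑-cong (λ a → card-∑ (I a)) ⟩
      ∑ (λ a → ∑ (λ i → ind (I a i)))     ≡⟨ ∑-swap _ ⟩
      ∑ (λ i → ∑ (λ a → ind (I a i)))     ≡⟨ ∑-cong (λ i → card-∑ (col-set i)) ⟨
      ∑ (λ i → card (col-set i))          ≤⟨ ∑-mono deg ⟩
      ∑ (λ i → s + ind (H i) * S)         ≡⟨ ∑-+ _ _ ⟩
      ∑ {k} (λ i → s) + ∑ (λ i → ind (H i) * S) ≡⟨ cong₂ _+_ (∑-const k s) (∑-*ʳ _ S) ⟩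
      k * s + ∑ (λ i → ind (H i)) * S     ≡⟨ cong (λ x → k * s + x * S) (card-∑ H) ⟨
      k * s + card H * S                  ∎
      where
      open ≤-Reasoning
      deg : ∀ i → card (col-set i) ≤ s + ind (H i) * S
      deg i with i ∈? H
      ... | yes h = ≤-trans (card≤n (col-set i)) (≤-trans (≤-reflexive (sym (trans (cong (_* S) (ind-∈ (eq h))) (*-identityˡ S)))) (m≤n+m _ s))
      ... | no h = ≤-trans (<⇒≤ (≰⇒> (λ le → h (into le)))) (m≤m+n s _)
    enough : S ^ s * s < card H
    enough = ≰⇒> (λ le → <⇒≱ room (≤-trans sum-bound (+-monoʳ-≤ (k * s)
      (≤-trans (*-monoˡ-≤ S le) (≤-reflexive (*-comm (S ^ s * s) S))))))
    decode : Fin (S ^ s) → Fin s → Fin S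
    decode = finToFun
    has-code? : (c : Fin (S ^ s)) (i : Fin k) → Dec (∀ j → i ∈ I (decode c j))
    has-code? c i = all? (λ j → i ∈? I (decode c j))
    injective? : (c : Fin (S ^ s)) → Dec (∀ i j → decode c i ≡ decode c j → i ≡ j)
    injective? c = all? (λ i → all? (λ j → (finToFun c i Fin.≟ finToFun c j) →-dec (i Fin.≟ j)))
    class : Fin (S ^ s) → VSet k
    class c = ⟦ (λ i → injective? c ×-dec has-code? c i) ⟧
    classify : ∀ {i} → i ∈ H → ∃ λ c → i ∈ class c
    classify {i} h with g , g∈ , inj ← choose (col-set i) s (out h) = funToFin g ,
      into ((λ a b e → inj (trans (sym (finToFun-funToFin g a)) (trans e (finToFun-funToFin g b)))) ,
            (λ j → subst (λ a → i ∈ I a) (sym (finToFun-funToFin g j)) (holds (eq (g∈ j)))))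
    result : Biclique I s
    result with c , many ← pigeonhole H class s classify enough
      with row , row∈ , row-inj ← choose (class c) s (<⇒≤ many) | f , f∈ , _ ← choose (class c) 1 (≤-trans (s≤s z≤n) many) = record
      { row = row; row-injective = row-inj; col = decode c
      ; col-injective = λ {i} {j} → proj₁ (out (f∈ zero)) i j
      ; incident = λ i j → proj₂ (out (row∈ i)) j }

-- `k` paths in each family, `q * q` marks for every piece, and `S + S` pieces, so that `S` of them
-- touch at least `q` paths of the same family. The field `dense` is what `biclique` asks for.
record GridSize (Δ s : ℕ) : Set where
  field
    k S q : ℕ
    cell-pos : 1 ≤ q * q
    cells-fit : (S + S) * (q * q + (Δ + Δ * (q * q))) ≤ k * k
    dense : k * s + S * (S ^ s * s) < S * q

-- With z = 4s(1+2Δ): k = zq and S = 2sz cells of q² marks, so 2S cells still fit into the k² marks.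
grid-size : ∀ Δ s → 1 ≤ s → GridSize Δ s
grid-size Δ s s≥1 = record
  { k = z * q; S = S; q = q; cell-pos = s≤s z≤n; cells-fit = cells-fit
  -- `S` is fixed before `q`, so `q` can be chosen to exceed the code count `C`; the two sides then
  -- differ by exactly `s * z`.
  ; dense = subst₂ _<_ (+-identityʳ _) (identity s z C) (+-monoʳ-< (z * suc (2 * C) * s + 2 * (s * z) * C) pos) }
  where
  z S C q : ℕ
  z = 4 * s * (1 + 2 * Δ)
  S = 2 * (s * z)
  C = S ^ s * s
  q = suc (2 * C)
  pos : 0 < s * z
  pos = *-mono-≤ s≥1 (*-mono-≤ (*-mono-≤ {1} {4} (s≤s z≤n) s≥1) (m≤m+n 1 (2 * Δ)))
  identity : ∀ s z C → (z * suc (2 * C) * s + 2 * (s * z) * C) + s * z ≡ 2 * (s * z) * suc (2 * C)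
  identity = solve-∀
  rearrange : ∀ s z Δ q → (2 * (s * z) + 2 * (s * z)) * (q * q + (Δ * (q * q) + Δ * (q * q)))
              ≡ (4 * s * (1 + 2 * Δ)) * z * (q * q)
  rearrange = solve-∀
  regroup : ∀ z q → z * z * (q * q) ≡ z * q * (z * q)
  regroup = solve-∀
  cells-fit : (S + S) * (q * q + (Δ + Δ * (q * q))) ≤ z * q * (z * q)
  cells-fit = ≤-trans (*-monoʳ-≤ (S + S) (+-monoʳ-≤ (q * q) (+-monoˡ-≤ (Δ * (q * q)) (m≤m*n Δ (q * q)))))
    (≤-reflexive (trans (rearrange s z Δ q) (regroup z q)))

module Grid (G : Graph n) (Δ : ℕ) (deg : Degree≤ G Δ) (R W : VSet n) (R-connected : Connected (Edge G) R)
  (apart : ∀ {x} → x ∈ R → x ∉ W) (foot : Fin n → Fin n)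
  (foot-edge : ∀ {x} → x ∈ W → Edge G x (foot x)) (foot∈R : ∀ {x} → x ∈ W → foot x ∈ R)
  (s : ℕ) (size : GridSize Δ s) where
  open GridSize size

  module _ (P Q : Fin k → VSet n) (P⊑W : ∀ i → P i ⊑ W) (Q⊑W : ∀ i → Q i ⊑ W)
    (P-disjoint : ∀ {i j x} → x ∈ P i → x ∈ P j → i ≡ j) (Q-disjoint : ∀ {i j x} → x ∈ Q i → x ∈ Q j → i ≡ j)
    (P-connected : ∀ i → Connected (Edge G) (P i)) (Q-connected : ∀ i → Connected (Edge G) (Q i))
    (mark : Fin k → Fin k → Fin n) (mark∈P : ∀ i j → mark i j ∈ P i) (mark∈Q : ∀ i j → mark i j ∈ Q j) where

    X : VSet n
    X = ⟦ (λ x → any? (λ i → any? (λ j → x Fin.≟ mark i j))) ⟧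

    X⊑W : X ⊑ W
    X⊑W h with i , j , refl ← out h = P⊑W i (mark∈P i j)

    open Split G Δ deg X foot (λ h → foot-edge (X⊑W h))

    kk≤X : k * k ≤ card X
    kk≤X = inj≤card X f (λ c → into (_ , _ , refl)) f-inj
      where
      f : Fin (k * k) → Fin n
      f c = mark (proj₁ (remQuot {k} k c)) (proj₂ (remQuot {k} k c))
      f-inj : ∀ {c d} → f c ≡ f d → c ≡ d
      f-inj {c} {d} e = trans (sym (combine-remQuot {k} k c)) (trans (cong₂ combine
        (P-disjoint (mark∈P _ _) (subst (_∈ P _) (sym e) (mark∈P _ _)))
        (Q-disjoint (mark∈Q _ _) (subst (_∈ Q _) (sym e) (mark∈Q _ _)))) (combine-remQuot {k} k d))

    room : (S + S) * (q * q + (Δ + Δ * (q * q))) ≤ weight R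
    room = ≤-trans cells-fit (≤-trans kk≤X (card-mono (λ h → into (h , foot∈R (X⊑W h)))))

    abstract
      parts : Pieces (S + S) (q * q) R
      parts = pieces (S + S) (q * q) R cell-pos R-connected room
    open Pieces parts

    touches : (Fin k → VSet n) → Fin (S + S) → VSet k
    touches line a = ⟦ (λ i → any? (λ x → (x ∈? line i) ×-dec (x ∈? tokens (T a)))) ⟧

    -- A token is some `mark i j`, and its piece then touches both `P i` and `Q j`. The tokens of a
    -- piece thus lie in a box whose sides are the two sets of touched paths, and one side has
    -- length at least `q`.
    area : ∀ a → q * q ≤ card (touches P a) * card (touches Q a)
    area a = ≤-trans (heavy a) (card-⋃ (touches P a) strip (card (touches Q a)) covers
      (λ {i} _ → subst (card (strip i) ≤_) (*-identityʳ _) (card-⋃ (touches Q a) (λ j → ⁅ mark i j ⁆) 1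
        (λ h → let j , j∈ , e = out h in j , j∈ , into e) (λ {j} _ → card-⁅⁆ _))))
      where
      strip : Fin k → VSet n
      strip i = ⟦ (λ x → any? (λ j → (j ∈? touches Q a) ×-dec (x Fin.≟ mark i j))) ⟧
      covers : ∀ {x} → x ∈ tokens (T a) → ∃ λ i → i ∈ touches P a × x ∈ strip i
      covers {x} h with x∈X , f∈ ← out h with i , j , refl ← out x∈X =
        i , into (x , mark∈P i j , h) , into (j , into (x , mark∈Q i j , h) , refl)

    long? : (line : Fin k → VSet n) → ∀ a → Dec (q ≤ card (touches line a))
    long? line a = q ≤? card (touches line a)

    long : (Fin k → VSet n) → VSet (S + S)
    long line = ⟦ long? line ⟧

    either : ∀ {a} → a ∈ full → a ∈ long P ∪ long Q
    either {a} _ = pick (long? P a) (long? Q a)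
      where
      pick : Dec (q ≤ card (touches P a)) → Dec (q ≤ card (touches Q a)) → a ∈ long P ∪ long Q
      pick (yes h) _ = into (inj₁ (into h))
      pick (no _) (yes h) = into (inj₂ (into h))
      pick (no h) (no h′) = ⊥-elim (<⇒≱ (*-mono-< (≰⇒> h) (≰⇒> h′)) (area a))

    module Lines (line : Fin k → VSet n) (line⊑ : ∀ i → line i ⊑ W)
      (line-disjoint : ∀ {i j x} → x ∈ line i → x ∈ line j → i ≡ j)
      (line-connected : ∀ i → Connected (Edge G) (line i))
      (f : Fin S → Fin (S + S)) (f-injective : ∀ {a b} → f a ≡ f b → a ≡ b)
      (B : Biclique (touches line ∘ f) s) where
      open Biclique B

      crossing : ∀ i j → ∃ λ x → x ∈ line (row i) × foot x ∈ T (f (col j))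
      crossing i j = let x , x∈ , h = out (incident i j) in x , x∈ , proj₂ (out h)

      -- Contracting the perfect matching of `K_{s,s}` gives `K_s`: line `i` is adjacent to every
      -- chosen piece, in particular to its partner.
      bag : Fin s → VSet n
      bag i = line (row i) ∪ T (f (col i))

      bag⊑ : ∀ i → bag i ⊑ R ∪ W
      bag⊑ i h = into (Sum.swap (Sum.map (line⊑ _) (T⊑ _) (out h)))

      bag-disjoint : ∀ {i j x} → x ∈ bag i → x ∈ bag j → i ≡ j
      bag-disjoint {i} {j} {x} a b = cases (out a) (out b)
        where
        cases : x ∈ line (row i) ⊎ x ∈ T (f (col i)) → x ∈ line (row j) ⊎ x ∈ T (f (col j)) → i ≡ j
        cases (inj₁ c) (inj₁ d) = row-injective (line-disjoint c d)
        cases (inj₂ c) (inj₂ d) = col-injective (f-injective (T-disjoint c d))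
        cases (inj₁ c) (inj₂ d) = ⊥-elim (apart (T⊑ _ d) (line⊑ _ c))
        cases (inj₂ c) (inj₁ d) = ⊥-elim (apart (T⊑ _ c) (line⊑ _ d))

      lines-model : Model (Edge G) (R ∪ W) s
      lines-model = record
        { bag = bag; bag⊑ = bag⊑
        ; point = λ i → proj₁ (crossing i i)
        ; point∈ = λ i → into (inj₁ (proj₁ (proj₂ (crossing i i))))
        ; connected = λ i → let x , x∈ , h = crossing i i in
            ∪-connected (edge-sym G) (line-connected _) (T-connected _) x∈ h (inj₂ (foot-edge (line⊑ _ x∈)))
        ; disjoint = bag-disjoint
        ; adjacent = λ i j _ → let x , x∈ , h = crossing i j in
            x , foot x , into (inj₁ x∈) , into (inj₂ h) , foot-edge (line⊑ _ x∈) }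

    model-from : (line : Fin k → VSet n) → (∀ i → line i ⊑ W) → (∀ {i j x} → x ∈ line i → x ∈ line j → i ≡ j) →
      (∀ i → Connected (Edge G) (line i)) → S ≤ card (long line) → Model (Edge G) (R ∪ W) s
    model-from line line⊑ line-disjoint line-connected le = Lines.lines-model line line⊑ line-disjoint line-connected
      (proj₁ chosen) (proj₂ (proj₂ chosen)) (biclique s q (touches line ∘ proj₁ chosen) (λ a → out (proj₁ (proj₂ chosen) a)) dense)
      where
      chosen : Σ (Fin S → Fin (S + S)) λ f → (∀ i → f i ∈ long line) × (∀ {i j} → f i ≡ f j → i ≡ j)
      chosen = choose (long line) S le

    grid-model : Model (Edge G) (R ∪ W) s
    grid-model with S ≤? card (long P)
    ... | yes le = model-from P P⊑W P-disjoint P-connected le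
    ... | no gt = model-from Q Q⊑W Q-disjoint Q-connected (+-cancelˡ-≤ S _ _ (begin
          S + S                       ≡⟨ card-full (S + S) ⟨
          card {S + S} full           ≤⟨ card-mono either ⟩
          card (long P ∪ long Q)      ≤⟨ card-∪ _ _ ⟩
          card (long P) + card (long Q) ≤⟨ +-monoˡ-≤ _ (<⇒≤ (≰⇒> gt)) ⟩
          S + card (long Q)           ∎))
      where open ≤-Reasoning

-- Large inseparable sets give a model

-- As `A` lies in `L` and `B` in `R`, each of `L` and `R` misses more than `M - k` vertices of `X`.
-- This is the progress that a separation makes on both sides.
record Unlinked (E : Rel n) (W X : VSet n) (k M : ℕ) : Set where
  field
    A B : VSet n
    A⊑X : A ⊑ X
    B⊑X : B ⊑ X
    A-large : M ≤ card A
    B-large : M ≤ card B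
    separation : Separation E W A B k

-- One linkage for every ordered pair of pieces, the diagonal included, so that `Fin (t * t)`
-- indexes them.
linkOrder : (t : ℕ) {Δ : ℕ} → GridSize Δ t → ℕ
linkOrder t size = supply (GridSize.k size) (t * t)

-- The budget for `t` pieces. With `suc M` in place of `M` each piece owns a token, whose foot
-- serves as its root, even for `M = 0`.
linkSize : ℕ → ℕ → ℕ → ℕ
linkSize Δ t M = t * (suc M + (Δ + Δ * suc M))

module Hub (G : Graph n) (Δ : ℕ) (deg : Degree≤ G Δ) (R W : VSet n) (R-connected : Connected (Edge G) R)
  (apart : ∀ {x} → x ∈ R → x ∉ W) (foot : Fin n → Fin n)
  (foot-edge : ∀ {x} → x ∈ W → Edge G x (foot x)) (foot∈R : ∀ {x} → x ∈ W → foot x ∈ R)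
  (t : ℕ) (size : GridSize Δ t) (X : VSet n) (X⊑W : X ⊑ W) (M : ℕ) (large : linkSize Δ t M ≤ card X) where

  private
    K : ℕ
    K = linkOrder t size
  open Split G Δ deg X foot (λ h → foot-edge (X⊑W h))

  abstract
    parts : Pieces t (suc M) R
    parts = pieces t (suc M) R (s≤s z≤n) R-connected
      (≤-trans large (card-mono (λ h → into (h , foot∈R (X⊑W h)))))
  open Pieces parts

  A : Fin t → VSet n
  A i = tokens (T i)

  A⊑W : ∀ i → A i ⊑ W
  A⊑W i h = X⊑W (proj₁ (out h))

  link : ∀ i j → Unlinked (Edge G) W X K M ⊎ Linkage (Edge G) W (A i) (A j) K
  link i j with menger G W (A i) (A j) K (A⊑W i) (A⊑W j)
  ... | inj₂ Λ = inj₂ Λ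
  ... | inj₁ S = inj₁ record { A = A i; B = A j; A⊑X = λ h → proj₁ (out h); B⊑X = λ h → proj₁ (out h)
                             ; A-large = <⇒≤ (heavy i); B-large = <⇒≤ (heavy j); separation = S }

  module Linked (Λ : ∀ i j → Linkage (Edge G) W (A i) (A j) K) where
    open Linkage

    from to : Fin (t * t) → Fin t
    from e = proj₁ (remQuot {t} t e)
    to e = proj₂ (remQuot {t} t e)

    Λ′ : ∀ e → Linkage (Edge G) W (A (from e)) (A (to e)) K
    Λ′ e = Λ (from e) (to e)

    Meets : Fin (t * t) → Fin (t * t) → Fin K → Fin K → Set
    Meets e e′ i j = ∃ λ x → x ∈ path (Λ′ e) i × x ∈ path (Λ′ e′) j

    meets? : ∀ e e′ i j → Dec (Meets e e′ i j)
    meets? e e′ i j = any? (λ x → (x ∈? path (Λ′ e) i) ×-dec (x ∈? path (Λ′ e′) j))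

    open Refine {K} (GridSize.k size)

    crossing-model : Crossing Meets → Model (Edge G) (R ∪ W) t
    crossing-model C = Grid.grid-model G Δ deg R W R-connected apart foot foot-edge foot∈R t size
      (λ i → path (Λ′ e) (P i)) (λ j → path (Λ′ e′) (Q j))
      (λ i → inside (Λ′ e) (P i)) (λ j → inside (Λ′ e′) (Q j))
      (λ a b → P-injective (disjoint (Λ′ e) a b)) (λ a b → Q-injective (disjoint (Λ′ e′) a b))
      (λ i → conn (Λ′ e) (P i)) (λ j → conn (Λ′ e′) (Q j))
      (λ i j → proj₁ (crosses i j)) (λ i j → proj₁ (proj₂ (crosses i j))) (λ i j → proj₂ (proj₂ (crosses i j)))
      where open Crossing C

    module Disjoint (c : Fin (t * t) → Fin K) (avoids : ∀ e e′ → e ≢ e′ → ¬ Meets e e′ (c e) (c e′)) where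
      D : Fin (t * t) → VSet n
      D e = path (Λ′ e) (c e)

      s d : Fin (t * t) → Fin n
      s e = source (Λ′ e) (c e)
      d e = target (Λ′ e) (c e)

      same : ∀ {e e′ x} → x ∈ D e → x ∈ D e′ → e ≡ e′
      same {e} {e′} a b with e Fin.≟ e′
      ... | yes h = h
      ... | no ne = ⊥-elim (avoids e e′ ne (_ , a , b))

      links : Fin t → VSet n
      links i = ⟦ (λ x → any? (λ e → (from e Fin.≟ i) ×-dec (x ∈? D e))) ⟧

      -- A path joins the bag of the piece at its source; the foot of its target makes this bag
      -- adjacent to the piece at the other end.
      bag : Fin t → VSet n
      bag i = T i ∪ links i

      root : ∀ i → ∃ λ r → r ∈ T i
      root i with x , h ← nonempty (≤-trans (s≤s z≤n) (heavy i)) = foot x , proj₂ (out h)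

      T⊑bag : ∀ {i} → T i ⊑ bag i
      T⊑bag h = into (inj₁ h)
      D⊑bag : ∀ {i} e → from e ≡ i → D e ⊑ bag i
      D⊑bag e eq h = into (inj₂ (into (e , eq , h)))

      to-root : ∀ i {x} → x ∈ bag i → Conn (Edge G) (bag i) x (proj₁ (root i))
      to-root i x∈ with out x∈
      ... | inj₁ h = conn-mono (λ e → e) T⊑bag (T-connected i h (proj₂ (root i)))
      ... | inj₂ h with e , refl , h′ ← out h =
        conn-trans (conn-mono (λ e → e) (D⊑bag e refl) (conn (Λ′ e) (c e) h′ (source∈ (Λ′ e) (c e))))
          (step (D⊑bag e refl (source∈ (Λ′ e) (c e))) (foot-edge (A⊑W _ (source∈A (Λ′ e) (c e))))
            (conn-mono (λ e → e) T⊑bag (T-connected i (proj₂ (out (source∈A (Λ′ e) (c e)))) (proj₂ (root i)))))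

      bag⊑ : ∀ i → bag i ⊑ R ∪ W
      bag⊑ i h with out h
      ... | inj₁ a = into (inj₁ (T⊑ i a))
      ... | inj₂ a with e , refl , b ← out a = into (inj₂ (inside (Λ′ e) (c e) b))

      mixed : ∀ {i j x} → x ∈ T i → x ∈ links j → ⊥
      mixed a b with e , refl , h ← out b = apart (T⊑ _ a) (inside (Λ′ e) (c e) h)

      bag-disjoint : ∀ {i j x} → x ∈ bag i → x ∈ bag j → i ≡ j
      bag-disjoint a b with out a | out b
      ... | inj₁ a′ | inj₁ b′ = T-disjoint a′ b′
      ... | inj₁ a′ | inj₂ b′ = ⊥-elim (mixed a′ b′)
      ... | inj₂ a′ | inj₁ b′ = ⊥-elim (mixed b′ a′)
      ... | inj₂ a′ | inj₂ b′ with e , refl , h ← out a′ | e′ , refl , h′ ← out b′ = cong from (same h h′)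

      bag-adjacent : ∀ i j → ∃ λ u → ∃ λ v → u ∈ bag i × v ∈ bag j × Edge G u v
      bag-adjacent i j = d e , foot (d e) , D⊑bag e (cong proj₁ (remQuot-combine i j)) (target∈ (Λ′ e) (c e)) ,
        T⊑bag (subst (λ l → foot (d e) ∈ T l) (cong proj₂ (remQuot-combine i j)) (proj₂ (out (target∈B (Λ′ e) (c e))))) ,
        foot-edge (A⊑W _ (target∈B (Λ′ e) (c e)))
        where
        e : Fin (t * t)
        e = combine i j

      disjoint-model : Model (Edge G) (R ∪ W) t
      disjoint-model = record
        { bag = bag; bag⊑ = bag⊑; point = λ i → proj₁ (root i); point∈ = λ i → T⊑bag (proj₂ (root i))
        ; connected = λ i → hub-connected (edge-sym G) _ (to-root i); disjoint = bag-disjoint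
        ; adjacent = λ i j _ → bag-adjacent i j }

    linked-model : Model (Edge G) (R ∪ W) t
    linked-model with refine (t * t) Meets meets? (λ { (x , a , b) → x , b , a }) (λ _ → full) (λ _ → ≤-reflexive (sym (card-full K)))
    ... | inj₂ C = crossing-model C
    ... | inj₁ (c , _ , avoids) = Disjoint.disjoint-model c avoids

  abstract
    model-or-unlinked : Model (Edge G) (R ∪ W) t ⊎ Unlinked (Edge G) W X K M
    model-or-unlinked with collect (λ i → collect (link i))
    ... | inj₁ u = inj₂ u
    ... | inj₂ Λ = inj₁ (Linked.linked-model Λ)

-- Quotients by connected classes

fiber : (Fin n → Fin n) → Fin n → VSet n
fiber π y = ⟦ (λ x → π x Fin.≟ y) ⟧

does-true : {P : Set} (d : Dec P) → does d ≡ true → P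
does-true (yes h) _ = h

-- The quotient keeps the vertex set: the class of x is represented by π x.
module Quotient (G : Graph n) (D : VSet n) (π : Fin n → Fin n)
  (retract : ∀ {w} → w ∈ D → Conn (Edge G) (D ∩ fiber π (π w)) w (π w)) where

  Joined : Rel n
  Joined a b = a ≢ b × ∃ λ u → ∃ λ v → (u ∈ D × v ∈ D) × (π u ≡ a × π v ≡ b) × Edge G u v

  joined? : ∀ a b → Dec (Joined a b)
  joined? a b = ¬? (a Fin.≟ b) ×-dec any? (λ u → any? (λ v →
    ((u ∈? D) ×-dec (v ∈? D)) ×-dec (((π u Fin.≟ a) ×-dec (π v Fin.≟ b)) ×-dec edge? G u v)))

  joined-sym : ∀ {a b} → Joined a b → Joined b a
  joined-sym (ne , u , v , (u∈ , v∈) , (e , e′) , uv) = (λ h → ne (sym h)) , v , u , (v∈ , u∈) , (e′ , e) , edge-sym G uv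

  quotient : Graph n
  quotient = record
    { adj = λ a b → does (joined? a b)
    ; sym = λ a b → does-⇔ (mk⇔ joined-sym joined-sym) (joined? a b) (joined? b a)
    ; irrefl = λ a → dec-false (joined? a a) (λ h → proj₁ h refl) }

  from-edge : ∀ {a b} → Edge quotient a b → Joined a b
  from-edge {a} {b} e = does-true (joined? a b) e

  to-edge : ∀ {a b} → Joined a b → Edge quotient a b
  to-edge {a} {b} h = dec-true (joined? a b) h

  quotient-degree : ∀ {Δ c} → Degree≤ G Δ → (∀ y → card (D ∩ fiber π y) ≤ c) → Degree≤ quotient (c * Δ)
  quotient-degree {Δ} {c} deg small a = ≤-trans (card-⋃ (D ∩ fiber π a) image Δ covers
      (λ {u} _ → subst (card (image u) ≤_) (*-identityʳ Δ)
        (≤-trans (card-⋃ (adj G u) (λ v → ⁅ π v ⁆) 1 (λ h → let v , e , f = out h in v , holds e , into (sym f))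
          (λ _ → card-⁅⁆ _)) (*-monoˡ-≤ 1 (deg u))))) (*-monoˡ-≤ Δ (small a))
    where
    image : Fin n → VSet n
    image u = ⟦ (λ b → any? (λ v → edge? G u v ×-dec (π v Fin.≟ b))) ⟧
    covers : ∀ {b} → b ∈ adj quotient a → ∃ λ u → u ∈ D ∩ fiber π a × b ∈ image u
    covers (holds e) with _ , u , v , (u∈ , v∈) , (f , f′) , uv ← from-edge e = u , into (u∈ , into f) , into (v , uv , f′)

  module _ (D′ : VSet n) (D′⊑ : ∀ {a} → a ∈ D′ → a ∈ D × π a ≡ a) {t : ℕ} (m : Model (Edge quotient) D′ t) where
    open Model m

    lift : Fin t → VSet n
    lift i = ⟦ (λ w → (w ∈? D) ×-dec (π w ∈? bag i)) ⟧

    lift-point : ∀ {i a} → a ∈ bag i → a ∈ lift i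
    lift-point {i} h with a∈ , e ← D′⊑ (bag⊑ i h) = into (a∈ , subst (_∈ bag i) (sym e) h)

    to-rep : ∀ {i w} → w ∈ lift i → Conn (Edge G) (lift i) w (π w)
    to-rep {i} h = conn-mono (λ e → e) (λ h′ → into (proj₁ (out h′) ,
      subst (_∈ bag i) (sym (out (proj₂ (out h′)))) (proj₂ (out h)))) (retract (proj₁ (out h)))

    same-class : ∀ {i u v} → u ∈ lift i → v ∈ lift i → π u ≡ π v → Conn (Edge G) (lift i) u v
    same-class {i} {u} a b e = conn-trans (to-rep a) (conn-sym (edge-sym G)
      (subst (Conn (Edge G) (lift i) _) (sym e) (to-rep b)))

    lift-conn : ∀ {i a b} → Conn (Edge quotient) (bag i) a b → ∀ {u v} → u ∈ lift i → π u ≡ a → v ∈ lift i → π v ≡ b →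
      Conn (Edge G) (lift i) u v
    lift-conn (stop _) u∈ e v∈ f = same-class u∈ v∈ (trans e (sym f))
    lift-conn {i} (step a∈ ab c) u∈ e v∈ f with _ , u′ , v′ , (u′∈ , v′∈) , (e′ , f′) , uv ← from-edge ab =
      conn-trans (same-class u∈ u′∈lift (trans e (sym e′)))
        (step u′∈lift uv (lift-conn c v′∈lift f′ v∈ f))
      where
      u′∈lift : u′ ∈ lift i
      u′∈lift = into (u′∈ , subst (_∈ bag i) (sym e′) a∈)
      v′∈lift : v′ ∈ lift i
      v′∈lift = into (v′∈ , subst (_∈ bag i) (sym f′) (conn-start c))

    lift-model : Model (Edge G) D t
    lift-model = record
      { bag = lift; bag⊑ = λ i h → proj₁ (out h)
      ; point = point; point∈ = λ i → lift-point (point∈ i)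
      ; connected = λ i a b → lift-conn (connected i (proj₂ (out a)) (proj₂ (out b))) a refl b refl
      ; disjoint = λ a b → disjoint (proj₂ (out a)) (proj₂ (out b))
      ; adjacent = adj′ }
      where
      adj′ : ∀ i j → i ≢ j → ∃ λ u → ∃ λ v → u ∈ lift i × v ∈ lift j × Edge G u v
      adj′ i j ne with a , b , a∈ , b∈ , ab ← adjacent i j ne
        with _ , u , v , (u∈ , v∈) , (e , f) , uv ← from-edge ab =
        u , v , into (u∈ , subst (_∈ bag i) (sym e) a∈) , into (v∈ , subst (_∈ bag j) (sym f) b∈) , uv

-- Contracting a window onto its lowest layer

module Window (G : Graph n) (Δ : ℕ) (deg : Degree≤ G Δ) (R W : VSet n) (R-connected : Connected (Edge G) R)
  (apart : ∀ {x} → x ∈ R → x ∉ W) (π : Fin n → Fin n)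
  (π-R : ∀ {x} → x ∈ R → π x ≡ x) (π-W : ∀ {w} → w ∈ W → π w ∈ W × π (π w) ≡ π w)
  (retract : ∀ {w} → w ∈ W → Conn (Edge G) (W ∩ fiber π (π w)) w (π w))
  (c : ℕ) (small : ∀ y → card (W ∩ fiber π y) ≤ suc c)
  (foot : Fin n → Fin n) (foot-edge : ∀ {w} → w ∈ W → π w ≡ w → Edge G w (foot w) × foot w ∈ R)
  (t : ℕ) (size : GridSize (suc c * Δ) t) (X : VSet n) (X⊑W : X ⊑ W) (M : ℕ)
  (large : linkSize (suc c * Δ) t M * suc c ≤ card X) where

  retract′ : ∀ {w} → w ∈ R ∪ W → Conn (Edge G) ((R ∪ W) ∩ fiber π (π w)) w (π w)
  retract′ {w} h with out h
  ... | inj₁ a = subst (Conn _ _ w) (sym (π-R a)) (stop (into (h , into refl)))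
  ... | inj₂ a = conn-mono (λ e → e) (λ b → into (into (inj₂ (proj₁ (out b))) , proj₂ (out b))) (retract a)

  open Quotient G (R ∪ W) π retract′

  small′ : ∀ y → card ((R ∪ W) ∩ fiber π y) ≤ suc c
  small′ y with y ∈? R
  ... | no y∉ = ≤-trans (card-mono sub) (small y)
    where
    sub : (R ∪ W) ∩ fiber π y ⊑ W ∩ fiber π y
    sub h with out (proj₁ (out h))
    ... | inj₁ a = ⊥-elim (y∉ (subst (_∈ R) (trans (sym (π-R a)) (out (proj₂ (out h)))) a))
    ... | inj₂ a = into (a , proj₂ (out h))
  ... | yes y∈ = ≤-trans (card≤1 one) (s≤s z≤n)
    where
    is-y : ∀ {x} → x ∈ (R ∪ W) ∩ fiber π y → x ≡ y
    is-y h with out (proj₁ (out h))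
    ... | inj₁ a = trans (sym (π-R a)) (out (proj₂ (out h)))
    ... | inj₂ a = ⊥-elim (apart y∈ (subst (_∈ W) (out (proj₂ (out h))) (proj₁ (π-W a))))
    one : ∀ {x x′} → x ∈ (R ∪ W) ∩ fiber π y → x′ ∈ (R ∪ W) ∩ fiber π y → x ≡ x′
    one a b = trans (is-y a) (sym (is-y b))

  W₀ : VSet n
  W₀ = ⟦ (λ w → (w ∈? W) ×-dec (π w Fin.≟ w)) ⟧

  X₀ : VSet n
  X₀ = ⟦ (λ y → any? (λ x → (x ∈? X) ×-dec (π x Fin.≟ y))) ⟧

  X₀⊑W₀ : X₀ ⊑ W₀
  X₀⊑W₀ h with x , x∈ , refl ← out h = into (π-W (X⊑W x∈))

  proper : ∀ {u v} → Edge G u v → u ≢ v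
  proper {u} e refl with () ← trans (sym e) (irrefl G u)

  R-edge : ∀ {u v} → u ∈ R → v ∈ R → Edge G u v → Edge quotient u v
  R-edge a b e = to-edge (proper e , _ , _ , (into (inj₁ a) , into (inj₁ b)) , (π-R a , π-R b) , e)

  R-connected′ : Connected (Edge quotient) R
  R-connected′ a b = go (R-connected a b)
    where
    go : ∀ {u v} → Conn (Edge G) R u v → Conn (Edge quotient) R u v
    go (stop h) = stop h
    go (step h e p) = step h (R-edge h (conn-start p) e) (go p)

  foot-edge′ : ∀ {w} → w ∈ W₀ → Edge quotient w (foot w)
  foot-edge′ h with a , e ← out h with f , b ← foot-edge a e =
    to-edge (proper f , _ , _ , (into (inj₂ a) , into (inj₁ b)) , (e , π-R b) , f)

  large₀ : linkSize (suc c * Δ) t M ≤ card X₀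
  large₀ = *-cancelʳ-≤ _ _ (suc c) (≤-trans large (card-⋃ X₀ (λ y → W ∩ fiber π y) (suc c)
    (λ {x} h → π x , into (x , h , refl) , into (X⊑W h , into refl)) (λ {y} _ → small y)))

  private
    K : ℕ
    K = linkOrder t size

  pull : VSet n → VSet n
  pull p = ⟦ (λ w → (w ∈? W) ×-dec (π w ∈? p)) ⟧

  pull-X : VSet n → VSet n
  pull-X p = ⟦ (λ x → (x ∈? X) ×-dec (π x ∈? p)) ⟧

  -- Membership in a pulled-back side depends only on the class, so an edge of `G` crossing it would
  -- join different classes and cross in the quotient. The order grows by the class size, while `A`
  -- and `B` do not shrink because every vertex of `X₀` comes from `X`.
  pull-unlinked : Unlinked (Edge quotient) W₀ X₀ K M → Unlinked (Edge G) W X (suc (K * suc c)) M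
  pull-unlinked u = record
    { A = pull-X A; B = pull-X B
    ; A⊑X = λ h → proj₁ (out h); B⊑X = λ h → proj₁ (out h)
    ; A-large = ≤-trans A-large (size-pull A A⊑X); B-large = ≤-trans B-large (size-pull B B⊑X)
    ; separation = record
      { L = pull L; R = pull R′
      ; L⊑ = λ h → proj₁ (out h); R⊑ = λ h → proj₁ (out h)
      ; cover = cover′
      ; A⊑ = λ h → into (X⊑W (proj₁ (out h)) , A⊑ (proj₂ (out h)))
      ; B⊑ = λ h → into (X⊑W (proj₁ (out h)) , B⊑ (proj₂ (out h)))
      ; crossing = crossing′
      ; order = s≤s (≤-trans (card-⋃ (L ∩ R′) (λ y → W ∩ fiber π y) (suc c)
          (λ {w} h → π w , into (proj₂ (out (proj₁ (out h))) , proj₂ (out (proj₂ (out h)))) ,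
             into (proj₁ (out (proj₁ (out h))) , into refl))
          (λ {y} _ → small y)) (*-monoˡ-≤ (suc c) (<⇒≤ order))) } }
    where
    open Unlinked u
    open Separation separation renaming (R to R′)
    size-pull : ∀ p → p ⊑ X₀ → card p ≤ card (pull-X p)
    size-pull p sub = subst (card p ≤_) (*-identityʳ _) (card-⋃ (pull-X p) (λ x → ⁅ π x ⁆) 1
      (λ {y} h → let x , x∈ , e = out (sub h) in x , into (x∈ , subst (_∈ p) (sym e) h) , into (sym e)) (λ _ → card-⁅⁆ _))
    cover′ : ∀ {x} → x ∈ W → x ∈ pull L ⊎ x ∈ pull R′
    cover′ h with cover (into (π-W h))
    ... | inj₁ a = inj₁ (into (h , a))
    ... | inj₂ a = inj₂ (into (h , a))
    crossing′ : ∀ {u v} → u ∈ pull L → u ∉ pull R′ → v ∈ pull R′ → v ∉ pull L → ¬ Edge G u v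
    crossing′ {u} {v} uL u∉ vR v∉ e with a , aL ← out uL | b , bR ← out vR =
      crossing aL (λ h → u∉ (into (a , h))) bR bL
        (to-edge ((λ eq → bL (subst (_∈ L) eq aL)) , u , v , (into (inj₂ a) , into (inj₂ b)) , (refl , refl) , e))
      where
      bL : π v ∉ L
      bL h = v∉ (into (b , h))

  fixed : ∀ {a} → a ∈ R ∪ W₀ → a ∈ R ∪ W × π a ≡ a
  fixed h with out h
  ... | inj₁ a = into (inj₁ a) , π-R a
  ... | inj₂ a = into (inj₂ (proj₁ (out a))) , proj₂ (out a)

  abstract
    window-model-or-unlinked : Model (Edge G) (R ∪ W) t ⊎ Unlinked (Edge G) W X (suc (K * suc c)) M
    window-model-or-unlinked = finish (Hub.model-or-unlinked quotient (suc c * Δ) (quotient-degree deg small′) R W₀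
        R-connected′ (λ a b → apart a (proj₁ (out b))) foot foot-edge′
        (λ h → proj₂ (foot-edge (proj₁ (out h)) (proj₂ (out h)))) t size X₀ X₀⊑W₀ M large₀)
      where
      finish : Model (Edge quotient) (R ∪ W₀) t ⊎ Unlinked (Edge quotient) W₀ X₀ K M →
        Model (Edge G) (R ∪ W) t ⊎ Unlinked (Edge G) W X (suc (K * suc c)) M
      finish (inj₁ m) = inj₁ (lift-model (R ∪ W₀) fixed m)
      finish (inj₂ u) = inj₂ (pull-unlinked u)

-- Two-colourings from separations

mono : VSet n → (Fin n → Bool) → Bool → VSet n
mono U colour b = ⟦ (λ x → (x ∈? U) ×-dec (colour x Bool.≟ b)) ⟧

Clustered : Rel n → VSet n → (Fin n → Bool) → ℕ → Set
Clustered E U colour N = ∀ b v D → (∀ {u} → u ∈ D → Conn E (mono U colour b) v u) → card D ≤ N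

conn-side : {E : Rel n} {p L R : VSet n} →
  (∀ {u w} → u ∈ p → w ∈ p → u ∈ L → u ∉ R → w ∈ R → w ∉ L → ¬ E u w) →
  (∀ {x} → x ∈ p → x ∈ L ⊎ x ∈ R) → (∀ {x} → x ∈ p → x ∈ L → x ∉ R) →
  ∀ {v u} → v ∈ L → Conn E p v u → Conn E (p ∩ L) v u
conn-side {E = E} {p} {L} {R} crossing cover apart = conn-within next
  where
  next : ∀ {u w} → u ∈ L → u ∈ p → w ∈ p → E u w → w ∈ L
  next {u} {w} uL u∈ w∈ e with w ∈? L
  ... | yes h = h
  ... | no h with cover w∈
  ...   | inj₁ a = a
  ...   | inj₂ a = ⊥-elim (crossing u∈ w∈ uL (apart u∈ uL) a h e)

choose-by : {P : Set} → Dec P → Bool → Bool → Bool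
choose-by (yes _) a b = a
choose-by (no _) a b = b

choose-yes : {P : Set} (d : Dec P) {a b : Bool} → P → choose-by d a b ≡ a
choose-yes (yes _) _ = refl
choose-yes (no h) p = ⊥-elim (h p)

choose-no : {P : Set} (d : Dec P) {a b : Bool} → ¬ P → choose-by d a b ≡ b
choose-no (yes p) h = ⊥-elim (h p)
choose-no (no _) _ = refl

true≢false : {b : Bool} → b ≡ true → b ≡ false → ⊥
true≢false refl ()

-- `L` and `R` may reach beyond `W`: the separation is found in three layers and only its trace on
-- the middle one matters.
record Shrunk (E : Rel n) (W S : VSet n) : Set where
  field
    L R : VSet n
    cover : ∀ {x} → x ∈ W → x ∈ L ⊎ x ∈ R
    crossing : ∀ {u v} → u ∈ W → v ∈ W → u ∈ L → u ∉ R → v ∈ R → v ∉ L → ¬ E u v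
    shrinkˡ : card ((S ∩ L) ∪ ((L ∩ R) ∩ W)) < card S
    shrinkʳ : card ((S ∩ R) ∪ ((L ∩ R) ∩ W)) < card S

module TwoColour (G : Graph n) (Δ : ℕ) (deg : Degree≤ G Δ) (W : VSet n) (θ : ℕ) (θ≥1 : 1 ≤ θ)
  (split : ∀ S → S ⊑ W → θ < card S → Shrunk (Edge G) W S) where

  -- A bag of `θ` vertices has at most `σ` neighbours, which form the next boundary. Every merge
  -- costs at least one boundary vertex and doubles the bound on the bag, so there are at most `σ`
  -- doublings.
  σ bound : ℕ
  σ = θ * Δ
  bound = θ * 2 ^ σ

  -- B-boundary makes B a union of monochromatic components; this is what lets colourings be glued along bags.
  record Colouring (U S : VSet n) (s : ℕ) : Set where
    field
      colour : Fin n → Bool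
      B : VSet n
      S⊑B : S ⊑ B
      B⊑U : B ⊑ U
      B-small : card B ≤ θ * 2 ^ s
      B-colour : ∀ {x} → x ∈ B → colour x ≡ false
      B-boundary : ∀ {x y} → x ∈ B → y ∈ U → y ∉ B → Edge G x y → colour y ≡ true
      clustered : Clustered (Edge G) U colour bound

  module Bag {U B : VSet n} {colour : Fin n → Bool} (B-colour : ∀ {x} → x ∈ B → colour x ≡ false)
    (B-boundary : ∀ {x y} → x ∈ B → y ∈ U → y ∉ B → Edge G x y → colour y ≡ true) where

    inside : ∀ {b v u} → Conn (Edge G) (mono U colour b) v u → v ∈ B → u ∈ B
    inside {b} = conn-invariant (_∈ B) next
      where
      next : ∀ {u w} → u ∈ B → u ∈ mono U colour b → w ∈ mono U colour b → Edge G u w → w ∈ B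
      next {u} {w} u∈B u∈ w∈ e with w ∈? B
      ... | yes h = h
      ... | no h = ⊥-elim (true≢false (B-boundary u∈B (proj₁ (out w∈)) h e)
                     (trans (proj₂ (out w∈)) (trans (sym (proj₂ (out u∈))) (B-colour u∈B))))

    outside : ∀ {b v u} → v ∈ U ∖ B → Conn (Edge G) (mono U colour b) v u → Conn (Edge G) (mono U colour b ∩ (U ∖ B)) v u
    outside {b} = conn-within next
      where
      next : ∀ {u w} → u ∈ U ∖ B → u ∈ mono U colour b → w ∈ mono U colour b → Edge G u w → w ∈ U ∖ B
      next {u} {w} u∈ u∈m w∈m e = into (proj₁ (out w∈m) , λ h → true≢false
        (B-boundary h (proj₁ (out u∈)) (proj₂ (out u∈)) (edge-sym G e))
        (trans (proj₂ (out u∈m)) (trans (sym (proj₂ (out w∈m))) (B-colour h))))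

    clusters : card B ≤ bound → (∀ b v D → v ∈ U → v ∉ B →
      (∀ {u} → u ∈ D → Conn (Edge G) (mono U colour b ∩ (U ∖ B)) v u) → card D ≤ bound) → Clustered (Edge G) U colour bound
    clusters small rest b v D reach = cases (v ∈? U) (v ∈? B)
      where
      cases : Dec (v ∈ U) → Dec (v ∈ B) → card D ≤ bound
      cases (no v∉) _ = ≤-trans (≤-reflexive (card-∅ (λ x h → v∉ (proj₁ (out (conn-start (reach h))))))) z≤n
      cases (yes _) (yes h) = ≤-trans (card-mono (λ d → inside (reach d) h)) small
      cases (yes v∈) (no h) = rest b v D v∈ h (λ d → outside (into (v∈ , h)) (reach d))

  pow : ∀ {s} → s ≤ σ → θ * 2 ^ s ≤ bound
  pow le = *-monoʳ-≤ θ (^-monoʳ-≤ 2 le)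

  empty : ∀ {U S : VSet n} {s} → S ⊑ U → (∀ x → x ∉ U) → Colouring U S s
  empty S⊑U none = record
    { colour = λ _ → false; B = ∅; S⊑B = λ h → ⊥-elim (none _ (S⊑U h)); B⊑U = λ { (holds ()) }
    ; B-small = ≤-trans (≤-reflexive (card-∅ {p = ∅} (λ { _ (holds ()) }))) z≤n
    ; B-colour = λ _ → refl; B-boundary = λ { (holds ()) }
    ; clustered = λ b v D reach → ≤-trans (≤-reflexive (card-∅ (λ x h → none v (proj₁ (out (conn-start (reach h))))))) z≤n }

  module Layer {U S S″ : VSet n} (s : ℕ) (S⊑ : S ⊑ S″) (S″⊑U : S″ ⊑ U) (small : card S″ ≤ θ) where
    S′ : VSet n
    S′ = ⟦ (λ y → (y ∈? U ∖ S″) ×-dec any? (λ x → (x ∈? S″) ×-dec edge? G x y)) ⟧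

    S′-small : card S′ ≤ σ
    S′-small = ≤-trans (card-⋃ S″ (adj G) Δ (λ h → let x , x∈ , e = proj₂ (out h) in x , x∈ , holds e) (λ _ → deg _))
      (*-monoˡ-≤ Δ small)

    -- The recursive colouring gives `false` to the neighbours of `S″`. Negating it makes them
    -- `true` without changing any cluster, and `S″` can receive `false`.
    extend : Colouring (U ∖ S″) S′ σ → Colouring U S s
    extend r = record
      { colour = colour; B = S″; S⊑B = S⊑; B⊑U = S″⊑U
      ; B-small = ≤-trans small (≤-trans (≤-reflexive (sym (*-identityʳ θ))) (*-monoʳ-≤ θ (m^n>0 2 s)))
      ; B-colour = B-colour; B-boundary = B-boundary
      ; clustered = Bag.clusters B-colour B-boundary
          (≤-trans small (≤-trans (≤-reflexive (sym (*-identityʳ θ))) (*-monoʳ-≤ θ (m^n>0 2 σ))))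
          (λ b v D v∈ v∉ reach → r.clustered (not b) v D (λ d → conn-mono (λ e → e) flip (reach d))) }
      where
      module r = Colouring r
      colour : Fin n → Bool
      colour x = choose-by (x ∈? S″) false (not (r.colour x))
      B-colour : ∀ {x} → x ∈ S″ → colour x ≡ false
      B-colour {x} h = choose-yes (x ∈? S″) h
      B-boundary : ∀ {x y} → x ∈ S″ → y ∈ U → y ∉ S″ → Edge G x y → colour y ≡ true
      B-boundary {x} {y} x∈ y∈ y∉ e = trans (choose-no (y ∈? S″) y∉)
        (cong not (r.B-colour (r.S⊑B (into (into (y∈ , y∉) , x , x∈ , e)))))
      flip : ∀ {b} → mono U colour b ∩ (U ∖ S″) ⊑ mono (U ∖ S″) r.colour (not b)
      flip {b} {x} h with m , x∈ ← out h = into (x∈ , trans (sym (Bool.not-involutive (r.colour x)))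
        (cong not (trans (sym (choose-no (x ∈? S″) (proj₂ (out x∈)))) (proj₂ (out m)))))

  module Merge {U S : VSet n} (U⊑W : U ⊑ W) (sh : Shrunk (Edge G) W S) (s : ℕ) (suc-s≤σ : suc s ≤ σ) where
    open Shrunk sh
    U₁ U₂ S₁ S₂ : VSet n
    U₁ = U ∩ L
    U₂ = U ∩ R
    S₁ = (S ∩ L) ∪ ((L ∩ R) ∩ U)
    S₂ = (S ∩ R) ∪ ((L ∩ R) ∩ U)

    S₁⊑U₁ : S ⊑ U → S₁ ⊑ U₁
    S₁⊑U₁ sub h with out h
    ... | inj₁ a = into (sub (proj₁ (out a)) , proj₂ (out a))
    ... | inj₂ a = into (proj₂ (out a) , proj₁ (out (proj₁ (out a))))
    S₂⊑U₂ : S ⊑ U → S₂ ⊑ U₂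
    S₂⊑U₂ sub h with out h
    ... | inj₁ a = into (sub (proj₁ (out a)) , proj₂ (out a))
    ... | inj₂ a = into (proj₂ (out a) , proj₂ (out (proj₁ (out a))))

    S₁-small : card S₁ < card S
    S₁-small = ≤-<-trans (card-mono f) shrinkˡ
      where
      f : S₁ ⊑ (S ∩ L) ∪ ((L ∩ R) ∩ W)
      f h with out h
      ... | inj₁ a = into (inj₁ a)
      ... | inj₂ a = into (inj₂ (into (proj₁ (out a) , U⊑W (proj₂ (out a)))))
    S₂-small : card S₂ < card S
    S₂-small = ≤-<-trans (card-mono f) shrinkʳ
      where
      f : S₂ ⊑ (S ∩ R) ∪ ((L ∩ R) ∩ W)
      f h with out h
      ... | inj₁ a = into (inj₁ a)
      ... | inj₂ a = into (inj₂ (into (proj₁ (out a) , U⊑W (proj₂ (out a)))))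

    -- On `L ∩ R` both colourings are `false`, because these vertices belong to both boundaries; so
    -- they can be combined. A monochromatic component outside `B` avoids `L ∩ R`, stays on one side
    -- and is bounded there; inside `B` the size of `B` is the bound.
    merge : S ⊑ U → Colouring U₁ S₁ s → Colouring U₂ S₂ s → Colouring U S (suc s)
    merge S⊑U r₁ r₂ = record
      { colour = colour; B = B; S⊑B = S⊑B; B⊑U = B⊑U
      ; B-small = B-small; B-colour = B-colour; B-boundary = B-boundary
      ; clustered = Bag.clusters B-colour B-boundary (≤-trans B-small (pow suc-s≤σ)) rest }
      where
      module r₁ = Colouring r₁
      module r₂ = Colouring r₂
      colour : Fin n → Bool
      colour x = choose-by (x ∈? L) (r₁.colour x) (r₂.colour x)
      B : VSet n
      B = r₁.B ∪ r₂.B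
      C⊑B₁ : ∀ {x} → x ∈ U → x ∈ L → x ∈ R → x ∈ r₁.B
      C⊑B₁ a b c = r₁.S⊑B (into (inj₂ (into (into (b , c) , a))))
      C⊑B₂ : ∀ {x} → x ∈ U → x ∈ L → x ∈ R → x ∈ r₂.B
      C⊑B₂ a b c = r₂.S⊑B (into (inj₂ (into (into (b , c) , a))))
      colour₁ : ∀ {x} → x ∈ U₁ → colour x ≡ r₁.colour x
      colour₁ {x} h = choose-yes (x ∈? L) (proj₂ (out h))
      colour₂ : ∀ {x} → x ∈ U₂ → colour x ≡ r₂.colour x
      colour₂ {x} h = go (x ∈? L)
        where
        go : (d : Dec (x ∈ L)) → choose-by d (r₁.colour x) (r₂.colour x) ≡ r₂.colour x
        go (no _) = refl
        go (yes l) with u , r ← out h = trans (r₁.B-colour (C⊑B₁ u l r)) (sym (r₂.B-colour (C⊑B₂ u l r)))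
      S⊑B : S ⊑ B
      S⊑B h with cover (U⊑W (S⊑U h))
      ... | inj₁ a = into (inj₁ (r₁.S⊑B (into (inj₁ (into (h , a))))))
      ... | inj₂ a = into (inj₂ (r₂.S⊑B (into (inj₁ (into (h , a))))))
      B⊑U : B ⊑ U
      B⊑U h with out h
      ... | inj₁ a = proj₁ (out (r₁.B⊑U a))
      ... | inj₂ a = proj₁ (out (r₂.B⊑U a))
      B-small : card B ≤ θ * 2 ^ suc s
      B-small = ≤-trans (card-∪ r₁.B r₂.B) (≤-trans (+-mono-≤ r₁.B-small r₂.B-small) (≤-reflexive (double θ (2 ^ s))))
        where
        double : ∀ a b → a * b + a * b ≡ a * (2 * b)
        double = solve-∀
      B-colour : ∀ {x} → x ∈ B → colour x ≡ false
      B-colour h with out h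
      ... | inj₁ a = trans (colour₁ (r₁.B⊑U a)) (r₁.B-colour a)
      ... | inj₂ a = trans (colour₂ (r₂.B⊑U a)) (r₂.B-colour a)
      boundary₁ : ∀ {x y} → x ∈ r₁.B → y ∈ U → y ∉ B → y ∈ L → Edge G x y → colour y ≡ true
      boundary₁ a y∈ y∉ l e = trans (colour₁ (into (y∈ , l))) (r₁.B-boundary a (into (y∈ , l)) (λ h → y∉ (into (inj₁ h))) e)
      boundary₂ : ∀ {x y} → x ∈ r₂.B → y ∈ U → y ∉ B → y ∈ R → Edge G x y → colour y ≡ true
      boundary₂ a y∈ y∉ l e = trans (colour₂ (into (y∈ , l))) (r₂.B-boundary a (into (y∈ , l)) (λ h → y∉ (into (inj₂ h))) e)
      B-boundary : ∀ {x y} → x ∈ B → y ∈ U → y ∉ B → Edge G x y → colour y ≡ true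
      B-boundary {x} {y} x∈ y∈ y∉ e with out x∈
      ... | inj₁ a = go (y ∈? L) (x ∈? R)
        where
        go : Dec (y ∈ L) → Dec (x ∈ R) → colour y ≡ true
        go (yes l) _ = boundary₁ a y∈ y∉ l e
        go (no ¬l) d with cover (U⊑W y∈)
        go (no ¬l) d | inj₁ l = ⊥-elim (¬l l)
        go (no ¬l) (yes r) | inj₂ r′ = boundary₂ (C⊑B₂ (proj₁ (out (r₁.B⊑U a))) (proj₂ (out (r₁.B⊑U a))) r) y∈ y∉ r′ e
        go (no ¬l) (no ¬r) | inj₂ r′ = ⊥-elim (crossing (U⊑W (proj₁ (out (r₁.B⊑U a)))) (U⊑W y∈) (proj₂ (out (r₁.B⊑U a))) ¬r r′ ¬l e)
      ... | inj₂ a = go (y ∈? R) (x ∈? L)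
        where
        go : Dec (y ∈ R) → Dec (x ∈ L) → colour y ≡ true
        go (yes l) _ = boundary₂ a y∈ y∉ l e
        go (no ¬l) d with cover (U⊑W y∈)
        go (no ¬l) d | inj₂ l = ⊥-elim (¬l l)
        go (no ¬l) (yes r) | inj₁ r′ = boundary₁ (C⊑B₁ (proj₁ (out (r₂.B⊑U a))) r (proj₂ (out (r₂.B⊑U a)))) y∈ y∉ r′ e
        go (no ¬l) (no ¬r) | inj₁ r′ = ⊥-elim (crossing (U⊑W y∈) (U⊑W (proj₁ (out (r₂.B⊑U a)))) r′ ¬l (proj₂ (out (r₂.B⊑U a))) ¬r (edge-sym G e))
      rest : ∀ b v D → v ∈ U → v ∉ B → (∀ {u} → u ∈ D → Conn (Edge G) (mono U colour b ∩ (U ∖ B)) v u) → card D ≤ bound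
      rest b v D v∈ v∉ reach with cover (U⊑W v∈)
      ... | inj₁ l = r₁.clustered b v D (λ d → conn-mono (λ e → e) sub (conn-side crossing′ cover′ apart l (reach d)))
        where
        in-U : ∀ {x} → x ∈ mono U colour b ∩ (U ∖ B) → x ∈ U
        in-U h = proj₁ (out (proj₂ (out h)))
        crossing′ : ∀ {u w} → u ∈ mono U colour b ∩ (U ∖ B) → w ∈ mono U colour b ∩ (U ∖ B) →
          u ∈ L → u ∉ R → w ∈ R → w ∉ L → ¬ Edge G u w
        crossing′ u∈ w∈ = crossing (U⊑W (in-U u∈)) (U⊑W (in-U w∈))
        cover′ : ∀ {x} → x ∈ mono U colour b ∩ (U ∖ B) → x ∈ L ⊎ x ∈ R
        cover′ h = cover (U⊑W (in-U h))
        apart : ∀ {x} → x ∈ mono U colour b ∩ (U ∖ B) → x ∈ L → x ∉ R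
        apart h l r = proj₂ (out (proj₂ (out h))) (into (inj₁ (C⊑B₁ (in-U h) l r)))
        sub : (mono U colour b ∩ (U ∖ B)) ∩ L ⊑ mono U₁ r₁.colour b
        sub h with m , l ← out h = into (into (in-U m , l) , trans (sym (colour₁ (into (in-U m , l)))) (proj₂ (out (proj₁ (out m)))))
      ... | inj₂ l = r₂.clustered b v D (λ d → conn-mono (λ e → e) sub (conn-side crossing′ cover′ apart l (reach d)))
        where
        in-U : ∀ {x} → x ∈ mono U colour b ∩ (U ∖ B) → x ∈ U
        in-U h = proj₁ (out (proj₂ (out h)))
        crossing′ : ∀ {u w} → u ∈ mono U colour b ∩ (U ∖ B) → w ∈ mono U colour b ∩ (U ∖ B) →
          u ∈ R → u ∉ L → w ∈ L → w ∉ R → ¬ Edge G u w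
        crossing′ u∈ w∈ uR uL wL wR e = crossing (U⊑W (in-U w∈)) (U⊑W (in-U u∈)) wL wR uR uL (edge-sym G e)
        cover′ : ∀ {x} → x ∈ mono U colour b ∩ (U ∖ B) → x ∈ R ⊎ x ∈ L
        cover′ h with cover (U⊑W (in-U h))
        ... | inj₁ a = inj₂ a
        ... | inj₂ a = inj₁ a
        apart : ∀ {x} → x ∈ mono U colour b ∩ (U ∖ B) → x ∈ R → x ∉ L
        apart h r l = proj₂ (out (proj₂ (out h))) (into (inj₁ (C⊑B₁ (in-U h) l r)))
        sub : (mono U colour b ∩ (U ∖ B)) ∩ R ⊑ mono U₂ r₂.colour b
        sub h with m , l ← out h = into (into (in-U m , l) , trans (sym (colour₂ (into (in-U m , l)))) (proj₂ (out (proj₁ (out m)))))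

  -- Colouring a bag has to make `U` smaller, so an empty boundary is replaced by a single vertex;
  -- `θ ≥ 1` makes room for it.
  enlarge : {U S : VSet n} → S ⊑ U → card S ≤ θ →
    (∀ x → x ∉ U) ⊎ (∃ λ S″ → S ⊑ S″ × S″ ⊑ U × card S″ ≤ θ × ∃ λ x → x ∈ S″)
  enlarge {U} {S} S⊑U le with any? (_∈? S) | any? (_∈? U)
  ... | yes (x , h) | _ = inj₂ (S , (λ h → h) , S⊑U , le , x , h)
  ... | no _ | no h = inj₁ (λ x x∈ → h (x , x∈))
  ... | no h | yes (x , x∈) = inj₂ (⁅ x ⁆ , (λ {y} y∈ → ⊥-elim (h (y , y∈))) ,
        (λ y∈ → subst (_∈ U) (sym (out y∈)) x∈) , ≤-trans (card-⁅⁆ x) θ≥1 , x , into refl)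

  abstract
    -- Solved by lexicographic induction on `u` and `s`: a split may leave `U` as large as before
    -- but shrinks `S`, whereas colouring a bag shrinks `U` and lets the boundary grow back to `σ`.
    Solve : ℕ → ℕ → Set
    Solve u s = ∀ U S → U ⊑ W → S ⊑ U → card U ≤ u → card S ≤ s → s ≤ σ → Colouring U S s

    small-case : ∀ u s → Solve u σ → ∀ U S → U ⊑ W → S ⊑ U → card U ≤ suc u → card S ≤ θ → Colouring U S s
    small-case u s solve U S U⊑W S⊑U le small with enlarge S⊑U small
    ... | inj₁ none = empty S⊑U none
    ... | inj₂ (S″ , S⊑ , S″⊑U , small″ , x , x∈) = extend (solve (U ∖ S″) S′
        (λ h → U⊑W (proj₁ (out h))) (λ h → proj₁ (out h))
        (s≤s⁻¹ (≤-trans (card-< (λ h → proj₁ (out h)) (S″⊑U x∈) (λ h → proj₂ (out h) x∈)) le)) S′-small ≤-refl)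
      where open Layer {S = S} s S⊑ S″⊑U small″

    solve-suc : ∀ u → Solve u σ → ∀ s → Solve (suc u) s
    solve-suc u solve s U S U⊑W S⊑U le le′ s≤σ with card S ≤? θ
    ... | yes small = small-case u s solve U S U⊑W S⊑U le small
    solve-suc u solve zero U S U⊑W S⊑U le le′ s≤σ | no gt = ⊥-elim (gt (≤-trans le′ z≤n))
    solve-suc u solve (suc s) U S U⊑W S⊑U le le′ s≤σ | no gt = merge S⊑U
        (solve-suc u solve s U₁ S₁ (λ h → U⊑W (proj₁ (out h))) (S₁⊑U₁ S⊑U) (≤-trans (card-mono (λ h → proj₁ (out h))) le)
          (s≤s⁻¹ (≤-trans S₁-small le′)) (≤-trans (n≤1+n s) s≤σ))
        (solve-suc u solve s U₂ S₂ (λ h → U⊑W (proj₁ (out h))) (S₂⊑U₂ S⊑U) (≤-trans (card-mono (λ h → proj₁ (out h))) le)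
          (s≤s⁻¹ (≤-trans S₂-small le′)) (≤-trans (n≤1+n s) s≤σ))
      where open Merge U⊑W (split S (λ h → U⊑W (S⊑U h)) (≰⇒> gt)) s s≤σ

    solve-all : ∀ u s → Solve u s
    solve-all zero s U S U⊑W S⊑U le _ _ = empty S⊑U (λ x h → <⇒≱ (card-pos h) le)
    solve-all (suc u) s = solve-suc u (solve-all u σ) s

    two-colouring : Σ (Fin n → Bool) λ colour → Clustered (Edge G) W colour bound
    two-colouring = Colouring.colour r , Colouring.clustered r
      where
      r : Colouring W ∅ σ
      r = solve-all (card W) σ W ∅ (λ h → h) (λ { (holds ()) }) ≤-refl
        (≤-trans (≤-reflexive (card-∅ {p = ∅} (λ { _ (holds ()) }))) z≤n) ≤-refl

-- Breadth-first layers

record Layering (G : Graph n) (r : Fin n) : Set where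
  field
    V : VSet n
    d : Fin n → ℕ
    parent : Fin n → Fin n
    closed : ∀ {u v} → u ∈ V → Edge G u v → v ∈ V
    lipschitz : ∀ {u v} → u ∈ V → Edge G u v → d v ≤ suc (d u)
    parent-edge : ∀ {v j} → v ∈ V → d v ≡ suc j → Edge G v (parent v)
    parent-depth : ∀ {v j} → v ∈ V → d v ≡ suc j → d (parent v) ≡ j
    bottom : ∀ {v} → v ∈ V → d v ≡ 0 → v ≡ r

  layer : ℕ → VSet n
  layer j = ⟦ (λ v → (v ∈? V) ×-dec (d v ℕ.≟ j)) ⟧

  ball : ℕ → VSet n
  ball j = ⟦ (λ v → (v ∈? V) ×-dec (d v ≤? j)) ⟧

  parent∈ : ∀ {v j} → v ∈ V → d v ≡ suc j → parent v ∈ V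
  parent∈ h e = closed h (parent-edge h e)

  descend : ∀ k {j v} → v ∈ V → d v ≡ k → k ≤ j → Conn (Edge G) (ball j) v r
  descend zero {j} h e le with refl ← bottom h e = stop (into (h , subst (_≤ j) (sym e) z≤n))
  descend (suc k) {j} h e le = step (into (h , subst (_≤ j) (sym e) le)) (parent-edge h e)
    (descend k (parent∈ h e) (parent-depth h e) (≤-trans (n≤1+n k) le))

  ball-connected : ∀ j → Connected (Edge G) (ball j)
  ball-connected j = hub-connected (edge-sym G) r (λ h → descend _ (proj₁ (out h)) refl (proj₂ (out h)))

-- W consists of the layers i+1, i+2, i+3; π sends a vertex to its ancestor on layer i+1.
module ThreeLayers {G : Graph n} {r : Fin n} (Λ : Layering G r) (Δ : ℕ) (deg : Degree≤ G Δ) (i : ℕ) where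
  open Layering Λ

  R W : VSet n
  R = ball i
  W = ⟦ (λ v → (v ∈? V) ×-dec ((d v ℕ.≟ suc i) ⊎-dec ((d v ℕ.≟ suc (suc i)) ⊎-dec (d v ℕ.≟ suc (suc (suc i)))))) ⟧

  project : Fin n → ℕ → Fin n
  project v k with k ℕ.≟ suc (suc i) | k ℕ.≟ suc (suc (suc i))
  ... | yes _ | _ = parent v
  ... | no _ | yes _ = parent (parent v)
  ... | no _ | no _ = v

  π : Fin n → Fin n
  π v = project v (d v)

  π-low : ∀ {v} → d v ≤ suc i → π v ≡ v
  π-low {v} le with d v ℕ.≟ suc (suc i) | d v ℕ.≟ suc (suc (suc i))
  ... | yes e | _ = ⊥-elim (<⇒≱ ≤-refl (subst (_≤ suc i) e le))
  ... | no _ | yes e = ⊥-elim (<⇒≱ (n≤1+n _) (subst (_≤ suc i) e le))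
  ... | no _ | no _ = refl

  π-mid : ∀ {v} → d v ≡ suc (suc i) → π v ≡ parent v
  π-mid {v} h with d v ℕ.≟ suc (suc i) | d v ℕ.≟ suc (suc (suc i))
  ... | yes _ | _ = refl
  ... | no ne | _ = ⊥-elim (ne h)

  π-top : ∀ {v} → d v ≡ suc (suc (suc i)) → π v ≡ parent (parent v)
  π-top {v} h with d v ℕ.≟ suc (suc i) | d v ℕ.≟ suc (suc (suc i))
  ... | yes e | _ = ⊥-elim (<⇒≢ ≤-refl (trans (sym e) h))
  ... | no _ | yes _ = refl
  ... | no _ | no ne = ⊥-elim (ne h)

  retraction : ∀ {w} → w ∈ W → (π w ∈ W × d (π w) ≡ suc i) × Conn (Edge G) (W ∩ fiber π (π w)) w (π w)
  retraction {w} h with w∈ , e ← out h with e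
  ... | inj₁ e₁ with p ← π-low (≤-reflexive e₁) = (subst (_∈ W) (sym p) h , trans (cong d p) e₁) ,
    subst (Conn _ _ w) (sym p) (stop (into (h , into refl)))
  ... | inj₂ (inj₁ e₂) with p ← π-mid e₂ =
    (subst (_∈ W) (sym p) q∈ , trans (cong d p) dq) ,
    subst (Conn _ _ w) (sym p) (conn-edge (into (h , into refl)) (parent-edge w∈ e₂)
      (into (q∈ , into (trans (π-low (≤-reflexive dq)) (sym p)))))
    where
    dq = parent-depth w∈ e₂
    q∈ : parent w ∈ W
    q∈ = into (parent∈ w∈ e₂ , inj₁ dq)
  ... | inj₂ (inj₂ e₃) with p ← π-top e₃ =
    (subst (_∈ W) (sym p) q∈ , trans (cong d p) dq) ,
    subst (Conn _ _ w) (sym p) (step (into (h , into refl)) (parent-edge w∈ e₃)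
      (conn-edge (into (m∈ , into (trans (π-mid dm) (sym p)))) (parent-edge (parent∈ w∈ e₃) dm)
        (into (q∈ , into (trans (π-low (≤-reflexive dq)) (sym p))))))
    where
    dm = parent-depth w∈ e₃
    m∈ : parent w ∈ W
    m∈ = into (parent∈ w∈ e₃ , inj₂ (inj₁ dm))
    dq = parent-depth (parent∈ w∈ e₃) dm
    q∈ : parent (parent w) ∈ W
    q∈ = into (parent∈ (parent∈ w∈ e₃) dm , inj₁ dq)

  small : ∀ y → card (W ∩ fiber π y) ≤ suc (Δ + Δ * Δ)
  small y = ≤-trans (card-mono sub) (≤-trans (card-∪ _ _) (+-mono-≤ (card-⁅⁆ y)
    (≤-trans (card-∪ _ _) (+-mono-≤ (deg y) (≤-trans (card-⋃ (adj G y) (adj G) Δ (λ h → let z , e , f = out h in z , holds e , holds f)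
      (λ {u} _ → deg u)) (*-monoˡ-≤ Δ (deg y)))))))
    where
    second : VSet n
    second = ⟦ (λ x → any? (λ z → edge? G y z ×-dec edge? G z x)) ⟧
    sub : W ∩ fiber π y ⊑ ⁅ y ⁆ ∪ (adj G y ∪ second)
    sub {x} h with h′ , p ← out h with x∈ , e ← out h′ with e
    ... | inj₁ e₁ = into (inj₁ (into (trans (sym (π-low (≤-reflexive e₁))) (out p))))
    ... | inj₂ (inj₁ e₂) = into (inj₂ (into (inj₁ (holds (edge-sym G
          (subst (Edge G x) (trans (sym (π-mid e₂)) (out p)) (parent-edge x∈ e₂)))))))
    ... | inj₂ (inj₂ e₃) = into (inj₂ (into (inj₂ (into (parent x ,
          edge-sym G (subst (Edge G (parent x)) (trans (sym (π-top e₃)) (out p))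
            (parent-edge (parent∈ x∈ e₃) (parent-depth x∈ e₃))) ,
          edge-sym G (parent-edge x∈ e₃))))))

  apart : ∀ {x} → x ∈ R → x ∉ W
  apart h h′ with proj₂ (out h) | proj₂ (out h′)
  ... | le | inj₁ e = <⇒≱ ≤-refl (subst (_≤ i) e le)
  ... | le | inj₂ (inj₁ e) = <⇒≱ (n≤1+n _) (subst (_≤ i) e le)
  ... | le | inj₂ (inj₂ e) = <⇒≱ (≤-trans (n≤1+n _) (n≤1+n _)) (subst (_≤ i) e le)

  foot-edge : ∀ {w} → w ∈ W → π w ≡ w → Edge G w (parent w) × parent w ∈ R
  foot-edge {w} h p = parent-edge w∈ e , into (parent∈ w∈ e , ≤-reflexive (parent-depth w∈ e))
    where
    w∈ : w ∈ V
    w∈ = proj₁ (out h)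
    e : d w ≡ suc i
    e = trans (cong d (sym p)) (proj₂ (proj₁ (retraction h)))

  module Cut (t : ℕ) (size : GridSize (suc (Δ + Δ * Δ) * Δ) t) (X : VSet n) (X⊑ : X ⊑ layer (suc (suc i))) (M : ℕ)
    (large : linkSize (suc (Δ + Δ * Δ) * Δ) t M * suc (Δ + Δ * Δ) ≤ card X) where
    -- `X` lies in the middle layer because the neighbours of that layer, and hence the clusters it
    -- jumps through, lie in the three layers of `W`.
    cut-layer : Model (Edge G) (R ∪ W) t ⊎ Unlinked (Edge G) W X (suc (linkOrder t size * suc (Δ + Δ * Δ))) M
    cut-layer = Window.window-model-or-unlinked G Δ deg R W (ball-connected i) apart π
      (λ h → π-low (≤-trans (proj₂ (out h)) (n≤1+n i)))
      (λ h → proj₁ (proj₁ (retraction h)) , π-low (≤-reflexive (proj₂ (proj₁ (retraction h)))))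
      (λ h → proj₂ (retraction h)) (Δ + Δ * Δ) small parent foot-edge t size X
      (λ h → into (proj₁ (out (X⊑ h)) , inj₂ (inj₁ (proj₂ (out (X⊑ h)))))) M large

-- J a is the cluster of the already coloured vertex a (empty if a is uncoloured).
module Jump (G : Graph n) (Δ : ℕ) (deg : Degree≤ G Δ) (J : Fin n → VSet n) (κ : ℕ)
  (J-small : ∀ a → card (J a) ≤ κ) (J-sym : ∀ {a b} → b ∈ J a → a ∈ J b) where

  Jumps : Rel n
  Jumps u v = ∃ λ a → ∃ λ b → Edge G u a × b ∈ J a × Edge G b v

  Joined : Rel n
  Joined u v = u ≢ v × (Edge G u v ⊎ Jumps u v)

  joined? : ∀ u v → Dec (Joined u v)
  joined? u v = ¬? (u Fin.≟ v) ×-dec (edge? G u v ⊎-dec any? (λ a → any? (λ b →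
    edge? G u a ×-dec ((b ∈? J a) ×-dec edge? G b v))))

  joined-sym : ∀ {u v} → Joined u v → Joined v u
  joined-sym (ne , inj₁ e) = (λ h → ne (sym h)) , inj₁ (edge-sym G e)
  joined-sym (ne , inj₂ (a , b , e , j , f)) = (λ h → ne (sym h)) , inj₂ (b , a , edge-sym G f , J-sym j , edge-sym G e)

  jump-graph : Graph n
  jump-graph = record
    { adj = λ a b → does (joined? a b)
    ; sym = λ a b → does-⇔ (mk⇔ joined-sym joined-sym) (joined? a b) (joined? b a)
    ; irrefl = λ a → dec-false (joined? a a) (λ h → proj₁ h refl) }

  from-joined : ∀ {a b} → Edge jump-graph a b → Joined a b
  from-joined {a} {b} e = does-true (joined? a b) e

  to-joined : ∀ {a b} → Joined a b → Edge jump-graph a b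
  to-joined {a} {b} h = dec-true (joined? a b) h

  around : Fin n → VSet n
  around a = ⟦ (λ v → any? (λ b → (b ∈? J a) ×-dec edge? G b v)) ⟧

  around-small : ∀ a → card (around a) ≤ κ * Δ
  around-small a = ≤-trans (card-⋃ (J a) (adj G) Δ (λ h → let b , j , e = out h in b , j , holds e) (λ {u} _ → deg u))
    (*-monoˡ-≤ Δ (J-small a))

  jump-degree : Degree≤ jump-graph (Δ + Δ * (κ * Δ))
  jump-degree u = ≤-trans (card-mono {q = adj G u ∪ far} sub) (≤-trans (card-∪ _ _) (+-mono-≤ (deg u)
    (≤-trans (card-⋃ (adj G u) around (κ * Δ) (λ h → let a , e , m = out h in a , holds e , m) (λ {a} _ → around-small a))
      (*-monoˡ-≤ (κ * Δ) (deg u)))))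
    where
    far : VSet n
    far = ⟦ (λ v → any? (λ a → edge? G u a ×-dec (v ∈? around a))) ⟧
    sub : adj jump-graph u ⊑ adj G u ∪ far
    sub (holds e) with from-joined e
    ... | _ , inj₁ f = into (inj₁ (holds f))
    ... | _ , inj₂ (a , b , f , j , g) = into (inj₂ (into (a , f , into (b , j , g))))

  -- A separation of G becomes one of the jump graph once its separator C absorbs all vertices that can jump through C.
  module Thicken (W W′ X : VSet n) (k M : ℕ) (W′⊑W : W′ ⊑ W) (u : Unlinked (Edge G) W X (suc k) M)
    (local : ∀ {v a b} → v ∈ W′ → Edge G v a → b ∈ J a → Conn (Edge G) (W ∩ J a) a b)
    (M-large : suc ((k + k * (κ * Δ)) + (k + k * (κ * Δ))) ≤ M) where
    open Unlinked u
    open Separation separation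

    C T : VSet n
    C = L ∩ R
    T = C ∪ ⟦ (λ v → any? (λ z → (z ∈? C) ×-dec (v ∈? around z))) ⟧

    τ : ℕ
    τ = k + k * (κ * Δ)

    C-small : card C ≤ k
    C-small = s≤s⁻¹ order

    T-small : card T ≤ τ
    T-small = ≤-trans (card-∪ _ _) (+-mono-≤ C-small (≤-trans (card-⋃ C around (κ * Δ) (λ h → out h) (λ {a} _ → around-small a))
      (*-monoˡ-≤ (κ * Δ) C-small)))

    -- If the part of the cluster `J a` inside `W` met `C` in a vertex `x`, then `v` could jump
    -- through `x` and would belong to `T`. So the path from `a` to `b`, which `local` keeps inside
    -- `W`, never leaves the side of `v`.
    no-jump : ∀ {v w} → v ∈ W′ → w ∈ W′ → v ∈ L → v ∉ R → v ∉ T → w ∈ R → w ∉ L → ¬ Jumps v w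
    no-jump {v} {w} v∈ w∈ vL vR v∉T wR wL (a , b , e , j , f) = crossing (proj₁ b-side) (proj₂ b-side) wR wL f
      where
      path : Conn (Edge G) (W ∩ J a) a b
      path = local v∈ e j
      free : ∀ {x} → x ∈ W ∩ J a → x ∉ C
      free h c = v∉T (into (inj₂ (into (_ , c , into (a , J-sym (proj₂ (out h)) , edge-sym G e)))))
      advance : ∀ {x y} → x ∈ L × x ∉ R → y ∈ W ∩ J a → Edge G x y → y ∈ L × y ∉ R
      advance {x} {y} (xL , xR) h g = go (y ∈? L) (y ∈? R)
        where
        go : Dec (y ∈ L) → Dec (y ∈ R) → y ∈ L × y ∉ R
        go (yes l) (yes r) = ⊥-elim (free h (into (l , r)))
        go (yes l) (no r) = l , r
        go (no l) (yes r) = ⊥-elim (crossing xL xR r l g)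
        go (no l) (no r) with cover (proj₁ (out h))
        ... | inj₁ l′ = ⊥-elim (l l′)
        ... | inj₂ r′ = ⊥-elim (r r′)
      b-side : b ∈ L × b ∉ R
      b-side = conn-invariant (λ x → x ∈ L × x ∉ R) (λ s _ h g → advance s h g) path
        (advance (vL , vR) (conn-start path) e)

    strip-L : ∀ {x} → x ∉ R ∪ T → x ∈ L ∪ T → x ∈ L × x ∉ R × x ∉ T
    strip-L x∉ h with out h
    ... | inj₁ l = l , (λ r → x∉ (into (inj₁ r))) , (λ s → x∉ (into (inj₂ s)))
    ... | inj₂ s = ⊥-elim (x∉ (into (inj₂ s)))
    strip-R : ∀ {x} → x ∉ L ∪ T → x ∈ R ∪ T → x ∈ R × x ∉ L
    strip-R x∉ h with out h
    ... | inj₁ r = r , (λ l → x∉ (into (inj₁ l)))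
    ... | inj₂ s = ⊥-elim (x∉ (into (inj₂ s)))

    -- The new boundary gains at most the `τ` vertices of `T` and loses those of `X ∖ P` outside
    -- `T`. Apart from vertices of `C`, all of `Y` is in `X ∖ P`; as `Y` has at least `2 τ + 1`
    -- vertices, more than `τ` remain there.
    shrink : (P Q Y : VSet n) → Y ⊑ X → M ≤ card Y → Y ⊑ Q → (∀ {x} → x ∈ P → x ∈ Q → x ∈ C) →
      card ((X ∩ (P ∪ T)) ∪ (((L ∪ T) ∩ (R ∪ T)) ∩ W′)) < card X
    shrink P Q Y Y⊑X Y-large Y⊑Q PQ⊑C = begin-strict
      card ((X ∩ (P ∪ T)) ∪ (((L ∪ T) ∩ (R ∪ T)) ∩ W′)) ≤⟨ card-mono sub ⟩
      card ((X ∩ P) ∪ T)                         ≤⟨ card-∪ _ _ ⟩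
      card (X ∩ P) + card T                      ≤⟨ +-monoʳ-≤ (card (X ∩ P)) T-small ⟩
      card (X ∩ P) + τ                           <⟨ +-monoʳ-< (card (X ∩ P)) beyond ⟩
      card (X ∩ P) + card (X ∖ P)                ≡⟨ card-split X P ⟨
      card X                                     ∎
      where
      open ≤-Reasoning
      narrow : X ∩ (P ∪ T) ⊑ (X ∩ P) ∪ T
      narrow h = into (Sum.map₁ (λ p → into (proj₁ (out h) , p)) (out (proj₂ (out h))))
      middle : (L ∪ T) ∩ (R ∪ T) ⊑ T
      middle {x} h = cases (out (proj₁ (out h))) (out (proj₂ (out h)))
        where
        cases : x ∈ L ⊎ x ∈ T → x ∈ R ⊎ x ∈ T → x ∈ T
        cases (inj₂ s) _ = s
        cases (inj₁ _) (inj₂ s) = s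
        cases (inj₁ l) (inj₁ r) = into (inj₁ (into (l , r)))
      sub : (X ∩ (P ∪ T)) ∪ (((L ∪ T) ∩ (R ∪ T)) ∩ W′) ⊑ (X ∩ P) ∪ T
      sub h = Sum.[ narrow , (λ a → into (inj₂ (middle (proj₁ (out a))))) ] (out h)
      Y-covered : Y ⊑ (X ∖ P) ∪ C
      Y-covered {x} h with x ∈? P
      ... | yes p = into (inj₂ (PQ⊑C p (Y⊑Q h)))
      ... | no p = into (inj₁ (into (Y⊑X h , p)))
      beyond : τ < card (X ∖ P)
      beyond = +-cancelʳ-≤ τ _ _ (≤-trans M-large (≤-trans Y-large (≤-trans (card-mono Y-covered)
        (≤-trans (card-∪ _ _) (+-monoʳ-≤ (card (X ∖ P)) (≤-trans C-small (m≤m+n k _)))))))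

    shrunk : Shrunk (Edge jump-graph) W′ X
    shrunk = record
      { L = L ∪ T; R = R ∪ T
      ; cover = cover′
      ; crossing = crossing′
      ; shrinkˡ = shrink L R B B⊑X B-large B⊑ (λ l r → into (l , r))
      ; shrinkʳ = shrink R L A A⊑X A-large A⊑ (λ r l → into (l , r)) }
      where
      cover′ : ∀ {x} → x ∈ W′ → x ∈ L ∪ T ⊎ x ∈ R ∪ T
      cover′ h with cover (W′⊑W h)
      ... | inj₁ l = inj₁ (into (inj₁ l))
      ... | inj₂ r = inj₂ (into (inj₁ r))
      crossing′ : ∀ {v w} → v ∈ W′ → w ∈ W′ → v ∈ L ∪ T → v ∉ R ∪ T → w ∈ R ∪ T → w ∉ L ∪ T → ¬ Edge jump-graph v w
      crossing′ v∈ w∈ vL vR wR wL e with strip-L vR vL | strip-R wL wR | from-joined e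
      ... | a , b , _ | c , d | _ , inj₁ f = crossing a b c d f
      ... | a , b , s | c , d | _ , inj₂ jump = no-jump v∈ w∈ a b s c d jump

-- Two-colouring a single layer of the jump graph

module Bounds (Δ t : ℕ) (size : GridSize (suc (Δ + Δ * Δ) * Δ) t) (κ : ℕ) where
  -- `margin` is one more than twice the size of the thickened separator. The summand `suc Δ` of
  -- `threshold` disposes of layers 0 and 1, which are not the middle layer of any window used here.
  separator margin threshold jumpDegree layerBound : ℕ
  separator = linkOrder t size * suc (Δ + Δ * Δ)
  margin = suc ((separator + separator * (κ * Δ)) + (separator + separator * (κ * Δ)))
  threshold = linkSize (suc (Δ + Δ * Δ) * Δ) t margin * suc (Δ + Δ * Δ) + suc Δ
  jumpDegree = Δ + Δ * (κ * Δ)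
  layerBound = threshold * 2 ^ (threshold * jumpDegree)

module ColourLayer {G : Graph n} {r : Fin n} (Λ : Layering G r) (Δ : ℕ) (deg : Degree≤ G Δ)
  (t : ℕ) (size : GridSize (suc (Δ + Δ * Δ) * Δ) t) (no-model : ∀ D → ¬ Model (Edge G) D t)
  (J : Fin n → VSet n) (κ : ℕ) (J-small : ∀ a → card (J a) ≤ κ) (J-sym : ∀ {a b} → b ∈ J a → a ∈ J b) where
  open Layering Λ
  open Jump G Δ deg J κ J-small J-sym public
  open Bounds Δ t size κ

  Local : ℕ → Set
  Local j = ∀ {v a b} → v ∈ layer j → Edge G v a → b ∈ J a → Conn (Edge G) (layer (d a) ∩ J a) a b

  low : ∀ j → j ≤ 1 → card (layer j) ≤ suc Δ
  low zero _ = ≤-trans (card≤1 (λ a b → trans (bottom (proj₁ (out a)) (proj₂ (out a)))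
    (sym (bottom (proj₁ (out b)) (proj₂ (out b)))))) (s≤s z≤n)
  low (suc zero) _ = ≤-trans (card-mono sub) (≤-trans (deg r) (n≤1+n Δ))
    where
    sub : layer 1 ⊑ adj G r
    sub {x} h with v∈ , e ← out h = holds (edge-sym G (subst (Edge G x)
      (bottom (parent∈ v∈ e) (parent-depth v∈ e)) (parent-edge v∈ e)))
  low (suc (suc j)) (s≤s ())

  near : ∀ {v a j} → v ∈ layer (suc (suc j)) → Edge G v a → d a ≡ suc j ⊎ d a ≡ suc (suc j) ⊎ d a ≡ suc (suc (suc j))
  near {v} {a} {j} h e with v∈ , p ← out h = pick (d a ℕ.≟ suc j) (d a ℕ.≟ suc (suc j))
    where
    upper : d a ≤ suc (suc (suc j))
    upper = subst (λ k → d a ≤ suc k) p (lipschitz v∈ e)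
    lower : suc j ≤ d a
    lower = s≤s⁻¹ (subst (_≤ suc (d a)) p (lipschitz (closed v∈ e) (edge-sym G e)))
    pick : Dec (d a ≡ suc j) → Dec (d a ≡ suc (suc j)) → d a ≡ suc j ⊎ d a ≡ suc (suc j) ⊎ d a ≡ suc (suc (suc j))
    pick (yes q) _ = inj₁ q
    pick (no _) (yes q) = inj₂ (inj₁ q)
    pick (no q) (no q′) = inj₂ (inj₂ (≤-antisym upper (≤∧≢⇒< (≤∧≢⇒< lower (λ x → q (sym x))) (λ x → q′ (sym x)))))

  split : ∀ j → Local j → ∀ S → S ⊑ layer j → threshold < card S → Shrunk (Edge jump-graph) (layer j) S
  split zero _ S S⊑ lt = ⊥-elim (<⇒≱ lt (≤-trans (card-mono S⊑) (≤-trans (low 0 z≤n) (m≤n+m (suc Δ) _))))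
  split (suc zero) _ S S⊑ lt = ⊥-elim (<⇒≱ lt (≤-trans (card-mono S⊑) (≤-trans (low 1 ≤-refl) (m≤n+m (suc Δ) _))))
  split (suc (suc i)) local S S⊑ lt = finish (Cut.cut-layer t size S S⊑ margin (≤-trans (m≤m+n _ (suc Δ)) (<⇒≤ lt)))
    where
    open ThreeLayers Λ Δ deg i
    local′ : ∀ {v a b} → v ∈ layer (suc (suc i)) → Edge G v a → b ∈ J a → Conn (Edge G) (W ∩ J a) a b
    local′ {v} {a} v∈ e j = conn-mono (λ e → e) (λ h → into (into (proj₁ (out (proj₁ (out h))) ,
        subst (λ k → k ≡ suc i ⊎ (k ≡ suc (suc i) ⊎ k ≡ suc (suc (suc i)))) (sym (proj₂ (out (proj₁ (out h))))) (near v∈ e)) ,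
        proj₂ (out h))) (local v∈ e j)
    finish : Model (Edge G) (R ∪ W) t ⊎ Unlinked (Edge G) W S (suc separator) margin → Shrunk (Edge jump-graph) (layer (suc (suc i))) S
    finish (inj₁ m) = ⊥-elim (no-model _ m)
    finish (inj₂ u) = Thicken.shrunk W (layer (suc (suc i))) S separator margin
      (λ h → into (proj₁ (out h) , inj₂ (inj₁ (proj₂ (out h))))) u local′ ≤-refl

  abstract
    colour-layer : ∀ j → Local j → Σ (Fin n → Bool) λ colour → Clustered (Edge jump-graph) (layer j) colour layerBound
    colour-layer j local = TwoColour.two-colouring jump-graph jumpDegree jump-degree (layer j) threshold
      (≤-trans (s≤s z≤n) (m≤n+m (suc Δ) _)) (split j local)

-- Three colours

even : ℕ → Bool
even zero = true
even (suc k) = not (even k)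

not≢ : ∀ {b c} → not b ≡ c → b ≡ c → ⊥
not≢ {true} refl ()
not≢ {false} refl ()

-- Layer j uses the two colours other than j mod 3, so no colour occurs on three consecutive layers.
shade : ℕ → Bool → Fin 3
shade 0 false = suc zero
shade 0 true = suc (suc zero)
shade 1 false = suc (suc zero)
shade 1 true = zero
shade 2 false = zero
shade 2 true = suc zero
shade (suc (suc (suc j))) b = shade j b

shade-injective : ∀ j {b c} → shade j b ≡ shade j c → b ≡ c
shade-injective 0 {false} {false} _ = refl
shade-injective 0 {true} {true} _ = refl
shade-injective 1 {false} {false} _ = refl
shade-injective 1 {true} {true} _ = refl
shade-injective 2 {false} {false} _ = refl
shade-injective 2 {true} {true} _ = refl
shade-injective (suc (suc (suc j))) e = shade-injective j e

shade-spread : ∀ j a b c {i} → shade j a ≡ i → shade (suc j) b ≡ i → shade (suc (suc j)) c ≡ i → ⊥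
shade-spread 0 false false c refl () h
shade-spread 0 false true c refl () h
shade-spread 0 true false false refl refl ()
shade-spread 0 true false true refl refl ()
shade-spread 0 true true c refl () h
shade-spread 1 false false c refl () h
shade-spread 1 false true c refl () h
shade-spread 1 true true c refl () h
shade-spread 1 true false false refl refl ()
shade-spread 1 true false true refl refl ()
shade-spread 2 false false c refl () h
shade-spread 2 false true c refl () h
shade-spread 2 true true c refl () h
shade-spread 2 true false false refl refl ()
shade-spread 2 true false true refl refl ()
shade-spread (suc (suc (suc j))) a b c p q r = shade-spread j a b c p q r

-- Monochromatic clusters across an even and an odd layer

module EvenClusters {G : Graph n} {r : Fin n} (Λ : Layering G r) (c¹ : Fin n → Bool) (κ : ℕ)
  (clustered : ∀ j → Clustered (Edge G) (Layering.layer Λ j) c¹ κ) where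
  open Layering Λ

  depth-near : ∀ {u v} → u ∈ V → Edge G u v → d u ≡ d v ⊎ (d v ≡ suc (d u) ⊎ d u ≡ suc (d v))
  depth-near {u} {v} h e = pick (d u ℕ.≟ d v) (d v ≤? d u)
    where
    pick : Dec (d u ≡ d v) → Dec (d v ≤ d u) → d u ≡ d v ⊎ (d v ≡ suc (d u) ⊎ d u ≡ suc (d v))
    pick (yes p) _ = inj₁ p
    pick (no p) (yes le) = inj₂ (inj₂ (≤-antisym (lipschitz (closed h e) (edge-sym G e)) (≤∧≢⇒< le (λ q → p (sym q)))))
    pick (no p) (no gt) = inj₂ (inj₁ (≤-antisym (lipschitz h e) (≰⇒> gt)))

  same-parity : ∀ {u v} → u ∈ V → Edge G u v → even (d u) ≡ even (d v) → d u ≡ d v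
  same-parity h e p with depth-near h e
  ... | inj₁ q = q
  ... | inj₂ (inj₁ q) = ⊥-elim (not≢ (sym (cong even q)) p)
  ... | inj₂ (inj₂ q) = ⊥-elim (not≢ (sym (cong even q)) (sym p))

  -- No layer is prescribed: adjacent vertices of even depth have equal depth, so the component of
  -- `a` stays on its own layer. It is empty if `a` has odd depth.
  like : Fin n → VSet n
  like a = ⟦ (λ x → (x ∈? V) ×-dec ((even (d x) Bool.≟ true) ×-dec (c¹ x Bool.≟ c¹ a))) ⟧

  J : Fin n → VSet n
  J a = comp G (like a) a

  J-even : ∀ {a b} → b ∈ J a → b ∈ V × even (d b) ≡ true × c¹ b ≡ c¹ a
  J-even h = out (conn-end (out h))

  J-self : ∀ {a} → a ∈ V → even (d a) ≡ true → a ∈ J a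
  J-self h e = into (stop (into (h , e , refl)))

  like-eq : ∀ {a b} → c¹ b ≡ c¹ a → like a ⊑ like b
  like-eq e h = into (proj₁ (out h) , proj₁ (proj₂ (out h)) , trans (proj₂ (proj₂ (out h))) (sym e))

  J-sym : ∀ {a b} → b ∈ J a → a ∈ J b
  J-sym {a} {b} h = into (conn-sym (edge-sym G) (conn-mono (λ e → e) (like-eq {a} {b} (proj₂ (proj₂ (J-even h)))) (out h)))

  J-trans : ∀ {a b c} → b ∈ J a → c ∈ J b → c ∈ J a
  J-trans {a} {b} h h′ = into (conn-trans (out h) (conn-mono (λ e → e) (like-eq {b} {a} (sym (proj₂ (proj₂ (J-even h))))) (out h′)))

  J-step : ∀ {a u w} → u ∈ J a → Edge G u w → even (d w) ≡ true → c¹ u ≡ c¹ w → w ∈ J a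
  J-step h e p q = into (conn-trans (out h) (conn-edge (conn-end (out h)) e
    (into (closed (proj₁ (J-even h)) e , p , trans (sym q) (proj₂ (proj₂ (J-even h)))))))

  in-layer : ∀ {a b} → a ∈ V → Conn (Edge G) (like a) a b → Conn (Edge G) (like a ∩ layer (d a)) a b
  in-layer {a} h = conn-within (λ u∈ u∈l w∈l e → into (proj₁ (out w∈l) ,
      trans (sym (same-parity (proj₁ (out u∈l)) e (trans (proj₁ (proj₂ (out u∈l))) (sym (proj₁ (proj₂ (out w∈l)))))))
        (proj₂ (out u∈)))) (into (h , refl))

  J-layer : ∀ {a b} → b ∈ J a → Conn (Edge G) (like a ∩ layer (d a)) a b
  J-layer h = in-layer (proj₁ (out (conn-start (out h)))) (out h)

  J-depth : ∀ {a b} → b ∈ J a → d b ≡ d a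
  J-depth h = proj₂ (out (proj₂ (out (conn-end (J-layer h)))))

  J-small : ∀ a → card (J a) ≤ κ
  J-small a = clustered (d a) (c¹ a) a (J a) (λ h → conn-mono (λ e → e)
    (λ m → into (proj₂ (out m) , proj₂ (proj₂ (out (proj₁ (out m)))))) (J-layer h))

  J-local : ∀ {a b} → b ∈ J a → Conn (Edge G) (layer (d a) ∩ J a) a b
  J-local {a} h = conn-mono (λ e → e) (λ m → into (proj₂ (out (proj₁ (out m))) , proj₂ (out m)))
    (conn-within (λ u∈ _ w∈ e → into (conn-trans (out u∈) (conn-edge (conn-end (out u∈)) e (proj₁ (out w∈)))))
      (into (stop (conn-start (out h)))) (J-layer h))

  module Odd (Δ : ℕ) (deg : Degree≤ G Δ) (c² : Fin n → Bool) (N : ℕ)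
    (clustered² : ∀ j → Clustered (Edge (Jump.jump-graph G Δ deg J κ J-small J-sym)) (layer j) c² N) where
    open Jump G Δ deg J κ J-small J-sym using (jump-graph; to-joined; Joined)

    bit : Fin n → Bool
    bit v = choose-by (even (d v) Bool.≟ true) (c¹ v) (c² v)

    colour : Fin n → Fin 3
    colour v = shade (d v) (bit v)

    even-bit : ∀ {u w} → even (d u) ≡ true → d u ≡ d w → colour u ≡ colour w → c¹ u ≡ c¹ w
    even-bit {u} {w} p e q = trans (sym (choose-yes (even (d u) Bool.≟ true) p))
      (trans (shade-injective (d w) (trans (cong (λ k → shade k (bit u)) (sym e)) q))
        (choose-yes (even (d w) Bool.≟ true) (trans (cong even (sym e)) p)))

    odd-bit : ∀ {u w} → even (d u) ≡ false → d u ≡ d w → colour u ≡ colour w → c² u ≡ c² w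
    odd-bit {u} {w} p e q = trans (sym (choose-no (even (d u) Bool.≟ true) (λ t → true≢false t p)))
      (trans (shade-injective (d w) (trans (cong (λ k → shade k (bit u)) (sym e)) q))
        (choose-no (even (d w) Bool.≟ true) (λ t → true≢false t (trans (cong even (sym e)) p))))

    odd-colour : ∀ {u w} → even (d u) ≡ false → d u ≡ d w → c² u ≡ c² w → colour u ≡ colour w
    odd-colour {u} {w} p e q = cong₂ shade e (trans (choose-no (even (d u) Bool.≟ true) (λ t → true≢false t p))
      (trans q (sym (choose-no (even (d w) Bool.≟ true) (λ t → true≢false t (trans (cong even (sym e)) p))))))

    parity-clash : ∀ {u w} → even (d u) ≡ true → even (d w) ≡ false → d u ≢ d w
    parity-clash p q e = true≢false p (trans (cong even e) q)

    -- Otherwise `y` and `w` lie on opposite sides of the even layer of `u`, and their colour would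
    -- occur on three consecutive layers, against `shade-spread`.
    same-depth : ∀ {y a u w i} → y ∈ V → a ∈ V → u ∈ V → even (d y) ≡ false → even (d u) ≡ true → even (d w) ≡ false →
      d u ≡ d a → Edge G y a → Edge G u w → colour y ≡ i → colour u ≡ i → colour w ≡ i → d y ≡ d w
    same-depth {y} {a} {u} {w} {i} y∈ a∈ u∈ py pu pw ua ya uw cy cu cw = go (depth-near y∈ ya) (depth-near u∈ uw)
      where
      go : d y ≡ d a ⊎ (d a ≡ suc (d y) ⊎ d y ≡ suc (d a)) → d u ≡ d w ⊎ (d w ≡ suc (d u) ⊎ d u ≡ suc (d w)) → d y ≡ d w
      go (inj₁ q) _ = ⊥-elim (parity-clash {u} {y} pu py (trans ua (sym q)))
      go _ (inj₁ q) = ⊥-elim (parity-clash {u} {w} pu pw q)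
      go (inj₂ (inj₁ q)) (inj₂ (inj₂ q′)) = ℕ-suc-injective (trans (sym q) (trans (sym ua) q′))
      go (inj₂ (inj₂ q)) (inj₂ (inj₁ q′)) = trans q (trans (cong suc (sym ua)) (sym q′))
      go (inj₂ (inj₁ q)) (inj₂ (inj₁ q′)) = ⊥-elim (shade-spread (d y) (bit y) (bit u) (bit w) cy
        (subst (λ k → shade k (bit u) ≡ i) (trans ua q) cu) (subst (λ k → shade k (bit w) ≡ i) (trans q′ (cong suc (trans ua q))) cw))
      go (inj₂ (inj₂ q)) (inj₂ (inj₂ q′)) = ⊥-elim (shade-spread (d w) (bit w) (bit u) (bit y) cw
        (subst (λ k → shade k (bit u) ≡ i) q′ cu) (subst (λ k → shade k (bit y) ≡ i) (trans q (cong suc (trans (sym ua) q′))) cy))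

    -- Provides a set for the odd vertices of the cluster of `v`: empty or one monochromatic
    -- component of the jump graph on a single layer, closed under the ways in which the cluster can
    -- return to odd depth.
    record OddPart (i : Fin 3) (v : Fin n) : Set where
      field
        O : VSet n
        O-small : card O ≤ N
        O-odd : ∀ {y} → y ∈ O → y ∈ V × even (d y) ≡ false × colour y ≡ i
        O-closed : ∀ {y w} → y ∈ O → w ∈ V → colour w ≡ i → d y ≡ d w → Joined y w → w ∈ O
        O-start : even (d v) ≡ false → v ∈ O
        O-entry : ∀ {u w} → u ∈ J v → colour u ≡ i → Edge G u w → even (d w) ≡ false → colour w ≡ i → w ∈ O

    odd-component : ∀ {i x v} → x ∈ V → even (d x) ≡ false → colour x ≡ i →
      (∀ {u w} → u ∈ J v → colour u ≡ i → Edge G u w → even (d w) ≡ false → colour w ≡ i →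
        w ≡ x ⊎ (d x ≡ d w × Joined x w)) → (even (d v) ≡ false → x ≡ v) → OddPart i v
    odd-component {i} {x} {v} x∈ px cx entry begin-odd = record
      { O = O; O-small = clustered² (d x) (c² x) x O out
      ; O-odd = O-odd
      ; O-closed = O-closed
      ; O-start = λ p → subst (_∈ O) (begin-odd p) x∈O
      ; O-entry = O-entry }
      where
      P O : VSet n
      P = mono (layer (d x)) c² (c² x)
      O = comp jump-graph P x
      x∈O : x ∈ O
      x∈O = into (stop (into (into (x∈ , refl) , refl)))
      O-in : ∀ {y} → y ∈ O → (y ∈ V × d y ≡ d x) × c² y ≡ c² x
      O-in h = out (proj₁ (out (conn-end (out h)))) , proj₂ (out (conn-end (out h)))
      O-odd : ∀ {y} → y ∈ O → y ∈ V × even (d y) ≡ false × colour y ≡ i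
      O-odd h with (y∈ , e) , q ← O-in h = y∈ , trans (cong even e) px , trans (odd-colour (trans (cong even e) px) e q) cx
      O-closed : ∀ {y w} → y ∈ O → w ∈ V → colour w ≡ i → d y ≡ d w → Joined y w → w ∈ O
      O-closed {y} {w} h w∈ cw e j with (y∈ , f) , q ← O-in h =
        into (conn-trans (out h) (conn-edge (conn-end (out h)) (to-joined j)
          (into (into (w∈ , trans (sym e) f) , sym (odd-bit px (trans (sym f) e) (trans cx (sym cw)))))))
      O-entry : ∀ {u w} → u ∈ J v → colour u ≡ i → Edge G u w → even (d w) ≡ false → colour w ≡ i → w ∈ O
      O-entry h cu e pw cw with entry h cu e pw cw
      ... | inj₁ refl = x∈O
      ... | inj₂ (q , j) = O-closed x∈O (closed (proj₁ (J-even h)) e) cw q j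

    Entry : Fin 3 → Fin n → Fin n → Fin n → Set
    Entry i v x u = (u ∈ J v × (Edge G u x × colour u ≡ i)) × (even (d x) ≡ false × colour x ≡ i)

    entry? : ∀ i v x u → Dec (Entry i v x u)
    entry? i v x u = ((u ∈? J v) ×-dec (edge? G u x ×-dec (colour u Fin.≟ i))) ×-dec
      ((even (d x) Bool.≟ false) ×-dec (colour x Fin.≟ i))

    -- A `v` of odd depth is itself the seed of `O`. For even depth, any odd neighbour of `J v` of
    -- the right colour serves: every other one is a jump through `J v` away, on the same layer by
    -- `same-depth`.
    odd-part-cases : ∀ i v → v ∈ V → colour v ≡ i → Dec (even (d v) ≡ true) →
      Dec (∃ λ x → ∃ λ u → Entry i v x u) → OddPart i v
    odd-part-cases i v v∈ cv (no odd) _ = odd-component v∈ (Bool.¬-not odd) cv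
      (λ h → ⊥-elim (odd (proj₁ (proj₂ (out (conn-start (out h))))))) (λ _ → refl)
    odd-part-cases i v v∈ cv (yes p) (no none) = record
      { O = ∅; O-small = ≤-trans (≤-reflexive (card-∅ {p = ∅} (λ { _ (holds ()) }))) z≤n
      ; O-odd = λ { (holds ()) }; O-closed = λ { (holds ()) }; O-start = λ q → ⊥-elim (true≢false p q)
      ; O-entry = λ {u} {w} h cu e pw cw → ⊥-elim (none (w , u , (h , e , cu) , pw , cw)) }
    odd-part-cases i v v∈ cv (yes p) (yes (x , u₀ , (h₀ , e₀ , cu₀) , px , cx)) =
      odd-component (closed (proj₁ (J-even h₀)) e₀) px cx entry (λ q → ⊥-elim (true≢false p q))
      where
      entry : ∀ {u w} → u ∈ J v → colour u ≡ i → Edge G u w → even (d w) ≡ false → colour w ≡ i →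
        w ≡ x ⊎ (d x ≡ d w × Joined x w)
      entry {u} {w} h cu e pw cw with w Fin.≟ x
      ... | yes q = inj₁ q
      ... | no ne = inj₂ (same-depth (closed (proj₁ (J-even h₀)) e₀) (proj₁ (J-even h₀)) (proj₁ (J-even h)) px
          (proj₁ (proj₂ (J-even h))) pw (trans (J-depth h) (sym (J-depth h₀))) (edge-sym G e₀) e cx cu cw ,
          (λ q → ne (sym q)) , inj₂ (u₀ , u , edge-sym G e₀ , J-trans (J-sym h₀) h , e))

    odd-part : ∀ i v → v ∈ V → colour v ≡ i → OddPart i v
    odd-part i v v∈ cv = odd-part-cases i v v∈ cv (even (d v) Bool.≟ true) (any? (λ x → any? (entry? i v x)))

    clusterBound : ℕ
    clusterBound = κ + (N + N * (Δ * κ))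

    class : Fin 3 → VSet n
    class i = ⟦ (λ x → colour x Fin.≟ i) ⟧

    module Cluster (i : Fin 3) (v : Fin n) (v∈ : v ∈ V) (cv : colour v ≡ i) (part : OddPart i v) where
      open OddPart part

      fringe : VSet n
      fringe = ⟦ (λ x → any? (λ y → (y ∈? O) ×-dec any? (λ a → edge? G y a ×-dec (x ∈? J a)))) ⟧

      -- `J v` is listed apart because `O`, and with it `fringe`, is empty if an even cluster has no
      -- odd neighbour of its colour.
      cluster : VSet n
      cluster = J v ∪ (O ∪ fringe)

      start : v ∈ cluster
      start = go (even (d v) Bool.≟ true)
        where
        go : Dec (even (d v) ≡ true) → v ∈ cluster
        go (yes p) = into (inj₁ (J-self v∈ p))
        go (no odd) = into (inj₂ (into (inj₁ (O-start (Bool.¬-not odd)))))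

      advance : ∀ {u w} → u ∈ V × u ∈ cluster → colour u ≡ i → colour w ≡ i → Edge G u w → w ∈ V × w ∈ cluster
      advance {u} {w} (u∈ , h) cu cw e = w∈ , go (even (d w) Bool.≟ true) (out h)
        where
        w∈ : w ∈ V
        w∈ = closed u∈ e
        stay : ∀ {a} → u ∈ J a → even (d w) ≡ true → w ∈ J a
        stay k p = J-step k e p (even-bit (proj₁ (proj₂ (J-even k)))
          (same-parity u∈ e (trans (proj₁ (proj₂ (J-even k))) (sym p))) (trans cu (sym cw)))
        odd-next : even (d w) ≡ false → u ∈ O ⊎ u ∈ fringe → w ∈ O
        odd-next p (inj₁ o) = O-closed o w∈ cw (same-parity u∈ e (trans (proj₁ (proj₂ (O-odd o))) (sym p)))
          ((λ { refl → true≢false e (irrefl G u) }) , inj₁ e)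
        odd-next p (inj₂ f) with y , o , a , ya , k ← out f = pick (w Fin.≟ y)
          where
          y∈ : y ∈ V
          y∈ = proj₁ (O-odd o)
          pick : Dec (w ≡ y) → w ∈ O
          pick (yes q) = subst (_∈ O) (sym q) o
          pick (no ne) = O-closed o w∈ cw (same-depth y∈ (closed y∈ ya) u∈ (proj₁ (proj₂ (O-odd o)))
            (proj₁ (proj₂ (J-even k))) p (J-depth k) ya e (proj₂ (proj₂ (O-odd o))) cu cw)
            ((λ q → ne (sym q)) , inj₂ (a , u , ya , k , e))
        go : Dec (even (d w) ≡ true) → u ∈ J v ⊎ u ∈ O ∪ fringe → w ∈ cluster
        go (yes p) (inj₁ k) = into (inj₁ (stay k p))
        go (yes p) (inj₂ k) with out k
        ... | inj₁ o = into (inj₂ (into (inj₂ (into (u , o , w , e , J-self w∈ p)))))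
        ... | inj₂ f with y , o , a , ya , k′ ← out f = into (inj₂ (into (inj₂ (into (y , o , a , ya , stay k′ p)))))
        go (no p) (inj₁ k) = into (inj₂ (into (inj₁ (O-entry k cu e (Bool.¬-not p) cw))))
        go (no p) (inj₂ k) = into (inj₂ (into (inj₁ (odd-next (Bool.¬-not p) (out k)))))

      cluster-small : card cluster ≤ clusterBound
      cluster-small = ≤-trans (card-∪ _ _) (+-mono-≤ (J-small v) (≤-trans (card-∪ _ _) (+-mono-≤ O-small
        (≤-trans (card-⋃ O near (Δ * κ) (λ h → let y , o , m = out h in y , o , into m) (λ {y} _ → near-small y))
          (*-monoˡ-≤ (Δ * κ) O-small)))))
        where
        near : Fin n → VSet n
        near y = ⟦ (λ x → any? (λ a → edge? G y a ×-dec (x ∈? J a))) ⟧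
        near-small : ∀ y → card (near y) ≤ Δ * κ
        near-small y = ≤-trans (card-⋃ (adj G y) J κ (λ h → let a , e , m = out h in a , holds e , m) (λ {a} _ → J-small a))
          (*-monoˡ-≤ κ (deg y))

    abstract
      three-coloured : ∀ i v D → v ∈ V → (∀ {u} → u ∈ D → Conn (Edge G) (class i) v u) → card D ≤ clusterBound
      three-coloured i v D v∈ reach = go (colour v Fin.≟ i)
        where
        go : Dec (colour v ≡ i) → card D ≤ clusterBound
        go (no ne) = ≤-trans (≤-reflexive (card-∅ (λ x h → ne (out (conn-start (reach h)))))) z≤n
        go (yes cv) = ≤-trans (card-mono (λ h → proj₂ (conn-invariant (λ u → u ∈ V × u ∈ C.cluster)
            (λ g a b e → C.advance g (out a) (out b) e) (reach h) (v∈ , C.start)))) C.cluster-small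
          where module C = Cluster i v v∈ cv (odd-part i v v∈ cv)

-- From models to minors

class-of : {m h : ℕ} → (Fin m → Fin h) → Fin h → VSet m
class-of β i = ⟦ (λ x → β x Fin.≟ i) ⟧

≡-from-⇔ : {b c : Bool} → (b ≡ true → c ≡ true) → (c ≡ true → b ≡ true) → b ≡ c
≡-from-⇔ {true} {c} f g = sym (f refl)
≡-from-⇔ {false} {false} f g = refl
≡-from-⇔ {false} {true} f g = g refl

module Contract {m h : ℕ} (S : Graph (suc m)) (H : Graph h) (β : Fin (suc m) → Fin h) {u v : Fin (suc m)}
  (uv : Edge S u v) (β≡ : β u ≡ β v) where

  v≢u : v ≢ u
  v≢u refl = true≢false uv (irrefl S u)

  ι : Fin m → Fin (suc m)
  ι = punchIn v

  Touch : Rel m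
  Touch a b = Edge S (ι a) (ι b) ⊎ (ι a ≡ u × Edge S v (ι b)) ⊎ (ι b ≡ u × Edge S v (ι a))

  touch? : ∀ a b → Dec (a ≢ b × Touch a b)
  touch? a b = ¬? (a Fin.≟ b) ×-dec (edge? S (ι a) (ι b) ⊎-dec
    (((ι a Fin.≟ u) ×-dec edge? S v (ι b)) ⊎-dec ((ι b Fin.≟ u) ×-dec edge? S v (ι a))))

  touch-sym : ∀ {a b} → a ≢ b × Touch a b → b ≢ a × Touch b a
  touch-sym (ne , inj₁ e) = (λ q → ne (sym q)) , inj₁ (edge-sym S e)
  touch-sym (ne , inj₂ (inj₁ p)) = (λ q → ne (sym q)) , inj₂ (inj₂ p)
  touch-sym (ne , inj₂ (inj₂ p)) = (λ q → ne (sym q)) , inj₂ (inj₁ p)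

  contracted : Graph m
  contracted = record
    { adj = λ a b → does (touch? a b)
    ; sym = λ a b → does-⇔ (mk⇔ touch-sym touch-sym) (touch? a b) (touch? b a)
    ; irrefl = λ a → dec-false (touch? a a) (λ p → proj₁ p refl) }

  is-contraction : ContractEdge S contracted
  is-contraction = u , v , uv , λ a b → mk⇔ (does-true (touch? a b)) (dec-true (touch? a b))

  β′ : Fin m → Fin h
  β′ a = β (ι a)

  ρ : Fin (suc m) → Fin m
  ρ x with v Fin.≟ x
  ... | yes _ = punchOut v≢u
  ... | no ne = punchOut ne

  ι-ρ : ∀ x → (x ≢ v × ι (ρ x) ≡ x) ⊎ (x ≡ v × ι (ρ x) ≡ u)
  ι-ρ x with v Fin.≟ x
  ... | yes e = inj₂ (sym e , punchIn-punchOut v≢u)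
  ... | no ne = inj₁ ((λ q → ne (sym q)) , punchIn-punchOut ne)

  ρ-ι : ∀ a → ρ (ι a) ≡ a
  ρ-ι a with ι-ρ (ι a)
  ... | inj₁ (_ , e) = punchIn-injective v _ _ e
  ... | inj₂ (e , _) = ⊥-elim (punchInᵢ≢i v a e)

  β-ρ : ∀ x → β′ (ρ x) ≡ β x
  β-ρ x with ι-ρ x
  ... | inj₁ (_ , e) = cong β e
  ... | inj₂ (e , f) = trans (cong β f) (trans β≡ (sym (cong β e)))

  ρ-edge : ∀ {x y} → Edge S x y → ρ x ≢ ρ y → Edge contracted (ρ x) (ρ y)
  ρ-edge {x} {y} e ne = dec-true (touch? (ρ x) (ρ y)) (ne , touch)
    where
    touch : Touch (ρ x) (ρ y)
    touch with ι-ρ x | ι-ρ y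
    ... | inj₁ (_ , p) | inj₁ (_ , q) = inj₁ (subst₂ (Edge S) (sym p) (sym q) e)
    ... | inj₂ (p , p′) | inj₁ (_ , q) = inj₂ (inj₁ (p′ , subst₂ (Edge S) p (sym q) e))
    ... | inj₁ (_ , p) | inj₂ (q , q′) = inj₂ (inj₂ (q′ , edge-sym S (subst₂ (Edge S) (sym p) q e)))
    ... | inj₂ (p , _) | inj₂ (q , _) = ⊥-elim (ne (cong ρ (trans p (sym q))))

  ρ-conn : ∀ {i x y} → Conn (Edge S) (class-of β i) x y → Conn (Edge contracted) (class-of β′ i) (ρ x) (ρ y)
  ρ-conn (stop p) = stop (into (trans (β-ρ _) (out p)))
  ρ-conn {i} (step {x} {w} {y} p e c) with ρ x Fin.≟ ρ w
  ... | yes q = subst (λ z → Conn (Edge contracted) (class-of β′ i) z (ρ y)) (sym q) (ρ-conn c)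
  ... | no ne = step (into (trans (β-ρ x) (out p))) (ρ-edge e ne) (ρ-conn c)

record Quotients {m h : ℕ} (S : Graph m) (H : Graph h) (β : Fin m → Fin h) : Set where
  field
    onto : ∀ i → ∃ λ x → β x ≡ i
    classes-connected : ∀ {x y} → β x ≡ β y → Conn (Edge S) (class-of β (β x)) x y
    edge-up : ∀ {i j} → Edge H i j → ∃ λ x → ∃ λ y → (β x ≡ i × β y ≡ j) × Edge S x y
    edge-down : ∀ {x y} → β x ≢ β y → Edge S x y → Edge H (β x) (β y)

-- Induction on the vertices. Two vertices of one class are joined inside it, so some edge has both
-- ends there, and contracting that edge preserves `Quotients`. Once `β` is injective, it is an
-- isomorphism.
contracts-to : ∀ {m h} (S : Graph m) (H : Graph h) (β : Fin m → Fin h) → Quotients S H β →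
  ∃ λ k → Σ (Graph k) λ C → Contracts S C × H ≅ C
contracts-to {m} S H β q with any? (λ x → any? (λ y → ¬? (x Fin.≟ y) ×-dec (β x Fin.≟ β y)))
... | no none = m , S , done S , f , β , (λ i → proj₂ (onto i)) , (λ x → injective (proj₂ (onto (β x)))) , same
  where
  open Quotients q
  f : Fin _ → Fin m
  f i = proj₁ (onto i)
  injective : ∀ {x y} → β x ≡ β y → x ≡ y
  injective {x} {y} e with x Fin.≟ y
  ... | yes p = p
  ... | no ne = ⊥-elim (none (x , y , ne , e))
  same : ∀ a b → adj H a b ≡ adj S (f a) (f b)
  same a b = ≡-from-⇔ up down
    where
    up : Edge H a b → Edge S (f a) (f b)
    up e with x , y , (p , q) , g ← edge-up e = subst₂ (Edge S)
      (injective (trans p (sym (proj₂ (onto a))))) (injective (trans q (sym (proj₂ (onto b))))) g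
    down : Edge S (f a) (f b) → Edge H a b
    down g = subst₂ (Edge H) (proj₂ (onto a)) (proj₂ (onto b)) (edge-down
      (λ e → true≢false (subst (λ z → Edge S z (f b)) (injective e) g) (irrefl S (f b))) g)
contracts-to {zero} S H β q | yes (() , _)
contracts-to {suc m} S H β q | yes (x , y , ne , e) with Quotients.classes-connected q e
... | stop _ = ⊥-elim (ne refl)
... | step {w = w} p xw c = let k , C , cs , iso = contracts-to contracted H β′ quotients
                            in k , C , Contracts.step is-contraction cs , iso
  where
  open Quotients q
  open Contract S H β xw (sym (out (conn-start c)))
  quotients : Quotients contracted H β′
  quotients = record
    { onto = λ i → ρ (proj₁ (onto i)) , trans (β-ρ _) (proj₂ (onto i))
    ; classes-connected = λ {a} {b} f → subst₂ (Conn _ _) (ρ-ι a) (ρ-ι b) (ρ-conn (classes-connected f))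
    ; edge-up = up
    ; edge-down = down }
    where
    up : ∀ {i j} → Edge H i j → ∃ λ a → ∃ λ b → (β′ a ≡ i × β′ b ≡ j) × Edge contracted a b
    up f with a , b , (refl , refl) , g ← edge-up f = ρ a , ρ b , (β-ρ a , β-ρ b) ,
      ρ-edge g (λ r → true≢false (subst (Edge H (β a)) (trans (sym (β-ρ b)) (trans (cong β′ (sym r)) (β-ρ a))) f) (irrefl H (β a)))
    down : ∀ {a b} → β′ a ≢ β′ b → Edge contracted a b → Edge H (β′ a) (β′ b)
    down {a} {b} ne′ f with does-true (touch? a b) f
    ... | _ , inj₁ g = edge-down ne′ g
    ... | _ , inj₂ (inj₁ (r , g)) = subst (λ i → Edge H i (β′ b)) at-a (edge-down (λ z → ne′ (trans (sym at-a) z)) g)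
      where
      at-a : β w ≡ β′ a
      at-a = trans (out (conn-start c)) (cong β (sym r))
    ... | _ , inj₂ (inj₂ (r , g)) = edge-sym H (subst (λ i → Edge H i (β′ a)) at-b
        (edge-down (λ z → ne′ (sym (trans (sym at-b) z))) g))
      where
      at-b : β w ≡ β′ b
      at-b = trans (out (conn-start c)) (cong β (sym r))

-- A minor must be isomorphic to `H` after the contractions, while the bags may be adjacent where
-- `H` has no edge. `Kept` therefore deletes these surplus edges in advance.
model-minor : ∀ {h} (H : Graph h) (G : Graph n) {D : VSet n} → Model (Edge G) D h → H ≼ G
model-minor {n} {h} H G M = card U , S , (f , f-inj , (λ a b e → proj₁ (from-edge e))) , contracts-to S H β quotients
  where
  open Model M
  U : VSet n
  U = ⟦ (λ x → any? (λ i → x ∈? bag i)) ⟧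
  f : Fin (card U) → Fin n
  f = proj₁ (choose U (card U) ≤-refl)
  f∈ : ∀ a → f a ∈ U
  f∈ = proj₁ (proj₂ (choose U (card U) ≤-refl))
  f-inj : ∀ {a b} → f a ≡ f b → a ≡ b
  f-inj = proj₂ (proj₂ (choose U (card U) ≤-refl))
  β : Fin (card U) → Fin h
  β a = proj₁ (out (f∈ a))
  β-spec : ∀ a → f a ∈ bag (β a)
  β-spec a = proj₂ (out (f∈ a))
  index : ∀ {i x} → x ∈ bag i → ∃ λ a → f a ≡ x × β a ≡ i
  index {i} h with a , refl ← injective-onto f f∈ f-inj ≤-refl (into {P? = λ x → any? (λ i → x ∈? bag i)} (i , h)) =
    a , refl , disjoint (β-spec a) h
  Kept : Rel (card U)
  Kept a b = Edge G (f a) (f b) × (β a ≡ β b ⊎ Edge H (β a) (β b))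
  kept? : ∀ a b → Dec (Kept a b)
  kept? a b = edge? G (f a) (f b) ×-dec ((β a Fin.≟ β b) ⊎-dec edge? H (β a) (β b))
  kept-sym : ∀ {a b} → Kept a b → Kept b a
  kept-sym (e , inj₁ p) = edge-sym G e , inj₁ (sym p)
  kept-sym (e , inj₂ p) = edge-sym G e , inj₂ (edge-sym H p)
  S : Graph (card U)
  S = record
    { adj = λ a b → does (kept? a b)
    ; sym = λ a b → does-⇔ (mk⇔ kept-sym kept-sym) (kept? a b) (kept? b a)
    ; irrefl = λ a → dec-false (kept? a a) (λ p → true≢false (proj₁ p) (irrefl G (f a))) }
  from-edge : ∀ {a b} → Edge S a b → Kept a b
  from-edge {a} {b} = does-true (kept? a b)
  trace : ∀ {i x y} → Conn (Edge G) (bag i) x y → ∀ {a b} → f a ≡ x → f b ≡ y → β a ≡ i → Conn (Edge S) (class-of β i) a b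
  trace (stop _) p q r = subst (Conn _ _ _) (f-inj (trans p (sym q))) (stop (into r))
  trace (step _ e c) {a} refl q refl with a′ , refl , r ← index (conn-start c) =
    step (into refl) (dec-true (kept? a a′) (e , inj₁ (sym r))) (trace c refl q r)
  quotients : Quotients S H β
  quotients = record
    { onto = λ i → let a , _ , r = index (point∈ i) in a , r
    ; classes-connected = λ {a} {b} e → trace (connected (β a) (β-spec a) (subst (λ i → f b ∈ bag i) (sym e) (β-spec b))) refl refl refl
    ; edge-up = up
    ; edge-down = down }
    where
    up : ∀ {i j} → Edge H i j → ∃ λ a → ∃ λ b → (β a ≡ i × β b ≡ j) × Edge S a b
    up {i} {j} e with u , v , u∈ , v∈ , uv ← adjacent i j (λ { refl → true≢false e (irrefl H i) })
      with a , refl , refl ← index u∈ | b , refl , refl ← index v∈ =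
      a , b , (refl , refl) , dec-true (kept? a b) (uv , inj₂ e)
    down : ∀ {a b} → β a ≢ β b → Edge S a b → Edge H (β a) (β b)
    down ne e with from-edge e
    ... | _ , inj₁ p = ⊥-elim (ne p)
    ... | _ , inj₂ p = p

-- Assembling the colouring

-- The default is `k`, so vertices outside the component of `r` get depth `n`.
first : (ℕ → Bool) → ℕ → ℕ
first p zero = 0
first p (suc k) with p 0
... | true = 0
... | false = suc (first (p ∘ suc) k)

first-holds : (p : ℕ → Bool) (k : ℕ) → p k ≡ true → p (first p k) ≡ true
first-holds p zero h = h
first-holds p (suc k) h with p 0 in e
... | true = e
... | false = first-holds (p ∘ suc) k h

first-least : (p : ℕ → Bool) (k j : ℕ) → p j ≡ true → first p k ≤ j
first-least p zero j h = z≤n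
first-least p (suc k) j h with p 0 in e
first-least p (suc k) j h | true = z≤n
first-least p (suc k) zero h | false = ⊥-elim (true≢false h e)
first-least p (suc k) (suc j) h | false = s≤s (first-least (p ∘ suc) k j h)

module _ (G : Graph n) (r : Fin n) where
  open Reach G full r (holds refl)

  private
    d : Fin n → ℕ
    d v = first (λ k → reach k v) n

    d-reach : ∀ {v} → v ∈ reach n → v ∈ reach (d v)
    d-reach {v} (holds h) = holds (first-holds (λ k → reach k v) n h)

    d-least : ∀ {v} j → v ∈ reach j → d v ≤ j
    d-least {v} j (holds h) = first-least (λ k → reach k v) n j h

    Parent : Fin n → Fin n → Set
    Parent v u = Edge G v u × suc (d u) ≡ d v

    parent? : ∀ v → Dec (∃ (Parent v))
    parent? v = any? (λ u → edge? G v u ×-dec (suc (d u) ℕ.≟ d v))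

    pick : ∀ v → Dec (∃ (Parent v)) → Fin n
    pick v (yes (u , _)) = u
    pick v (no _) = v

    pick-spec : ∀ v (q : Dec (∃ (Parent v))) → ∃ (Parent v) → Parent v (pick v q)
    pick-spec v (yes (_ , p)) _ = p
    pick-spec v (no none) p = ⊥-elim (none p)

    step-reach : ∀ {u v} → u ∈ reach n → Edge G u v → v ∈ reach n
    step-reach h e = stable-n (reach-edge n h e (holds refl))

    d-edge : ∀ {u v} → u ∈ reach n → Edge G u v → d v ≤ suc (d u)
    d-edge {u} h e = d-least (suc (d u)) (reach-edge (d u) (d-reach h) e (holds refl))

    has-parent : ∀ {v j} → v ∈ reach n → d v ≡ suc j → ∃ (Parent v)
    has-parent {v} {j} h e with out (subst (λ k → v ∈ reach k) e (d-reach h))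
    ... | inj₁ a = ⊥-elim (<⇒≱ (≤-reflexive (sym e)) (d-least j a))
    ... | inj₂ (_ , u , a , uv) = u , edge-sym G uv , ≤-antisym
          (≤-trans (s≤s (d-least j a)) (≤-reflexive (sym e))) (d-edge (reach-complete (reach-sound j a)) uv)

  bfs : Layering G r
  bfs = record
    { V = reach n; d = d; parent = λ v → pick v (parent? v)
    ; closed = step-reach
    ; lipschitz = d-edge
    ; parent-edge = λ {v} h e → proj₁ (pick-spec v (parent? v) (has-parent h e))
    ; parent-depth = λ {v} h e → ℕ-suc-injective (trans (proj₂ (pick-spec v (parent? v) (has-parent h e))) e)
    ; bottom = λ {v} h e → out (subst (λ k → v ∈ reach k) e (d-reach h)) }

  bfs-reaches : ∀ {v} → Conn (Edge G) full r v → v ∈ Layering.V bfs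
  bfs-reaches = reach-complete

-- Roots of the components and the final colouring

firstFin : (Fin n → Bool) → Maybe (Fin n)
firstFin {zero} p = nothing
firstFin {suc n} p with p zero
... | true = just zero
... | false = Maybe.map suc (firstFin (p ∘ suc))

firstFin-cong : {p q : Fin n → Bool} → (∀ i → p i ≡ q i) → firstFin p ≡ firstFin q
firstFin-cong {zero} h = refl
firstFin-cong {suc n} {p} {q} h with p zero | q zero | h zero
... | true | true | _ = refl
... | false | false | _ = cong (Maybe.map suc) (firstFin-cong (h ∘ suc))

firstFin-finds : (p : Fin n → Bool) {i : Fin n} → p i ≡ true → ∃ λ j → firstFin p ≡ just j × p j ≡ true
firstFin-finds {suc n} p {i} h with p zero in e
firstFin-finds {suc n} p {i} h | true = zero , refl , e
firstFin-finds {suc n} p {zero} h | false = ⊥-elim (true≢false h e)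
firstFin-finds {suc n} p {suc i} h | false with j , f , g ← firstFin-finds (p ∘ suc) h = suc j , cong (Maybe.map suc) f , g

-- `N₁` bounds clusters on even layers, coloured without jumps; `N₂` bounds jump components on odd
-- layers, whose degree depends on `N₁`. The last summand counts even clusters adjacent to such a
-- component.
clusterSize : (Δ t : ℕ) → GridSize (suc (Δ + Δ * Δ) * Δ) t → ℕ
clusterSize Δ t size = N₁ + (N₂ + N₂ * (Δ * N₁))
  where
  N₁ = Bounds.layerBound Δ t size 0
  N₂ = Bounds.layerBound Δ t size N₁

module Main (G : Graph n) (Δ t : ℕ) (deg : Degree≤ G Δ) (size : GridSize (suc (Δ + Δ * Δ) * Δ) t)
  (no-model : ∀ D → ¬ Model (Edge G) D t) where

  private
    N : ℕ
    N = clusterSize Δ t size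

  Good : Fin n → (Fin n → Fin 3) → Set
  Good r c = ∀ i v D → Conn (Edge G) full r v → (∀ {u} → u ∈ D → Conn (Edge G) ⟦ (λ x → c x Fin.≟ i) ⟧ v u) → card D ≤ N

  abstract
    good : ∀ r → Σ (Fin n → Fin 3) (Good r)
    good r = O.colour , λ i v D rv reach → O.three-coloured i v D (bfs-reaches G r rv) reach
      where
      Λ : Layering G r
      Λ = bfs G r
      open Layering Λ
      -- With empty clusters the jump graph has the edges of `G` only, so the same construction
      -- serves both rounds.
      no-jumps : Fin n → VSet n
      no-jumps _ = ∅
      no-jumps-small : ∀ a → card (no-jumps a) ≤ 0
      no-jumps-small _ = ≤-reflexive (card-∅ {p = ∅} (λ { _ (holds ()) }))
      no-jumps-sym : ∀ {a b} → b ∈ no-jumps a → a ∈ no-jumps b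
      no-jumps-sym (holds ())
      module S₁ = ColourLayer Λ Δ deg t size no-model no-jumps 0 no-jumps-small no-jumps-sym
      N₁ : ℕ
      N₁ = Bounds.layerBound Δ t size 0
      colouring₁ : ∀ j → Σ (Fin n → Bool) λ colour → Clustered (Edge S₁.jump-graph) (layer j) colour N₁
      colouring₁ j = S₁.colour-layer j (λ { _ _ (holds ()) })
      c¹ : Fin n → Bool
      c¹ v = proj₁ (colouring₁ (d v)) v
      proper : ∀ {u v} → Edge G u v → u ≢ v
      proper {u} e refl = true≢false e (irrefl G u)
      clustered₁ : ∀ j → Clustered (Edge G) (layer j) c¹ N₁
      clustered₁ j b v D reach = proj₂ (colouring₁ j) b v D (λ h → conn-mono
        (λ e → S₁.to-joined (proper e , inj₁ e))
        (λ {x} m → into (proj₁ (out m) , trans (cong (λ k → proj₁ (colouring₁ k) x) (sym (proj₂ (out (proj₁ (out m))))))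
          (proj₂ (out m)))) (reach h))
      module E = EvenClusters Λ c¹ N₁ clustered₁
      module S₂ = ColourLayer Λ Δ deg t size no-model E.J N₁ E.J-small E.J-sym
      colouring₂ : ∀ j → Σ (Fin n → Bool) λ colour → Clustered (Edge S₂.jump-graph) (layer j) colour (Bounds.layerBound Δ t size N₁)
      colouring₂ j = S₂.colour-layer j (λ _ _ → E.J-local)
      c² : Fin n → Bool
      c² v = proj₁ (colouring₂ (d v)) v
      clustered₂ : ∀ j → Clustered (Edge S₂.jump-graph) (layer j) c² (Bounds.layerBound Δ t size N₁)
      clustered₂ j b v D reach = proj₂ (colouring₂ j) b v D (λ h → conn-mono (λ e → e)
        (λ {x} m → into (proj₁ (out m) , trans (cong (λ k → proj₁ (colouring₂ k) x) (sym (proj₂ (out (proj₁ (out m))))))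
          (proj₂ (out m)))) (reach h))
      module O = E.Odd Δ deg c² (Bounds.layerBound Δ t size N₁) clustered₂

  -- The least vertex of the component: a choice that depends only on the component, so all its
  -- vertices are coloured from the same layering.
  root : Fin n → Maybe (Fin n)
  root v = firstFin (λ r → comp G full r v)

  root-edge : ∀ {u v} → Conn (Edge G) full u v → root u ≡ root v
  root-edge c = firstFin-cong (λ r → ≡-from-⇔
    (λ h → eq {p = comp G full r} (into (conn-trans (out (holds h)) c)))
    (λ h → eq {p = comp G full r} (into (conn-trans (out (holds h)) (conn-sym (edge-sym G) c)))))

  root-found : ∀ v → ∃ λ r → root v ≡ just r × Conn (Edge G) full r v
  root-found v with r , e , h ← firstFin-finds (λ r → comp G full r v) (eq {p = comp G full v} (into (stop (holds refl)))) =
    r , e , out (holds h)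

  paint : Maybe (Fin n) → Fin n → Fin 3
  paint (just r) v = proj₁ (good r) v
  paint nothing v = zero

  part : Fin n → Fin 3
  part v = paint (root v) v

  part-clustered : ∀ i → ComponentsAtMost G (λ x → part x ≡ i) N
  part-clustered i v S reach with r , root≡ , rv ← root-found v =
    subst (_≤ N) (trans (sym (size-tabulate (lookup S))) (cong ∣_∣ (tabulate∘lookup S)))
      (proj₂ (good r) i v (lookup S) rv (λ {u} h → recolour root≡ (reach u (lookup⇒[]= u S (eq h)))))
    where
    recolour : ∀ {r w u} → root w ≡ just r → ConnIn G (λ x → part x ≡ i) w u →
      Conn (Edge G) ⟦ (λ x → proj₁ (good r) x Fin.≟ i) ⟧ w u
    recolour {r} {w} p (here q) = stop (into (trans (cong (λ m → paint m w) (sym p)) q))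
    recolour {r} {w} p (ConnIn.step q e c) = step (into (trans (cong (λ m → paint m w) (sym p)) q)) e
      (recolour (trans (sym (root-edge (conn-edge (holds refl) e (holds refl)))) p) c)

theorem1p5 : ∀ {h} (H : Graph h) (Δ : ℕ) → 1 ≤ Δ →
    Σ ℕ λ N → (∀ {n} (G : Graph n) → MaxDegree≤ G Δ → ¬ (H ≼ G) →
    Σ (Fin n → Fin 3) λ part → (∀ (i : Fin 3) → ComponentsAtMost G (λ x → part x ≡ i) N))
-- `grid-size` asks for a positive number of bags. The graph without vertices is a minor of every
-- graph, so no `G` is left to colour.
theorem1p5 {zero} H Δ _ = 0 , λ G _ not-minor → ⊥-elim (not-minor (model-minor H G {∅} record
  { bag = λ (); bag⊑ = λ (); point = λ (); point∈ = λ (); connected = λ (); disjoint = λ { {()} }; adjacent = λ () }))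
theorem1p5 {suc h} H Δ _ = clusterSize Δ (suc h) size , λ G deg not-minor →
  let open Main G Δ (suc h) (λ v → subst (_≤ Δ) (size-tabulate (adj G v)) (deg v)) size
             (λ D m → not-minor (model-minor H G m))
  in part , part-clustered
  where
  size : GridSize (suc (Δ + Δ * Δ) * Δ) (suc h)
  size = grid-size (suc (Δ + Δ * Δ) * Δ) (suc h) (s≤s z≤n)
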